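{- For every positive integer $n$, $$(2n)!\,A_n=\sum_{M\in\mathcal{M}(2n)}\omega X_{\mathrm{Inc}(P_M)},$$ where $\mathcal{M}(2n)$ is the set of all perfect matchings on the vertex set $[2n]$.
   Context: $A_n=\frac{1}{(2n)!}\sum_{\lambda\vdash n}|\phi(\lambda)|\,p_\lambda$, where for $\lambda=\langle 1^{m_1},\dots,n^{m_n}\rangle\vdash n$ ($m_k$ parts equal to $k$), $\phi(\lambda)=(2n)!\prod_{k=1}^n\frac{1}{m_k!}\left(\frac{4^k(4^k-1)B_{2k}}{(2k)(2k)!}\right)^{m_k}$ with $B_{2k}$ Bernoulli numbers, and $p_\lambda$ power sums. For a perfect matching $M$ on $[2n]$, $P_M$ is the poset whose elements are the edges of $M$, with $\{a,b\}<\{c,d\}$ iff $\max\{a,b\}<\min\{c,d\}$. $\mathrm{Inc}(P)$ is the incomparability graph of a poset $P$ (vertices the elements of $P$, edges between incomparable pairs). For a graph $G$ on vertex set $V$, its chromatic symmetric function is $X_G=\sum_\kappa\prod_{v\in V}x_{\kappa(v)}$, summed over proper colorings $\kappa\colon V\to\{1,2,\dots\}$. $\omega$ is the involution on symmetric functions with $\omega(h_n)=e_n$. -}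

module Defs where

open import Data.Bool using (Bool; true; false; _∧_; _∨_; not; if_then_else_)
open import Data.Nat as ℕ using (ℕ; zero; suc; _∸_; _≡ᵇ_; _<ᵇ_; _≤ᵇ_; _!)
open import Data.Nat.Properties using (_!≢0; m*n≢0)
open import Data.Nat.Combinatorics using (_C_)
open import Data.Fin as Fin using (Fin; toℕ)
open import Data.Vec as Vec using (Vec; lookup)
open import Data.List as List using (List; []; _∷_; [_]; map; concatMap; upTo; filterᵇ; length; zip; allFin; _++_; foldr)
open import Data.Product using (_×_; _,_; proj₁; proj₂)
open import Data.Integer using (+_)
open import Data.Rational as ℚ using (ℚ; 0ℚ; 1ℚ; _+_; _*_; -_; _-_; _/_; ∣_∣)
open import Relation.Nullary.Decidable using (⌊_⌋)
open import Relation.Nullary using (¬_)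
open import Relation.Binary.PropositionalEquality using (_≡_)

andB : List Bool → Bool
andB = foldr _∧_ true

allB : {X : Set} → (X → Bool) → List X → Bool
allB p xs = andB (map p xs)

countB : {X : Set} → (X → Bool) → List X → ℕ
countB p xs = length (filterᵇ p xs)

ℕtoℚ : ℕ → ℚ
ℕtoℚ n = + n / 1

sumℚ : List ℚ → ℚ
sumℚ = foldr _+_ 0ℚ

_^ℚ_ : ℚ → ℕ → ℚ
q ^ℚ zero  = 1ℚ
q ^ℚ suc k = q * (q ^ℚ k)

inv! : ℕ → ℚ
inv! m = (+ 1 / (m !)) {{m !≢0}}

nthℚ : List ℚ → ℕ → ℚ
nthℚ []       _       = 0ℚ
nthℚ (x ∷ _)  zero    = x
nthℚ (_ ∷ xs) (suc i) = nthℚ xs i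

-- Bernoulli numbers: B_0 = 1 and  sum_{j=0}^{m} C(m+1,j) B_j = 0  (m ≥ 1),
-- i.e.  B_m = - 1/(m+1) * sum_{j<m} C(m+1,j) B_j.

nextBernoulli : ℕ → List ℚ → ℚ
nextBernoulli zero    _  = 1ℚ
nextBernoulli (suc m) bs =
  - ((+ 1 / suc (suc m)) *
     sumℚ (map (λ j → ℕtoℚ (suc (suc m) C j) * nthℚ bs j) (upTo (suc m))))

bernoulliList : ℕ → List ℚ
bernoulliList zero    = []
bernoulliList (suc m) = bernoulliList m ++ [ nextBernoulli m (bernoulliList m) ]

bernoulli : ℕ → ℚ
bernoulli m = nthℚ (bernoulliList (suc m)) m

-- Formal power series in x_1, x_2, ... with rational coefficients.
-- A monomial x_1^{a_1} ... x_k^{a_k} is a list [a_1, ..., a_k];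
-- a series assigns a coefficient to every monomial.

Series : Set
Series = List ℕ → ℚ

splits : List ℕ → List (List ℕ × List ℕ)
splits []      = [ ([] , []) ]
splits (a ∷ α) =
  concatMap (λ b → map (λ p → (b ∷ proj₁ p , (a ∸ b) ∷ proj₂ p)) (splits α))
            (upTo (suc a))

zeroS : Series
zeroS _ = 0ℚ

oneS : Series
oneS α = if allB (λ a → a ≡ᵇ 0) α then 1ℚ else 0ℚ

addS : Series → Series → Series
addS f g α = f α + g α

scaleS : ℚ → Series → Series
scaleS c f α = c * f α

mulS : Series → Series → Series
mulS f g α = sumℚ (map (λ p → f (proj₁ p) * g (proj₂ p)) (splits α))

sumS : List Series → Series
sumS = foldr addS zeroS

prodS : List Series → Series
prodS = foldr mulS oneS

powS : Series → ℕ → Series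
powS f zero    = oneS
powS f (suc k) = mulS f (powS f k)

degree : List ℕ → ℕ
degree = foldr ℕ._+_ 0

hS : ℕ → Series
hS k α = if degree α ≡ᵇ k then 1ℚ else 0ℚ

eS : ℕ → Series
eS k α = if (degree α ≡ᵇ k) ∧ allB (λ a → a ≤ᵇ 1) α then 1ℚ else 0ℚ

pS : ℕ → Series
pS k α = if (degree α ≡ᵇ k) ∧ (countB (λ a → 0 <ᵇ a) α ≡ᵇ 1) then 1ℚ else 0ℚ

-- The involution ω.  The ring of symmetric functions over ℚ is the
-- polynomial ring ℚ[h_1, h_2, ...] and ω is the ring homomorphism with
-- ω(h_k) = e_k.  A polynomial in the h's is a list of terms
-- (coefficient , [k_1, ..., k_r]) standing for  coefficient * h_{k_1}...h_{k_r}.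

Poly : Set
Poly = List (ℚ × List ℕ)

evalPoly : (ℕ → Series) → Poly → Series
evalPoly g P = sumS (map (λ t → scaleS (proj₁ t) (prodS (map g (proj₂ t)))) P)

IsOmegaOf : Series → Series → Set
IsOmegaOf f g =
  (Q : Poly) → (∀ α → evalPoly hS Q α ≡ f α) → ∀ α → evalPoly eS Q α ≡ g α

-- Chromatic symmetric function of a graph with vertex list vs
-- (pairwise distinct vertices) and symmetric adjacency adj.
-- Coefficient of x^α = number of proper colorings κ with |κ⁻¹(i)| = α_i
-- for every colour i (colours are 0,1,..., colour i ↔ variable x_{i+1}).

allLists : ℕ → ℕ → List (List ℕ)
allLists L zero    = [ [] ]
allLists L (suc m) = concatMap (λ c → map (c ∷_) (allLists L m)) (upTo L)

properB : {V : Set} → (V → V → Bool) → List (V × ℕ) → Bool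
properB adj []             = true
properB adj ((v , c) ∷ xs) =
  allB (λ w → not (adj v (proj₁ w)) ∨ not (c ≡ᵇ proj₂ w)) xs ∧ properB adj xs

countsB : List ℕ → List ℕ → Bool
countsB α cs = andB (map (λ p → countB (λ c → c ≡ᵇ proj₁ p) cs ≡ᵇ proj₂ p)
                        (zip (upTo (length α)) α))

chromatic : {V : Set} → List V → (V → V → Bool) → Series
chromatic vs adj α =
  ℕtoℚ (length (filterᵇ (λ cs → properB adj (zip vs cs) ∧ countsB α cs)
                       (allLists (length α) (length vs))))

-- Perfect matchings on [2n] = Fin (2n), as fixed-point-free involutions
-- (the matching {{i, σ i}}).

allVecs : (m k : ℕ) → List (Vec (Fin m) k)
allVecs m zero    = [ Vec.[] ]
allVecs m (suc k) = concatMap (λ i → map (i Vec.∷_) (allVecs m k)) (allFin m)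

isMatchingB : {m : ℕ} → Vec (Fin m) m → Bool
isMatchingB {m} σ =
  allB (λ i → ⌊ lookup σ (lookup σ i) Fin.≟ i ⌋ ∧ not ⌊ lookup σ i Fin.≟ i ⌋)
      (allFin m)

matchings : (n : ℕ) → List (Vec (Fin (2 ℕ.* n)) (2 ℕ.* n))
matchings n = filterᵇ (λ σ → isMatchingB σ) (allVecs (2 ℕ.* n) (2 ℕ.* n))

edgesOf : {m : ℕ} → Vec (Fin m) m → List (ℕ × ℕ)
edgesOf {m} σ =
  map (λ i → (toℕ i , toℕ (lookup σ i)))
      (filterᵇ (λ i → toℕ i <ᵇ toℕ (lookup σ i)) (allFin m))

-- {a,b} < {c,d} in P_M  iff  max{a,b} < min{c,d}   (edges stored with a < b)
precB : ℕ × ℕ → ℕ × ℕ → Bool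
precB (a , b) (c , d) = b <ᵇ c

-- incomparability (for distinct edges)
incAdj : ℕ × ℕ → ℕ × ℕ → Bool
incAdj e f = not (precB e f) ∧ not (precB f e)

XIncP : {m : ℕ} → Vec (Fin m) m → Series
XIncP σ = chromatic (edgesOf σ) incAdj

sumMatchings : ℕ → Series
sumMatchings n = sumS (map XIncP (matchings n))

-- A_n.  Partitions λ ⊢ n as multiplicity lists [m_1, ..., m_n] with
-- sum_k k m_k = n.

weight : List ℕ → ℕ
weight ms = foldr ℕ._+_ 0 (map (λ p → proj₁ p ℕ.* proj₂ p) (zip (List.drop 1 (upTo (suc (length ms)))) ms))

partitionsMult : ℕ → List (List ℕ)
partitionsMult n = filterᵇ (λ ms → weight ms ≡ᵇ n) (allLists (suc n) n)

coeffK : ℕ → ℚ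
coeffK zero    = 0ℚ
coeffK (suc j) =
  ((+ (4 ℕ.^ suc j ℕ.* (4 ℕ.^ suc j ∸ 1)) / (2 ℕ.* suc j ℕ.* (2 ℕ.* suc j) !))
     {{m*n≢0 (2 ℕ.* suc j) ((2 ℕ.* suc j) !) {{_}} {{(2 ℕ.* suc j) !≢0}}}})
  * bernoulli (2 ℕ.* suc j)

phi : ℕ → List ℕ → ℚ
phi n ms = ℕtoℚ ((2 ℕ.* n) !) *
  foldr _*_ 1ℚ (map (λ p → inv! (proj₂ p) * (coeffK (proj₁ p) ^ℚ proj₂ p))
                    (zip (List.drop 1 (upTo (suc (length ms)))) ms))

powerSumλ : List ℕ → Series
powerSumλ ms = prodS (map (λ p → powS (pS (proj₁ p)) (proj₂ p))
                          (zip (List.drop 1 (upTo (suc (length ms)))) ms))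

A : ℕ → Series
A n = scaleS (inv! (2 ℕ.* n))
             (sumS (map (λ ms → scaleS ∣ phi n ms ∣ (powerSumλ ms)) (partitionsMult n)))

{-# OPTIONS --safe #-}
module Submission where

-- A proper colouring of Inc(P_M) cuts M into chains {a₁,b₁} < {a₂,b₂} < …, so (M, κ) can be
-- recovered from the word giving each vertex the colour of its edge, and every word with even
-- letter multiplicities arises.  Hence the left-hand side before ω has x^α-coefficient
-- (2n)! / ∏ (2αᵢ)!, that is, Σ_M X_{Inc(P_M)} is the y^n-coefficient of (2n)! ∏ᵢ cosh √(xᵢ y).
--
-- For ω, replace h_r by the supersymmetric Σ_{i+j=r} h_i(x) e_j(y): since the substitution
-- x₁ = −y₁ cancels these variables, the coefficients in y are determined by those in x, and
-- cosh √(x y) turns into 1 / cos √(x y).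
--
-- On the other side, log (1 / cos √y) = Σ_k |c_k| y^k with c_k the coefficients in φ.  The
-- Bernoulli generating function gives c_k through x tanh x, and the Riccati equation of tan
-- fixes the signs.  Both Σ_λ and ∏ᵢ then solve the same first-order equation for the degree
-- derivation, whose solutions are unique.
open import Defs
open import Algebra.Bundles using (CommutativeRing; AbelianGroup; module CommutativeMonoid)
import Algebra.Construct.Pointwise as Pointwise
import Algebra.Solver.Ring
open import Algebra.Solver.Ring.AlmostCommutativeRing using (fromCommutativeRing; _-Raw-AlmostCommutative⟶_)
open import Data.Bool as Bool using (Bool; true; false; _∧_; _∨_; not; if_then_else_; T)
import Data.Bool.Properties as Bool
open import Data.Fin as Fin using (Fin; toℕ; fromℕ<)
import Data.Fin.Properties as Fin
import Data.Integer as ℤ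
import Data.Integer.Properties as ℤ
open import Data.List as List
  using (List; []; _∷_; [_]; map; concatMap; foldr; applyUpTo; upTo; allFin; length; filterᵇ; zip; _++_)
import Data.List.Properties as List
open import Data.List.Membership.Propositional using (_∈_; find; lose)
open import Data.List.Membership.Propositional.Properties
open import Data.List.Relation.Unary.All as All using (All; []; _∷_)
import Data.List.Relation.Unary.All.Properties as All
open import Data.List.Relation.Unary.AllPairs using (AllPairs; []; _∷_)
import Data.List.Relation.Unary.AllPairs.Properties as AllPairs
open import Data.List.Relation.Unary.Any using (here; there)
open import Data.List.Relation.Unary.Unique.Propositional using (Unique)
import Data.List.Relation.Unary.Unique.Propositional.Properties as Unique
open import Data.Maybe using (Maybe; just; nothing)
open import Data.Nat as ℕ using (ℕ; zero; suc; _∸_; _≤_; _<_; z≤n; s≤s; _≡ᵇ_; _≤ᵇ_; _<ᵇ_; _!)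
import Data.Nat.Properties as ℕ
import Data.Nat.DivMod as ℕ
open import Data.Nat.Combinatorics as ℕ using (_C_)
import Data.Nat.Combinatorics.Specification as ℕ
open import Data.Nat.Induction using (<-rec)
open import Data.Product using (_×_; _,_; proj₁; proj₂; ∃; ∃₂)
open import Data.Rational as ℚ using (ℚ; 0ℚ; 1ℚ; _+_; _*_; -_; _/_; ∣_∣; toℚᵘ; fromℚᵘ)
import Data.Rational.Properties as ℚ
open import Data.Rational.Solver renaming (module +-*-Solver to ℚ-Solver)
open import Data.Rational.Unnormalised as ℚᵘ using (mkℚᵘ; *≡*)
import Data.Rational.Unnormalised.Properties as ℚᵘ
open import Data.Sum using (_⊎_; inj₁; inj₂)
open import Data.Unit using (tt)
open import Data.Vec as Vec using (Vec; lookup)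
import Data.Vec.Properties as Vec
open import Function using (_∘_; flip; id; _$_; Equivalence)
open import Relation.Binary.Definitions using (tri<; tri≈; tri>)
open import Relation.Binary.PropositionalEquality hiding ([_])
open import Relation.Nullary using (¬_; yes; no; contradiction)
open import Relation.Nullary.Decidable using (T?; ⌊_⌋; toWitness; fromWitness)
open import Algebra.Properties.CommutativeSemigroup
  (CommutativeMonoid.commutativeSemigroup ℚ.+-0-commutativeMonoid) using (interchange)
open import Algebra.Properties.CommutativeSemigroup ℕ.+-commutativeSemigroup
  using () renaming (interchange to ℕ-interchange)

-- Sums over lists, antidiagonals and splittings of exponents

-- `IsOmegaOf` speaks about every polynomial `Q` in the h's that represents the given series, and
-- such a `Q` cannot be read off from the coefficients. What has to be shown is that the
-- h-evaluation of `Q` determines its e-evaluation. Both are restrictions of one series in two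
-- alphabets, and the relation obtained by cancelling x₁ against y₁ rebuilds one restriction from
-- the other. It also explains the secant: a product of f over the x's and s over the y's satisfies
-- the relation when f(-y) s(y) = 1. On the power sum side, |φ| is multiplicative, so the absolute
-- values pass to the single coefficients c_k. No logarithm and no infinite product is formed: the
-- exponentials of c_k p_k are cut off after the n-th power, which changes nothing in degree at most
-- n, and their differential equations carry this degree bound. Coloured matchings and words are
-- matched by a relation, not by a pair of inverse functions: it is total and injective in both
-- directions, and the lists involved have no repetitions, so their lengths agree.

∑ : {X : Set} → List X → (X → ℚ) → ℚ
∑ xs f = sumℚ (map f xs)

module _ {X : Set} where

  ∑-cong : ∀ (xs : List X) {f g : X → ℚ} → (∀ x → f x ≡ g x) → ∑ xs f ≡ ∑ xs g
  ∑-cong []       eq = refl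
  ∑-cong (x ∷ xs) eq = cong₂ _+_ (eq x) (∑-cong xs eq)

  ∑-zero : ∀ (xs : List X) → ∑ xs (λ _ → 0ℚ) ≡ 0ℚ
  ∑-zero []       = refl
  ∑-zero (x ∷ xs) = trans (ℚ.+-identityˡ _) (∑-zero xs)

  ∑-+ : ∀ (xs : List X) (f g : X → ℚ) → ∑ xs (λ x → f x + g x) ≡ ∑ xs f + ∑ xs g
  ∑-+ []       f g = refl
  ∑-+ (x ∷ xs) f g = trans (cong (f x + g x +_) (∑-+ xs f g)) (interchange (f x) (g x) _ _)

  ∑-*ˡ : ∀ (xs : List X) q (f : X → ℚ) → ∑ xs (λ x → q * f x) ≡ q * ∑ xs f
  ∑-*ˡ []       q f = sym (ℚ.*-zeroʳ q)
  ∑-*ˡ (x ∷ xs) q f = trans (cong (q * f x +_) (∑-*ˡ xs q f)) (sym (ℚ.*-distribˡ-+ q (f x) _))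

  ∑-++ : ∀ (xs ys : List X) (f : X → ℚ) → ∑ (xs ++ ys) f ≡ ∑ xs f + ∑ ys f
  ∑-++ []       ys f = sym (ℚ.+-identityˡ _)
  ∑-++ (x ∷ xs) ys f = trans (cong (f x +_) (∑-++ xs ys f)) (sym (ℚ.+-assoc (f x) _ _))

  ∑-map : ∀ {Y : Set} (xs : List Y) (g : Y → X) (f : X → ℚ) → ∑ (map g xs) f ≡ ∑ xs (f ∘ g)
  ∑-map xs g f = cong sumℚ (sym (List.map-∘ xs))

  ∑-concatMap : ∀ {Y : Set} (xs : List Y) (g : Y → List X) (f : X → ℚ) →
                ∑ (concatMap g xs) f ≡ ∑ xs (λ y → ∑ (g y) f)
  ∑-concatMap []       g f = refl
  ∑-concatMap (x ∷ xs) g f =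
    trans (∑-++ (g x) (concatMap g xs) f) (cong (∑ (g x) f +_) (∑-concatMap xs g f))

-- Recursion on the total keeps the pairs i + j = a free of truncated subtraction, and
-- `antidiag-cong` hands out the equation i + j = a. `antidiag-upTo` connects this form with the `∸`
-- of `splits`.
antidiag : ℕ → (ℕ → ℕ → ℚ) → ℚ
antidiag zero    h = h 0 0
antidiag (suc a) h = h 0 (suc a) + antidiag a (λ i j → h (suc i) j)

antidiag-cong : ∀ a {h k : ℕ → ℕ → ℚ} → (∀ i j → i ℕ.+ j ≡ a → h i j ≡ k i j) →
                antidiag a h ≡ antidiag a k
antidiag-cong zero    eq = eq 0 0 refl
antidiag-cong (suc a) eq =
  cong₂ _+_ (eq 0 (suc a) refl) (antidiag-cong a λ i j p → eq (suc i) j (cong suc p))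

antidiag-zero : ∀ a → antidiag a (λ _ _ → 0ℚ) ≡ 0ℚ
antidiag-zero zero    = refl
antidiag-zero (suc a) = trans (ℚ.+-identityˡ _) (antidiag-zero a)

antidiag-+ : ∀ a h k → antidiag a (λ i j → h i j + k i j) ≡ antidiag a h + antidiag a k
antidiag-+ zero    h k = refl
antidiag-+ (suc a) h k =
  trans (cong (h 0 (suc a) + k 0 (suc a) +_) (antidiag-+ a (h ∘ suc) (k ∘ suc))) (interchange (h 0 (suc a)) _ _ _)

antidiag-*ˡ : ∀ a q h → antidiag a (λ i j → q * h i j) ≡ q * antidiag a h
antidiag-*ˡ zero    q h = refl
antidiag-*ˡ (suc a) q h =
  trans (cong (q * h 0 (suc a) +_) (antidiag-*ˡ a q (h ∘ suc))) (sym (ℚ.*-distribˡ-+ q (h 0 (suc a)) _))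

antidiag-*ʳ : ∀ a q h → antidiag a (λ i j → h i j * q) ≡ antidiag a h * q
antidiag-*ʳ a q h = trans (antidiag-cong a λ i j _ → ℚ.*-comm (h i j) q)
  (trans (antidiag-*ˡ a q h) (ℚ.*-comm q _))

antidiag-last : ∀ a h → antidiag (suc a) h ≡ antidiag a (λ i j → h i (suc j)) + h (suc a) 0
antidiag-last zero    h = refl
antidiag-last (suc a) h =
  trans (cong (h 0 (2 ℕ.+ a) +_) (antidiag-last a (λ i j → h (suc i) j)))
        (sym (ℚ.+-assoc (h 0 (2 ℕ.+ a)) _ _))

antidiag-comm : ∀ a h → antidiag a h ≡ antidiag a (flip h)
antidiag-comm zero    h = refl
antidiag-comm (suc a) h = begin
  h 0 (suc a) + antidiag a (λ i j → h (suc i) j) ≡⟨ cong (h 0 (suc a) +_) (antidiag-comm a _) ⟩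
  h 0 (suc a) + antidiag a (λ i j → h (suc j) i) ≡⟨ ℚ.+-comm (h 0 (suc a)) _ ⟩
  antidiag a (λ i j → h (suc j) i) + h 0 (suc a) ≡⟨ antidiag-last a (flip h) ⟨
  antidiag (suc a) (flip h)                      ∎
  where open ≡-Reasoning

antidiag-assoc : ∀ a (h : ℕ → ℕ → ℕ → ℚ) →
  antidiag a (λ i j → antidiag i (λ k l → h k l j)) ≡ antidiag a (λ k m → antidiag m (h k))
antidiag-assoc zero    h = refl
antidiag-assoc (suc a) h = begin
  h 0 0 (suc a) + antidiag a (λ i j → h 0 (suc i) j + antidiag i (λ k l → h (suc k) l j))
    ≡⟨ cong (h 0 0 (suc a) +_) (trans (antidiag-+ a _ _)
         (cong (antidiag a (λ l j → h 0 (suc l) j) +_) (antidiag-assoc a (h ∘ suc)))) ⟩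
  h 0 0 (suc a) + (antidiag a (λ l j → h 0 (suc l) j) + antidiag a (λ k m → antidiag m (h (suc k))))
    ≡⟨ ℚ.+-assoc (h 0 0 (suc a)) _ _ ⟨
  antidiag (suc a) (λ k m → antidiag m (h k)) ∎
  where open ≡-Reasoning

∑-antidiag : ∀ {X : Set} (xs : List X) a (h : X → ℕ → ℕ → ℚ) →
  ∑ xs (λ x → antidiag a (h x)) ≡ antidiag a (λ i j → ∑ xs (λ x → h x i j))
∑-antidiag []       a h = sym (antidiag-zero a)
∑-antidiag (x ∷ xs) a h =
  trans (cong (antidiag a (h x) +_) (∑-antidiag xs a h)) (sym (antidiag-+ a (h x) _))

antidiag-upTo : ∀ a h → antidiag a h ≡ ∑ (upTo (suc a)) (λ b → h b (a ∸ b))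
antidiag-upTo a h = trans (go a h) (cong sumℚ (sym (List.map-applyUpTo id (λ b → h b (a ∸ b)) (suc a))))
  where
  go : ∀ a h → antidiag a h ≡ sumℚ (applyUpTo (λ b → h b (a ∸ b)) (suc a))
  go zero    h = sym (ℚ.+-identityʳ (h 0 0))
  go (suc a) h = cong (h 0 (suc a) +_) (go a (λ i j → h (suc i) j))

-- One antidiagonal per variable, so that the laws of products of series reduce to those of a single
-- antidiagonal. `mulS` is handled in this form.
splitSum : List ℕ → (List ℕ → List ℕ → ℚ) → ℚ
splitSum []      h = h [] []
splitSum (a ∷ α) h = antidiag a λ b c → splitSum α λ β γ → h (b ∷ β) (c ∷ γ)

splitSum-splits : ∀ α h → splitSum α h ≡ ∑ (splits α) (λ p → h (proj₁ p) (proj₂ p))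
splitSum-splits []      h = sym (ℚ.+-identityʳ (h [] []))
splitSum-splits (a ∷ α) h = sym (begin
  ∑ (splits (a ∷ α)) h′
    ≡⟨ ∑-concatMap (upTo (suc a)) (λ b → map (λ p → b ∷ proj₁ p , (a ∸ b) ∷ proj₂ p) (splits α)) h′ ⟩
  ∑ (upTo (suc a)) (λ b → ∑ (map (λ p → b ∷ proj₁ p , (a ∸ b) ∷ proj₂ p) (splits α)) h′)
    ≡⟨ ∑-cong (upTo (suc a)) (λ b → trans
         (∑-map (splits α) (λ p → b ∷ proj₁ p , (a ∸ b) ∷ proj₂ p) h′)
         (sym (splitSum-splits α (λ β γ → h (b ∷ β) ((a ∸ b) ∷ γ))))) ⟩
  ∑ (upTo (suc a)) (λ b → splitSum α λ β γ → h (b ∷ β) ((a ∸ b) ∷ γ))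
    ≡⟨ antidiag-upTo a (λ b c → splitSum α λ β γ → h (b ∷ β) (c ∷ γ)) ⟨
  splitSum (a ∷ α) h ∎)
  where
  open ≡-Reasoning
  h′ : List ℕ × List ℕ → ℚ
  h′ p = h (proj₁ p) (proj₂ p)

splitSum-cong : ∀ α {h k : List ℕ → List ℕ → ℚ} →
  (∀ β γ → degree β ℕ.+ degree γ ≡ degree α → h β γ ≡ k β γ) → splitSum α h ≡ splitSum α k
splitSum-cong []      eq = eq [] [] refl
splitSum-cong (a ∷ α) eq = antidiag-cong a λ b c p → splitSum-cong α λ β γ q →
  eq (b ∷ β) (c ∷ γ) (trans (ℕ-interchange b (degree β) c (degree γ)) (cong₂ ℕ._+_ p q))

splitSum-zero : ∀ α → splitSum α (λ _ _ → 0ℚ) ≡ 0ℚ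
splitSum-zero []      = refl
splitSum-zero (a ∷ α) = trans (antidiag-cong a λ _ _ _ → splitSum-zero α) (antidiag-zero a)

splitSum-+ : ∀ α h k → splitSum α (λ β γ → h β γ + k β γ) ≡ splitSum α h + splitSum α k
splitSum-+ []      h k = refl
splitSum-+ (a ∷ α) h k =
  trans (antidiag-cong a λ b c _ → splitSum-+ α (λ β γ → h (b ∷ β) (c ∷ γ)) _) (antidiag-+ a _ _)

splitSum-*ˡ : ∀ α q h → splitSum α (λ β γ → q * h β γ) ≡ q * splitSum α h
splitSum-*ˡ []      q h = refl
splitSum-*ˡ (a ∷ α) q h = trans (antidiag-cong a λ _ _ _ → splitSum-*ˡ α q _) (antidiag-*ˡ a q _)

splitSum-*ʳ : ∀ α q h → splitSum α (λ β γ → h β γ * q) ≡ splitSum α h * q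
splitSum-*ʳ []      q h = refl
splitSum-*ʳ (a ∷ α) q h = trans (antidiag-cong a λ _ _ _ → splitSum-*ʳ α q _) (antidiag-*ʳ a q _)

splitSum-antidiag : ∀ α a (h : List ℕ → List ℕ → ℕ → ℕ → ℚ) →
  splitSum α (λ β γ → antidiag a (h β γ)) ≡ antidiag a (λ i j → splitSum α (λ β γ → h β γ i j))
splitSum-antidiag α zero    h = refl
splitSum-antidiag α (suc a) h = trans (splitSum-+ α (λ β γ → h β γ 0 (suc a)) _)
  (cong (splitSum α (λ β γ → h β γ 0 (suc a)) +_) (splitSum-antidiag α a (λ β γ i j → h β γ (suc i) j)))

splitSum-comm : ∀ α h → splitSum α h ≡ splitSum α (flip h)
splitSum-comm []      h = refl
splitSum-comm (a ∷ α) h = trans (antidiag-comm a _) (antidiag-cong a λ _ _ _ → splitSum-comm α _)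

splitSum-assoc : ∀ α (h : List ℕ → List ℕ → List ℕ → ℚ) →
  splitSum α (λ β γ → splitSum β (λ β₁ β₂ → h β₁ β₂ γ)) ≡ splitSum α (λ β δ → splitSum δ (h β))
splitSum-assoc []      h = refl
splitSum-assoc (a ∷ α) h = begin
  antidiag a (λ i j → splitSum α λ β γ → antidiag i λ k l → splitSum β λ β₁ β₂ → h (k ∷ β₁) (l ∷ β₂) (j ∷ γ))
    ≡⟨ antidiag-cong a (λ i j _ → splitSum-antidiag α i _) ⟩
  antidiag a (λ i j → antidiag i λ k l → splitSum α λ β γ → splitSum β λ β₁ β₂ → h (k ∷ β₁) (l ∷ β₂) (j ∷ γ))
    ≡⟨ antidiag-cong a (λ i j _ → antidiag-cong i λ k l _ → splitSum-assoc α _) ⟩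
  antidiag a (λ i j → antidiag i λ k l → splitSum α λ β δ → splitSum δ λ δ₁ δ₂ → h (k ∷ β) (l ∷ δ₁) (j ∷ δ₂))
    ≡⟨ antidiag-assoc a _ ⟩
  antidiag a (λ k m → antidiag m λ l j → splitSum α λ β δ → splitSum δ λ δ₁ δ₂ → h (k ∷ β) (l ∷ δ₁) (j ∷ δ₂))
    ≡⟨ antidiag-cong a (λ k m _ → splitSum-antidiag α m _) ⟨
  splitSum (a ∷ α) (λ β δ → splitSum δ (h β)) ∎
  where open ≡-Reasoning

mulS-splitSum : ∀ f g α → mulS f g α ≡ splitSum α (λ β γ → f β * g γ)
mulS-splitSum f g α = sym (splitSum-splits α _)

-- Rational factorials

-- A quotient `_/_` is normalised by a gcd and does not reduce on variables, so equations between
-- fractions are checked in `ℚᵘ` and carried over by `fromℚᵘ`.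
fromℚᵘ-homo-* : ∀ p q → fromℚᵘ (p ℚᵘ.* q) ≡ fromℚᵘ p * fromℚᵘ q
fromℚᵘ-homo-* p q = ℚ.toℚᵘ-injective $ begin
  toℚᵘ (fromℚᵘ (p ℚᵘ.* q))              ≈⟨ ℚ.toℚᵘ-fromℚᵘ (p ℚᵘ.* q) ⟩
  p ℚᵘ.* q                              ≈⟨ ℚᵘ.*-cong (ℚ.toℚᵘ-fromℚᵘ p) (ℚ.toℚᵘ-fromℚᵘ q) ⟨
  toℚᵘ (fromℚᵘ p) ℚᵘ.* toℚᵘ (fromℚᵘ q)  ≈⟨ ℚ.toℚᵘ-homo-* (fromℚᵘ p) (fromℚᵘ q) ⟨
  toℚᵘ (fromℚᵘ p * fromℚᵘ q)            ∎
  where open ℚᵘ.≃-Reasoning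

fromℚᵘ-homo-+ : ∀ p q → fromℚᵘ (p ℚᵘ.+ q) ≡ fromℚᵘ p + fromℚᵘ q
fromℚᵘ-homo-+ p q = ℚ.toℚᵘ-injective $ begin
  toℚᵘ (fromℚᵘ (p ℚᵘ.+ q))              ≈⟨ ℚ.toℚᵘ-fromℚᵘ (p ℚᵘ.+ q) ⟩
  p ℚᵘ.+ q                              ≈⟨ ℚᵘ.+-cong (ℚ.toℚᵘ-fromℚᵘ p) (ℚ.toℚᵘ-fromℚᵘ q) ⟨
  toℚᵘ (fromℚᵘ p) ℚᵘ.+ toℚᵘ (fromℚᵘ q)  ≈⟨ ℚ.toℚᵘ-homo-+ (fromℚᵘ p) (fromℚᵘ q) ⟨
  toℚᵘ (fromℚᵘ p + fromℚᵘ q)            ∎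
  where open ℚᵘ.≃-Reasoning

ℕtoℚ-* : ∀ m n → ℕtoℚ (m ℕ.* n) ≡ ℕtoℚ m * ℕtoℚ n
ℕtoℚ-* m n = trans
  (cong (_/ 1) (ℤ.pos-* m n)) (fromℚᵘ-homo-* (mkℚᵘ (ℤ.+ m) 0) (mkℚᵘ (ℤ.+ n) 0))

ℕtoℚ-+ : ∀ m n → ℕtoℚ (m ℕ.+ n) ≡ ℕtoℚ m + ℕtoℚ n
ℕtoℚ-+ m n = trans
  (cong (_/ 1) (trans (ℤ.pos-+ m n)
    (sym (cong₂ ℤ._+_ (ℤ.*-identityʳ (ℤ.+ m)) (ℤ.*-identityʳ (ℤ.+ n))))))
  (fromℚᵘ-homo-+ (mkℚᵘ (ℤ.+ m) 0) (mkℚᵘ (ℤ.+ n) 0))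

/-as-* : ∀ a d .{{_ : ℕ.NonZero d}} → ℤ.+ a / d ≡ ℕtoℚ a * (ℤ.+ 1 / d)
/-as-* a (suc d) = trans
  (ℚ.fromℚᵘ-cong {mkℚᵘ (ℤ.+ a) d} {mkℚᵘ (ℤ.+ a) 0 ℚᵘ.* mkℚᵘ (ℤ.+ 1) d} (*≡* (cong₂ ℤ._*_
    (sym (ℤ.*-identityʳ (ℤ.+ a))) (cong (λ e → ℤ.+ suc e) (ℕ.+-identityʳ d)))))
  (fromℚᵘ-homo-* (mkℚᵘ (ℤ.+ a) 0) (mkℚᵘ (ℤ.+ 1) d))

ℕtoℚ-inverse : ∀ d .{{_ : ℕ.NonZero d}} → ℕtoℚ d * (ℤ.+ 1 / d) ≡ 1ℚ
ℕtoℚ-inverse (suc d) = trans (sym (/-as-* (suc d) (suc d)))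
  (ℚ.fromℚᵘ-cong {mkℚᵘ (ℤ.+ suc d) d} {mkℚᵘ (ℤ.+ 1) 0} (*≡* (ℤ.*-comm (ℤ.+ suc d) (ℤ.+ 1))))

*-cancelˡ-inverse : ∀ q q⁻¹ → q * q⁻¹ ≡ 1ℚ → ∀ {x y} → q * x ≡ q * y → x ≡ y
*-cancelˡ-inverse q q⁻¹ inv {x} {y} eq = begin
  x                ≡⟨ unit x ⟩
  q⁻¹ * (q * x)    ≡⟨ cong (q⁻¹ *_) eq ⟩
  q⁻¹ * (q * y)    ≡⟨ unit y ⟨
  y                ∎
  where
  open ≡-Reasoning
  unit : ∀ z → z ≡ q⁻¹ * (q * z)
  unit z = begin
    z               ≡⟨ ℚ.*-identityˡ z ⟨
    1ℚ * z          ≡⟨ cong (_* z) (trans (sym inv) (ℚ.*-comm q q⁻¹)) ⟩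
    q⁻¹ * q * z     ≡⟨ ℚ.*-assoc q⁻¹ q z ⟩
    q⁻¹ * (q * z)   ∎

ℕtoℚ-cancelˡ : ∀ d .{{_ : ℕ.NonZero d}} {x y} → ℕtoℚ d * x ≡ ℕtoℚ d * y → x ≡ y
ℕtoℚ-cancelˡ d = *-cancelˡ-inverse (ℕtoℚ d) (ℤ.+ 1 / d) (ℕtoℚ-inverse d)

!-inv! : ∀ m → ℕtoℚ (m !) * inv! m ≡ 1ℚ
!-inv! m = ℕtoℚ-inverse (m !) {{m ℕ.!≢0}}

inv!-suc : ∀ m → ℕtoℚ (suc m) * inv! (suc m) ≡ inv! m
inv!-suc m = *-cancelˡ-inverse (ℕtoℚ (m !)) (inv! m) (!-inv! m) (begin
  ℕtoℚ (m !) * (ℕtoℚ (suc m) * inv! (suc m)) ≡⟨ ℚ.*-assoc (ℕtoℚ (m !)) _ _ ⟨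
  ℕtoℚ (m !) * ℕtoℚ (suc m) * inv! (suc m)   ≡⟨ cong (_* inv! (suc m)) (ℚ.*-comm (ℕtoℚ (m !)) _) ⟩
  ℕtoℚ (suc m) * ℕtoℚ (m !) * inv! (suc m)   ≡⟨ cong (_* inv! (suc m)) (ℕtoℚ-* (suc m) (m !)) ⟨
  ℕtoℚ (suc m !) * inv! (suc m)              ≡⟨ !-inv! (suc m) ⟩
  1ℚ                                         ≡⟨ !-inv! m ⟨
  ℕtoℚ (m !) * inv! m                        ∎)
  where open ≡-Reasoning

^ℚ-+ : ∀ c i j → c ^ℚ (i ℕ.+ j) ≡ c ^ℚ i * c ^ℚ j
^ℚ-+ c zero    j = sym (ℚ.*-identityˡ _)
^ℚ-+ c (suc i) j = trans (cong (c *_) (^ℚ-+ c i j)) (sym (ℚ.*-assoc c _ _))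

-- Power series in one variable

Seq : Set
Seq = ℕ → ℚ

infixl 6 _⊕_
infixl 7 _⋆_

_⊕_ _⋆_ : Seq → Seq → Seq
(f ⊕ g) a = f a + g a
(f ⋆ g) a = antidiag a (λ i j → f i * g j)

⊖_ : Seq → Seq
(⊖ f) a = - f a

const : ℚ → Seq
const c zero    = c
const c (suc _) = 0ℚ

δ : Seq
δ = const 1ℚ

X : Seq
X zero    = 0ℚ
X (suc a) = δ a

const-⋆ : ∀ c f a → (const c ⋆ f) a ≡ c * f a
const-⋆ c f zero    = refl
const-⋆ c f (suc a) = trans
  (cong (_+_ (c * f (suc a))) (trans (antidiag-cong a λ i j _ → ℚ.*-zeroˡ (f j)) (antidiag-zero a)))
  (ℚ.+-identityʳ _)

X-⋆-suc : ∀ f a → (X ⋆ f) (suc a) ≡ f a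
X-⋆-suc f a = trans (cong₂ _+_ (ℚ.*-zeroˡ (f (suc a))) (const-⋆ 1ℚ f a))
  (trans (ℚ.+-identityˡ _) (ℚ.*-identityˡ _))

⋆-comm : ∀ f g a → (f ⋆ g) a ≡ (g ⋆ f) a
⋆-comm f g a = trans (antidiag-comm a _) (antidiag-cong a λ i j _ → ℚ.*-comm (f j) (g i))

⋆-assoc : ∀ f g h a → (f ⋆ g ⋆ h) a ≡ (f ⋆ (g ⋆ h)) a
⋆-assoc f g h a = begin
  antidiag a (λ i j → antidiag i (λ k l → f k * g l) * h j)
    ≡⟨ antidiag-cong a (λ i j _ → antidiag-*ʳ i (h j) (λ k l → f k * g l)) ⟨
  antidiag a (λ i j → antidiag i (λ k l → f k * g l * h j))
    ≡⟨ antidiag-assoc a (λ k l j → f k * g l * h j) ⟩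
  antidiag a (λ k m → antidiag m (λ l j → f k * g l * h j))
    ≡⟨ antidiag-cong a (λ k m _ → trans
         (antidiag-cong m λ l j _ → ℚ.*-assoc (f k) (g l) (h j)) (antidiag-*ˡ m (f k) _)) ⟩
  antidiag a (λ k m → f k * antidiag m (λ l j → g l * h j)) ∎
  where open ≡-Reasoning

⋆-identityˡ : ∀ f a → (δ ⋆ f) a ≡ f a
⋆-identityˡ f a = trans (const-⋆ 1ℚ f a) (ℚ.*-identityˡ (f a))

⋆-distribˡ : ∀ f g h a → (f ⋆ (g ⊕ h)) a ≡ (f ⋆ g ⊕ f ⋆ h) a
⋆-distribˡ f g h a = trans
  (antidiag-cong a λ i j _ → ℚ.*-distribˡ-+ (f i) (g j) (h j)) (antidiag-+ a _ _)

powerSeries : CommutativeRing _ _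
powerSeries = record
  { Carrier = Seq
  ; _≈_ = _≗_
  ; _+_ = _⊕_
  ; _*_ = _⋆_
  ; -_  = ⊖_
  ; 0#  = λ _ → 0ℚ
  ; 1#  = δ
  ; isCommutativeRing = record
    { isRing = record
      { +-isAbelianGroup = AbelianGroup.isAbelianGroup (Pointwise.abelianGroup ℕ ℚ.+-0-abelianGroup)
      ; *-cong = λ p q a → antidiag-cong a λ i j _ → cong₂ _*_ (p i) (q j)
      ; *-assoc = ⋆-assoc
      ; *-identity = ⋆-identityˡ , λ f a → trans (⋆-comm f δ a) (⋆-identityˡ f a)
      ; distrib = ⋆-distribˡ , λ f g h a → trans (⋆-comm (g ⊕ h) f a) (trans
          (⋆-distribˡ f g h a) (cong₂ _+_ (⋆-comm f g a) (⋆-comm f h a)))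
      }
    ; *-comm = ⋆-comm
    }
  }

module PS = CommutativeRing powerSeries

const-+ : ∀ c d → const c ⊕ const d ≗ const (c + d)
const-+ c d zero    = refl
const-+ c d (suc a) = refl

const-* : ∀ p q a → const (p * q) a ≡ p * const q a
const-* p q zero    = refl
const-* p q (suc a) = sym (ℚ.*-zeroʳ p)

const-≟ : ∀ p q → Maybe (const p ≗ const q)
const-≟ p q with p ℚ.≟ q
... | yes refl = just λ _ → refl
... | no  _    = nothing

const-homomorphism : CommutativeRing.rawRing ℚ.+-*-commutativeRing
                     -Raw-AlmostCommutative⟶ fromCommutativeRing powerSeries
const-homomorphism = record
  { ⟦_⟧    = const
  ; +-homo = λ p q a → sym (const-+ p q a)
  ; *-homo = λ p q a → trans (const-* p q a) (sym (const-⋆ p (const q) a))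
  ; -‿homo = λ { p zero → refl ; p (suc a) → refl }
  ; 0-homo = λ { zero → refl ; (suc a) → refl }
  ; 1-homo = λ _ → refl
  }

module PS-Solver = Algebra.Solver.Ring
  (CommutativeRing.rawRing ℚ.+-*-commutativeRing) (fromCommutativeRing powerSeries)
  const-homomorphism const-≟

X-cancelˡ : ∀ {f g} → X ⋆ f ≗ X ⋆ g → f ≗ g
X-cancelˡ {f} {g} eq a = trans (sym (X-⋆-suc f a)) (trans (eq (suc a)) (X-⋆-suc g a))

unit-cancelʳ : ∀ {h h⁻¹} → h ⋆ h⁻¹ ≗ δ → ∀ {f g} → f ⋆ h ≗ g ⋆ h → f ≗ g
unit-cancelʳ {h} {h⁻¹} inv {f} {g} eq = begin
  f              ≈⟨ unit f ⟨
  f ⋆ h ⋆ h⁻¹    ≈⟨ PS.*-congʳ eq ⟩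
  g ⋆ h ⋆ h⁻¹    ≈⟨ unit g ⟩
  g              ∎
  where
  open import Relation.Binary.Reasoning.Setoid PS.setoid
  unit : ∀ k → k ⋆ h ⋆ h⁻¹ ≗ k
  unit k a = trans (⋆-assoc k h h⁻¹ a) (trans (PS.*-congˡ {k} inv a) (PS.*-identityʳ k a))

-- The Euler operator x d/dx. Unlike d/dx it preserves degrees, so first-order equations need no
-- index shift, and it carries over to several variables as `θS`.
θ : Seq → Seq
θ f a = ℕtoℚ a * f a

θ-⋆ : ∀ f g → θ (f ⋆ g) ≗ θ f ⋆ g ⊕ f ⋆ θ g
θ-⋆ f g a = trans (sym (antidiag-*ˡ a (ℕtoℚ a) _)) (trans (antidiag-cong a term) (antidiag-+ a _ _))
  where
  term : ∀ i j → i ℕ.+ j ≡ a →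
         ℕtoℚ a * (f i * g j) ≡ ℕtoℚ i * f i * g j + f i * (ℕtoℚ j * g j)
  term i j refl = trans (cong (_* (f i * g j)) (ℕtoℚ-+ i j))
    (solve 4 (λ i j f g → (i :+ j) :* (f :* g) := i :* f :* g :+ f :* (j :* g)) refl
      (ℕtoℚ i) (ℕtoℚ j) (f i) (g j))
    where open ℚ-Solver

θ-⊕ : ∀ f g → θ (f ⊕ g) ≗ θ f ⊕ θ g
θ-⊕ f g a = ℚ.*-distribˡ-+ (ℕtoℚ a) (f a) (g a)

θ-cong : ∀ {f g} → f ≗ g → θ f ≗ θ g
θ-cong eq a = cong (ℕtoℚ a *_) (eq a)

-- The substitution x ↦ c x.
dilate : ℚ → Seq → Seq
dilate c f a = c ^ℚ a * f a

dilate-⋆ : ∀ c f g → dilate c (f ⋆ g) ≗ dilate c f ⋆ dilate c g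
dilate-⋆ c f g a = trans (sym (antidiag-*ˡ a (c ^ℚ a) _)) (antidiag-cong a term)
  where
  term : ∀ i j → i ℕ.+ j ≡ a → c ^ℚ a * (f i * g j) ≡ c ^ℚ i * f i * (c ^ℚ j * g j)
  term i j refl = trans (cong (_* (f i * g j)) (^ℚ-+ c i j))
    (solve 4 (λ x y f g → x :* y :* (f :* g) := x :* f :* (y :* g)) refl
      (c ^ℚ i) (c ^ℚ j) (f i) (g j))
    where open ℚ-Solver

dilate-X : ∀ c → dilate c X ≗ const c ⋆ X
dilate-X c zero          = sym (ℚ.*-zeroʳ c)
dilate-X c (suc zero)    = trans (cong (_* 1ℚ) (ℚ.*-identityʳ c)) (sym (const-⋆ c X 1))
dilate-X c (suc (suc a)) = trans (ℚ.*-zeroʳ (c ^ℚ (2 ℕ.+ a)))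
  (sym (trans (const-⋆ c X (2 ℕ.+ a)) (ℚ.*-zeroʳ c)))

expS : ℚ → Seq
expS c = dilate c inv!

θ-expS : ∀ c → θ (expS c) ≗ const c ⋆ X ⋆ expS c
θ-expS c zero    = sym (cong (_* expS c 0) (ℚ.*-zeroʳ c))
θ-expS c (suc a) = begin
  ℕtoℚ (suc a) * (c * c ^ℚ a * inv! (suc a))
    ≡⟨ solve 4 (λ n c p i → n :* (c :* p :* i) := c :* (p :* (n :* i))) refl (ℕtoℚ (suc a)) c _ _ ⟩
  c * (c ^ℚ a * (ℕtoℚ (suc a) * inv! (suc a)))
    ≡⟨ cong (λ i → c * (c ^ℚ a * i)) (inv!-suc a) ⟩
  c * expS c a
    ≡⟨ cong (c *_) (X-⋆-suc (expS c) a) ⟨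
  c * (X ⋆ expS c) (suc a)
    ≡⟨ const-⋆ c (X ⋆ expS c) (suc a) ⟨
  (const c ⋆ (X ⋆ expS c)) (suc a)
    ≡⟨ ⋆-assoc (const c) X (expS c) (suc a) ⟨
  (const c ⋆ X ⋆ expS c) (suc a) ∎
  where
  open ≡-Reasoning
  open ℚ-Solver

-- The equation computes (a + 1) f_(a+1) from f_a. Uniqueness takes the place of the binomial
-- theorem in `expS-+`.
expS-unique : ∀ c f → f 0 ≡ 1ℚ → θ f ≗ const c ⋆ X ⋆ f → f ≗ expS c
expS-unique c f f0 ode zero    = f0
expS-unique c f f0 ode (suc a) = ℕtoℚ-cancelˡ (suc a) (begin
  ℕtoℚ (suc a) * f (suc a)      ≡⟨ ode (suc a) ⟩
  (const c ⋆ X ⋆ f) (suc a)      ≡⟨ step f ⟩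
  c * f a                        ≡⟨ cong (c *_) (expS-unique c f f0 ode a) ⟩
  c * expS c a                   ≡⟨ step (expS c) ⟨
  (const c ⋆ X ⋆ expS c) (suc a) ≡⟨ θ-expS c (suc a) ⟨
  ℕtoℚ (suc a) * expS c (suc a) ∎)
  where
  open ≡-Reasoning
  step : ∀ g → (const c ⋆ X ⋆ g) (suc a) ≡ c * g a
  step g = trans (⋆-assoc (const c) X g (suc a))
    (trans (const-⋆ c (X ⋆ g) (suc a)) (cong (c *_) (X-⋆-suc g a)))

expS-+ : ∀ c d → expS c ⋆ expS d ≗ expS (c + d)
expS-+ c d = expS-unique (c + d) (expS c ⋆ expS d) refl (begin
  θ (expS c ⋆ expS d)
    ≈⟨ θ-⋆ (expS c) (expS d) ⟩
  θ (expS c) ⋆ expS d ⊕ expS c ⋆ θ (expS d)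
    ≈⟨ PS.+-cong (PS.*-congʳ {expS d} (θ-expS c)) (PS.*-congˡ {expS c} (θ-expS d)) ⟩
  const c ⋆ X ⋆ expS c ⋆ expS d ⊕ expS c ⋆ (const d ⋆ X ⋆ expS d)
    ≈⟨ solve 5 (λ c d x e f → c :* x :* e :* f :+ e :* (d :* x :* f) := (c :+ d) :* x :* (e :* f))
         (λ _ → refl) (const c) (const d) X (expS c) (expS d) ⟩
  (const c ⊕ const d) ⋆ X ⋆ (expS c ⋆ expS d)
    ≈⟨ PS.*-congʳ {expS c ⋆ expS d} (PS.*-congʳ {X} (const-+ c d)) ⟩
  const (c + d) ⋆ X ⋆ (expS c ⋆ expS d) ∎)
  where
  open import Relation.Binary.Reasoning.Setoid PS.setoid
  open PS-Solver

-- Bernoulli numbers and x tanh x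

C-inv! : ∀ n i j → i ℕ.+ j ≡ n → ℕtoℚ (n C i) ≡ ℕtoℚ (n !) * (inv! i * inv! j)
C-inv! n i j refl = begin
  ℕtoℚ (n C i)
    ≡⟨ unit ⟨
  ℕtoℚ (n C i) * (ℕtoℚ (i !) * inv! i * (ℕtoℚ (j !) * inv! j))
    ≡⟨ solve 5 (λ c x y z w → c :* (x :* y :* (z :* w)) := c :* (x :* z) :* (y :* w)) refl
         (ℕtoℚ (n C i)) (ℕtoℚ (i !)) (inv! i) (ℕtoℚ (j !)) (inv! j) ⟩
  ℕtoℚ (n C i) * (ℕtoℚ (i !) * ℕtoℚ (j !)) * (inv! i * inv! j)
    ≡⟨ cong (_* (inv! i * inv! j)) (trans (cong (ℕtoℚ (n C i) *_) (sym (ℕtoℚ-* (i !) (j !))))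
         (trans (sym (ℕtoℚ-* (n C i) (i ! ℕ.* j !))) (cong ℕtoℚ product))) ⟩
  ℕtoℚ (n !) * (inv! i * inv! j) ∎
  where
  open ≡-Reasoning
  open ℚ-Solver
  unit : ℕtoℚ (n C i) * (ℕtoℚ (i !) * inv! i * (ℕtoℚ (j !) * inv! j)) ≡ ℕtoℚ (n C i)
  unit rewrite !-inv! i | !-inv! j = ℚ.*-identityʳ (ℕtoℚ (n C i))
  i≤n : i ≤ i ℕ.+ j
  i≤n = ℕ.m≤m+n i j
  product : (n C i) ℕ.* (i ! ℕ.* j !) ≡ n !
  product = subst (λ k → (n C i) ℕ.* (i ! ℕ.* k !) ≡ n !) (ℕ.m+n∸m≡n i j)
    (trans (cong (ℕ._* (i ! ℕ.* (n ∸ i) !)) (ℕ.nCk≡n!/k![n-k]! i≤n))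
           (ℕ.m/n*n≡m {{i ℕ.!* (n ∸ i) !≢0}} (ℕ.k![n∸k]!∣n! i≤n)))

nthℚ-++ˡ : ∀ xs ys i → i < length xs → nthℚ (xs ++ ys) i ≡ nthℚ xs i
nthℚ-++ˡ (x ∷ xs) ys zero    _       = refl
nthℚ-++ˡ (x ∷ xs) ys (suc i) (s≤s p) = nthℚ-++ˡ xs ys i p

nthℚ-last : ∀ xs y → nthℚ (xs ++ [ y ]) (length xs) ≡ y
nthℚ-last []       y = refl
nthℚ-last (x ∷ xs) y = nthℚ-last xs y

length-bernoulliList : ∀ m → length (bernoulliList m) ≡ m
length-bernoulliList zero    = refl
length-bernoulliList (suc m) = trans (List.length-++ (bernoulliList m))
  (trans (ℕ.+-comm _ 1) (cong suc (length-bernoulliList m)))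

bernoulli-next : ∀ m → bernoulli m ≡ nextBernoulli m (bernoulliList m)
bernoulli-next m = subst
  (λ k → nthℚ (bernoulliList (suc m)) k ≡ nextBernoulli m (bernoulliList m))
  (length-bernoulliList m) (nthℚ-last (bernoulliList m) _)

nthℚ-bernoulliList : ∀ m j → j < m → nthℚ (bernoulliList m) j ≡ bernoulli j
nthℚ-bernoulliList (suc m) j (s≤s j≤m) with ℕ.m≤n⇒m<n∨m≡n j≤m
... | inj₁ j<m  = trans
  (nthℚ-++ˡ (bernoulliList m) _ j (subst (j <_) (sym (length-bernoulliList m)) j<m))
  (nthℚ-bernoulliList m j j<m)
... | inj₂ refl = refl

-- The definition of B_(m+1) solves this relation for its last term, whose binomial coefficient
-- C(m+2, m+1) = m + 2 cancels the denominator.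
bernoulli-recurrence : ∀ m → antidiag (suc m) (λ i _ → ℕtoℚ (suc (suc m) C i) * bernoulli i) ≡ 0ℚ
bernoulli-recurrence m = begin
  antidiag (suc m) (λ i _ → c i * bernoulli i)
    ≡⟨ antidiag-last m (λ i _ → c i * bernoulli i) ⟩
  antidiag m (λ i _ → c i * bernoulli i) + c (suc m) * bernoulli (suc m)
    ≡⟨ cong₂ _+_ earlier latest ⟩
  S + - S
    ≡⟨ ℚ.+-inverseʳ S ⟩
  0ℚ ∎
  where
  open ≡-Reasoning
  open ℚ-Solver
  N = suc (suc m)
  c : ℕ → ℚ
  c i = ℕtoℚ (N C i)
  S = sumℚ (map (λ j → c j * nthℚ (bernoulliList (suc m)) j) (upTo (suc m)))
  earlier : antidiag m (λ i _ → c i * bernoulli i) ≡ S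
  earlier = trans
    (antidiag-cong m λ i j p → cong (c i *_)
      (sym (nthℚ-bernoulliList (suc m) i (s≤s (subst (i ≤_) p (ℕ.m≤m+n i j))))))
    (antidiag-upTo m (λ i _ → c i * nthℚ (bernoulliList (suc m)) i))
  c-last : c (suc m) ≡ ℕtoℚ N
  c-last = cong ℕtoℚ (trans (ℕ.nCk≡nC[n∸k] (ℕ.n≤1+n (suc m)))
    (trans (cong (N C_) (ℕ.m+n∸n≡m 1 m)) (ℕ.nC1≡n N)))
  latest : c (suc m) * bernoulli (suc m) ≡ - S
  latest = begin
    c (suc m) * bernoulli (suc m)  ≡⟨ cong₂ _*_ c-last (bernoulli-next (suc m)) ⟩
    ℕtoℚ N * - (ℤ.+ 1 / N * S)       ≡⟨ solve 3 (λ n r s → n :* :- (r :* s) := :- (n :* r :* s)) refl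
                                       (ℕtoℚ N) (ℤ.+ 1 / N) S ⟩
    - (ℕtoℚ N * (ℤ.+ 1 / N) * S)     ≡⟨ cong (λ q → - (q * S)) (ℕtoℚ-inverse N) ⟩
    - (1ℚ * S)                     ≡⟨ cong -_ (ℚ.*-identityˡ S) ⟩
    - S                            ∎

-- β is x / (eˣ − 1) and ε its inverse.
β ε : Seq
β j = bernoulli j * inv! j
ε j = inv! (suc j)

-- Multiplied by (m+2)!, the coefficient of x^(m+1) becomes the Bernoulli recurrence.
β⋆ε : β ⋆ ε ≗ δ
β⋆ε zero    = refl
β⋆ε (suc m) = *-cancelˡ-inverse (ℕtoℚ (N !)) (inv! N) (!-inv! N) (begin
  ℕtoℚ (N !) * (β ⋆ ε) (suc m)
    ≡⟨ antidiag-*ˡ (suc m) (ℕtoℚ (N !)) (λ i j → β i * ε j) ⟨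
  antidiag (suc m) (λ i j → ℕtoℚ (N !) * (bernoulli i * inv! i * inv! (suc j)))
    ≡⟨ antidiag-cong (suc m) term ⟩
  antidiag (suc m) (λ i _ → ℕtoℚ (N C i) * bernoulli i)
    ≡⟨ bernoulli-recurrence m ⟩
  0ℚ
    ≡⟨ ℚ.*-zeroʳ (ℕtoℚ (N !)) ⟨
  ℕtoℚ (N !) * 0ℚ ∎)
  where
  open ≡-Reasoning
  open ℚ-Solver
  N = suc (suc m)
  term : ∀ i j → i ℕ.+ j ≡ suc m →
         ℕtoℚ (N !) * (bernoulli i * inv! i * inv! (suc j)) ≡ ℕtoℚ (N C i) * bernoulli i
  term i j p = trans
    (solve 4 (λ n b x y → n :* (b :* x :* y) := n :* (x :* y) :* b) refl
      (ℕtoℚ (N !)) (bernoulli i) (inv! i) (inv! (suc j)))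
    (cong (_* bernoulli i) (sym (C-inv! N i (suc j) (trans (ℕ.+-suc i j) (cong suc p)))))

β⋆exp : β ⋆ inv! ≗ X ⊕ β
β⋆exp = begin
  β ⋆ inv!              ≈⟨ PS.*-congˡ {β} exp-ε ⟩
  β ⋆ (X ⋆ ε ⊕ δ)       ≈⟨ solve 3 (λ b x e → b :* (x :* e :+ con 1ℚ) := x :* (b :* e) :+ b) (λ _ → refl) β X ε ⟩
  X ⋆ (β ⋆ ε) ⊕ β       ≈⟨ PS.+-congʳ {β} (PS.*-congˡ {X} β⋆ε) ⟩
  X ⋆ δ ⊕ β             ≈⟨ PS.+-congʳ {β} (PS.*-identityʳ X) ⟩
  X ⊕ β                 ∎
  where
  open import Relation.Binary.Reasoning.Setoid PS.setoid
  open PS-Solver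
  exp-ε : inv! ≗ X ⋆ ε ⊕ δ
  exp-ε zero    = refl
  exp-ε (suc a) = sym (trans (ℚ.+-identityʳ _) (X-⋆-suc ε a))

dilate-β⋆exp : ∀ c → dilate c β ⋆ expS c ≗ const c ⋆ X ⊕ dilate c β
dilate-β⋆exp c a = begin
  (dilate c β ⋆ expS c) a     ≡⟨ dilate-⋆ c β inv! a ⟨
  c ^ℚ a * (β ⋆ inv!) a       ≡⟨ cong (c ^ℚ a *_) (β⋆exp a) ⟩
  c ^ℚ a * (X a + β a)        ≡⟨ ℚ.*-distribˡ-+ (c ^ℚ a) (X a) (β a) ⟩
  dilate c X a + dilate c β a ≡⟨ cong (_+ dilate c β a) (dilate-X c a) ⟩
  (const c ⋆ X ⊕ dilate c β) a ∎
  where open ≡-Reasoning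

2ℚ 4ℚ -1ℚ : ℚ
2ℚ  = ℕtoℚ 2
4ℚ  = ℕtoℚ 4
-1ℚ = - 1ℚ

-- G = x tanh x = 2x coth 2x − x coth x, where z coth z = β(2z) + z.
D G cosh₂ : Seq
D     = dilate 4ℚ β ⊕ ⊖ dilate 2ℚ β
G     = D ⊕ X
cosh₂ = expS 1ℚ ⊕ expS -1ℚ

-- As D = x tanh x - x, this is the formula tanh x - 1 = -2 / (e^(2x) + 1). With Z the difference of
-- the two sides, the functional equations of β(2x) and β(4x) give Z e^(2x) = Z.
D⋆exp : D ⋆ (expS 2ℚ ⊕ δ) ≗ ⊖ (const 2ℚ ⋆ X)
D⋆exp = begin
  D ⋆ (F ⊕ δ)
    ≈⟨ solve 3 (λ d f x → d :* (f :+ con 1ℚ) := d :* (f :+ con 1ℚ) :+ con 2ℚ :* x :+ :- (con 2ℚ :* x))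
         (λ _ → refl) D F X ⟩
  Z ⊕ ⊖ (const 2ℚ ⋆ X)
    ≈⟨ PS.+-congʳ {⊖ (const 2ℚ ⋆ X)} Z≗0 ⟩
  (λ _ → 0ℚ) ⊕ ⊖ (const 2ℚ ⋆ X)
    ≈⟨ PS.+-identityˡ (⊖ (const 2ℚ ⋆ X)) ⟩
  ⊖ (const 2ℚ ⋆ X) ∎
  where
  open import Relation.Binary.Reasoning.Setoid PS.setoid
  open PS-Solver
  F = expS 2ℚ
  β₂ = dilate 2ℚ β
  β₄ = dilate 4ℚ β
  Z = D ⋆ (F ⊕ δ) ⊕ const 2ℚ ⋆ X
  Z⋆F : Z ⋆ F ≗ Z
  Z⋆F = begin
    Z ⋆ F
      ≈⟨ solve 4 (λ p q f x →
           ((p :+ :- q) :* (f :+ con 1ℚ) :+ con 2ℚ :* x) :* f :=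
           p :* (f :* f) :+ :- (q :* f :* (f :+ con 1ℚ)) :+ :- q :* f :+ (p :* f :+ q :* f) :+ con 2ℚ :* x :* f)
           (λ _ → refl) β₄ β₂ F X ⟩
    β₄ ⋆ (F ⋆ F) ⊕ ⊖ (β₂ ⋆ F ⋆ (F ⊕ δ)) ⊕ (⊖ β₂) ⋆ F ⊕ (β₄ ⋆ F ⊕ β₂ ⋆ F) ⊕ const 2ℚ ⋆ X ⋆ F
      ≈⟨ PS.+-congʳ {const 2ℚ ⋆ X ⋆ F} (PS.+-congʳ {β₄ ⋆ F ⊕ β₂ ⋆ F} (PS.+-congʳ {(⊖ β₂) ⋆ F}
           (PS.+-cong (PS.trans (PS.*-congˡ {β₄} (expS-+ 2ℚ 2ℚ)) (dilate-β⋆exp 4ℚ))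
                      (PS.-‿cong (PS.*-congʳ {F ⊕ δ} (dilate-β⋆exp 2ℚ)))))) ⟩
    (const 4ℚ ⋆ X ⊕ β₄) ⊕ ⊖ ((const 2ℚ ⋆ X ⊕ β₂) ⋆ (F ⊕ δ)) ⊕ (⊖ β₂) ⋆ F ⊕ (β₄ ⋆ F ⊕ β₂ ⋆ F) ⊕ const 2ℚ ⋆ X ⋆ F
      ≈⟨ solve 4 (λ p q f x →
           (con 4ℚ :* x :+ p) :+ :- ((con 2ℚ :* x :+ q) :* (f :+ con 1ℚ)) :+ :- q :* f :+
             (p :* f :+ q :* f) :+ con 2ℚ :* x :* f :=
           (p :+ :- q) :* (f :+ con 1ℚ) :+ con 2ℚ :* x) (λ _ → refl) β₄ β₂ F X ⟩
    Z ∎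
  -- The factor e^(2x) - 1 is not a unit, but β(2x) turns it into 2x, and x can be cancelled.
  XZ : X ⋆ Z ≗ X ⋆ (λ _ → 0ℚ)
  XZ = begin
    X ⋆ Z
      ≈⟨ solve 3 (λ x z b → x :* z := con (ℚ.½) :* (z :* (con 2ℚ :* x :+ b) :+ :- (b :* z)))
           (λ _ → refl) X Z β₂ ⟩
    const ℚ.½ ⋆ (Z ⋆ (const 2ℚ ⋆ X ⊕ β₂) ⊕ ⊖ (β₂ ⋆ Z))
      ≈⟨ PS.*-congˡ {const ℚ.½} (PS.+-congʳ {⊖ (β₂ ⋆ Z)} (PS.*-congˡ {Z} (dilate-β⋆exp 2ℚ))) ⟨
    const ℚ.½ ⋆ (Z ⋆ (β₂ ⋆ F) ⊕ ⊖ (β₂ ⋆ Z))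
      ≈⟨ solve 4 (λ h z b f → h :* (z :* (b :* f) :+ :- (b :* z)) := h :* (b :* (z :* f) :+ :- (b :* z)))
           (λ _ → refl) (const ℚ.½) Z β₂ F ⟩
    const ℚ.½ ⋆ (β₂ ⋆ (Z ⋆ F) ⊕ ⊖ (β₂ ⋆ Z))
      ≈⟨ PS.*-congˡ {const ℚ.½} (PS.+-congʳ {⊖ (β₂ ⋆ Z)} (PS.*-congˡ {β₂} Z⋆F)) ⟩
    const ℚ.½ ⋆ (β₂ ⋆ Z ⊕ ⊖ (β₂ ⋆ Z))
      ≈⟨ PS.*-congˡ {const ℚ.½} (PS.-‿inverseʳ (β₂ ⋆ Z)) ⟩
    const ℚ.½ ⋆ (λ _ → 0ℚ)
      ≈⟨ PS.zeroʳ (const ℚ.½) ⟩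
    (λ _ → 0ℚ)
      ≈⟨ PS.zeroʳ X ⟨
    X ⋆ (λ _ → 0ℚ) ∎
  Z≗0 : Z ≗ λ _ → 0ℚ
  Z≗0 = X-cancelˡ {Z} {λ _ → 0ℚ} XZ

exp⋆exp⁻ : expS 1ℚ ⋆ expS -1ℚ ≗ δ
exp⋆exp⁻ a = trans (expS-+ 1ℚ -1ℚ a) (expS-0 a)
  where
  expS-0 : expS 0ℚ ≗ δ
  expS-0 zero    = refl
  expS-0 (suc a) = trans (cong (_* inv! (suc a)) (ℚ.*-zeroˡ (0ℚ ^ℚ a))) (ℚ.*-zeroˡ (inv! (suc a)))

-- Both sides are 2x sinh x. Writing eˣ + e⁻ˣ as (e^(2x) + 1) e⁻ˣ makes `D⋆exp` applicable.
G⋆cosh₂ : G ⋆ cosh₂ ≗ θ cosh₂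
G⋆cosh₂ = begin
  G ⋆ (E ⊕ E⁻)
    ≈⟨ solve 4 (λ d x e i → (d :+ x) :* (e :+ i) := (d :+ x) :* (e :* con 1ℚ :+ i)) (λ _ → refl) D X E E⁻ ⟩
  (D ⊕ X) ⋆ (E ⋆ δ ⊕ E⁻)
    ≈⟨ PS.*-congˡ {D ⊕ X} (PS.+-congʳ {E⁻} (PS.*-congˡ {E} exp⋆exp⁻)) ⟨
  (D ⊕ X) ⋆ (E ⋆ (E ⋆ E⁻) ⊕ E⁻)
    ≈⟨ solve 4 (λ d x e i → (d :+ x) :* (e :* (e :* i) :+ i) :=
         (d :* (e :* e :+ con 1ℚ) :+ x :* (e :* e :+ con 1ℚ)) :* i)
         (λ _ → refl) D X E E⁻ ⟩
  (D ⋆ (E ⋆ E ⊕ δ) ⊕ X ⋆ (E ⋆ E ⊕ δ)) ⋆ E⁻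
    ≈⟨ PS.*-congʳ {E⁻} (PS.+-congʳ {X ⋆ (E ⋆ E ⊕ δ)}
         (PS.trans (PS.*-congˡ {D} (PS.+-congʳ {δ} (expS-+ 1ℚ 1ℚ))) D⋆exp)) ⟩
  (⊖ (const 2ℚ ⋆ X) ⊕ X ⋆ (E ⋆ E ⊕ δ)) ⋆ E⁻
    ≈⟨ solve 3 (λ x e i → (:- (con 2ℚ :* x) :+ x :* (e :* e :+ con 1ℚ)) :* i := x :* e :* (e :* i) :+ con -1ℚ :* x :* i)
         (λ _ → refl) X E E⁻ ⟩
  X ⋆ E ⋆ (E ⋆ E⁻) ⊕ const -1ℚ ⋆ X ⋆ E⁻
    ≈⟨ PS.+-congʳ {const -1ℚ ⋆ X ⋆ E⁻} (PS.*-congˡ {X ⋆ E} exp⋆exp⁻) ⟩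
  X ⋆ E ⋆ δ ⊕ const -1ℚ ⋆ X ⋆ E⁻
    ≈⟨ solve 3 (λ x e i → x :* e :* con 1ℚ :+ con -1ℚ :* x :* i := con 1ℚ :* x :* e :+ con -1ℚ :* x :* i)
         (λ _ → refl) X E E⁻ ⟩
  const 1ℚ ⋆ X ⋆ E ⊕ const -1ℚ ⋆ X ⋆ E⁻
    ≈⟨ PS.+-cong (θ-expS 1ℚ) (θ-expS -1ℚ) ⟨
  θ E ⊕ θ E⁻
    ≈⟨ θ-⊕ E E⁻ ⟨
  θ cosh₂ ∎
  where
  open import Relation.Binary.Reasoning.Setoid PS.setoid
  open PS-Solver
  E = expS 1ℚ
  E⁻ = expS -1ℚ

1^ℚ : ∀ a → 1ℚ ^ℚ a ≡ 1ℚ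
1^ℚ zero    = refl
1^ℚ (suc a) = trans (ℚ.*-identityˡ _) (1^ℚ a)

^ℚ-2* : ∀ c a → c ^ℚ (2 ℕ.* a) ≡ (c * c) ^ℚ a
^ℚ-2* c zero    = refl
^ℚ-2* c (suc a) = begin
  c ^ℚ (2 ℕ.* suc a)         ≡⟨ cong (c ^ℚ_) (ℕ.*-suc 2 a) ⟩
  c * (c * c ^ℚ (2 ℕ.* a))   ≡⟨ ℚ.*-assoc c c _ ⟨
  c * c * c ^ℚ (2 ℕ.* a)     ≡⟨ cong (c * c *_) (^ℚ-2* c a) ⟩
  c * c * (c * c) ^ℚ a       ∎
  where open ≡-Reasoning

ℕtoℚ-^ : ∀ m k → ℕtoℚ (m ℕ.^ k) ≡ ℕtoℚ m ^ℚ k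
ℕtoℚ-^ m zero    = refl
ℕtoℚ-^ m (suc k) = trans (ℕtoℚ-* m (m ℕ.^ k)) (cong (ℕtoℚ m *_) (ℕtoℚ-^ m k))

-- When the total is even, the two indices have the same parity, so the hypothesis on odd second
-- indices removes all odd pairs. This is the passage from series in x to series in y = x².
antidiag-2* : ∀ a h → (∀ i k → h i (suc (2 ℕ.* k)) ≡ 0ℚ) →
              antidiag (2 ℕ.* a) h ≡ antidiag a (λ k l → h (2 ℕ.* k) (2 ℕ.* l))
antidiag-2* zero    h odd = refl
antidiag-2* (suc a) h odd = begin
  antidiag (2 ℕ.* suc a) h
    ≡⟨ cong (λ n → antidiag n h) (ℕ.*-suc 2 a) ⟩
  h 0 (2 ℕ.+ 2 ℕ.* a) + (h 1 (suc (2 ℕ.* a)) + antidiag (2 ℕ.* a) h₂)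
    ≡⟨ cong₂ (λ x y → x + (y + antidiag (2 ℕ.* a) h₂)) (cong (h 0) (sym (ℕ.*-suc 2 a))) (odd 1 a) ⟩
  h 0 (2 ℕ.* suc a) + (0ℚ + antidiag (2 ℕ.* a) h₂)
    ≡⟨ cong (_+_ (h 0 (2 ℕ.* suc a))) (trans (ℚ.+-identityˡ _) (antidiag-2* a h₂ (λ i → odd (2 ℕ.+ i)))) ⟩
  h 0 (2 ℕ.* suc a) + antidiag a (λ k l → h (2 ℕ.+ 2 ℕ.* k) (2 ℕ.* l))
    ≡⟨ cong (_+_ (h 0 (2 ℕ.* suc a))) (antidiag-cong a λ k l _ → cong (λ n → h n (2 ℕ.* l)) (sym (ℕ.*-suc 2 k))) ⟩
  antidiag (suc a) (λ k l → h (2 ℕ.* k) (2 ℕ.* l)) ∎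
  where
  open ≡-Reasoning
  h₂ = λ i j → h (2 ℕ.+ i) j

-- In y = x²: `u` is cosh √y and `g` is √y tanh √y.
u g : Seq
u a = inv! (2 ℕ.* a)
g k = G (2 ℕ.* k)

cosh₂-odd : ∀ k → cosh₂ (suc (2 ℕ.* k)) ≡ 0ℚ
cosh₂-odd k rewrite ^ℚ-2* 1ℚ k | ^ℚ-2* -1ℚ k | 1^ℚ k =
  solve 1 (λ i → con 1ℚ :* con 1ℚ :* i :+ con -1ℚ :* con 1ℚ :* i := con 0ℚ) refl (inv! (suc (2 ℕ.* k)))
  where open ℚ-Solver

cosh₂-even : ∀ k → cosh₂ (2 ℕ.* k) ≡ 2ℚ * u k
cosh₂-even k rewrite ^ℚ-2* 1ℚ k | ^ℚ-2* -1ℚ k | 1^ℚ k =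
  solve 1 (λ i → con 1ℚ :* i :+ con 1ℚ :* i := con 2ℚ :* i) refl (u k)
  where open ℚ-Solver

-- The even part of `G⋆cosh₂`; the factor 2 arises because the Euler operator in x is twice the one
-- in y = x².
g⋆u : g ⋆ u ≗ const 2ℚ ⋆ θ u
g⋆u a = *-cancelˡ-inverse 2ℚ ℚ.½ refl (begin
  2ℚ * (g ⋆ u) a
    ≡⟨ antidiag-*ˡ a 2ℚ (λ k l → g k * u l) ⟨
  antidiag a (λ k l → 2ℚ * (g k * u l))
    ≡⟨ antidiag-cong a (λ k l _ → trans (solve 2 (λ g u → con 2ℚ :* (g :* u) := g :* (con 2ℚ :* u)) refl (g k) (u l))
         (cong (g k *_) (sym (cosh₂-even l)))) ⟩
  antidiag a (λ k l → G (2 ℕ.* k) * cosh₂ (2 ℕ.* l))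
    ≡⟨ antidiag-2* a (λ i j → G i * cosh₂ j)
         (λ i k → trans (cong (G i *_) (cosh₂-odd k)) (ℚ.*-zeroʳ (G i))) ⟨
  (G ⋆ cosh₂) (2 ℕ.* a)
    ≡⟨ G⋆cosh₂ (2 ℕ.* a) ⟩
  ℕtoℚ (2 ℕ.* a) * cosh₂ (2 ℕ.* a)
    ≡⟨ cong₂ _*_ (ℕtoℚ-* 2 a) (cosh₂-even a) ⟩
  2ℚ * ℕtoℚ a * (2ℚ * u a)
    ≡⟨ solve 2 (λ n u → con 2ℚ :* n :* (con 2ℚ :* u) := con 2ℚ :* (con 2ℚ :* (n :* u)))
         refl (ℕtoℚ a) (u a) ⟩
  2ℚ * (2ℚ * θ u a)
    ≡⟨ cong (2ℚ *_) (const-⋆ 2ℚ (θ u) a) ⟨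
  2ℚ * (const 2ℚ ⋆ θ u) a ∎)
  where
  open ≡-Reasoning
  open ℚ-Solver

X-2* : ∀ k → X (2 ℕ.* k) ≡ 0ℚ
X-2* zero    = refl
X-2* (suc k) = cong X (ℕ.*-suc 2 k)

-- In degree 2k the series `D` has coefficient (4^(2k) - 2^(2k)) B_(2k) / (2k)!, and 4^(2k) - 2^(2k)
-- = 4^k (4^k - 1). The factor 2k makes up for the 2k in the denominator of `coeffK`.
g-coeffK : ∀ k → g k ≡ 2ℚ * (ℕtoℚ k * coeffK k)
g-coeffK zero    = refl
g-coeffK k@(suc j) = begin
  4ℚ ^ℚ (2 ℕ.* k) * (b * i) + - (2ℚ ^ℚ (2 ℕ.* k) * (b * i)) + X (2 ℕ.* k)
    ≡⟨ cong (λ x → 4ℚ ^ℚ (2 ℕ.* k) * (b * i) + - (2ℚ ^ℚ (2 ℕ.* k) * (b * i)) + x) (X-2* k) ⟩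
  4ℚ ^ℚ (2 ℕ.* k) * (b * i) + - (2ℚ ^ℚ (2 ℕ.* k) * (b * i)) + 0ℚ
    ≡⟨ cong₂ (λ p q → p * (b * i) + - (q * (b * i)) + 0ℚ) pow4 (^ℚ-2* 2ℚ k) ⟩
  p * p * (b * i) + - (p * (b * i)) + 0ℚ
    ≡⟨ solve 3 (λ p b i → p :* p :* (b :* i) :+ :- (p :* (b :* i)) :+ con 0ℚ := p :* (p :+ :- con 1ℚ) :* b :* i)
         refl p b i ⟩
  p * (p + - 1ℚ) * b * i
    ≡⟨ cong₂ (λ x y → x * b * y) (sym pow-diff) i-eq ⟩
  ℕtoℚ num * b * (2ℚ * ℕtoℚ k * d)
    ≡⟨ solve 4 (λ n b k d → n :* b :* (con 2ℚ :* k :* d) := con 2ℚ :* (k :* (n :* d :* b)))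
         refl (ℕtoℚ num) b (ℕtoℚ k) d ⟩
  2ℚ * (ℕtoℚ k * (ℕtoℚ num * d * b))
    ≡⟨ cong (λ q → 2ℚ * (ℕtoℚ k * (q * b))) (/-as-* num (2 ℕ.* k ℕ.* (2 ℕ.* k) !)) ⟨
  2ℚ * (ℕtoℚ k * coeffK k) ∎
  where
  open ≡-Reasoning
  open ℚ-Solver
  instance
    nz : ℕ.NonZero (2 ℕ.* k ℕ.* (2 ℕ.* k) !)
    nz = ℕ.m*n≢0 (2 ℕ.* k) ((2 ℕ.* k) !) {{_}} {{(2 ℕ.* k) ℕ.!≢0}}
  b = bernoulli (2 ℕ.* k)
  i = inv! (2 ℕ.* k)
  p = 4ℚ ^ℚ k
  num = 4 ℕ.^ k ℕ.* (4 ℕ.^ k ∸ 1)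
  d = ℤ.+ 1 / (2 ℕ.* k ℕ.* (2 ℕ.* k) !)
  pow4 : 4ℚ ^ℚ (2 ℕ.* k) ≡ p * p
  pow4 = trans (cong (4ℚ ^ℚ_) (cong (k ℕ.+_) (ℕ.+-identityʳ k))) (^ℚ-+ 4ℚ k k)
  pow-pred : ℕtoℚ (4 ℕ.^ k ∸ 1) ≡ p + - 1ℚ
  pow-pred = begin
    ℕtoℚ (4 ℕ.^ k ∸ 1)                ≡⟨ solve 1 (λ x → x := x :+ con 1ℚ :+ :- con 1ℚ) refl _ ⟩
    ℕtoℚ (4 ℕ.^ k ∸ 1) + 1ℚ + - 1ℚ    ≡⟨ cong (_+ - 1ℚ) (ℕtoℚ-+ (4 ℕ.^ k ∸ 1) 1) ⟨
    ℕtoℚ (4 ℕ.^ k ∸ 1 ℕ.+ 1) + - 1ℚ   ≡⟨ cong (λ m → ℕtoℚ m + - 1ℚ) (ℕ.m∸n+n≡m (ℕ.m^n>0 4 k)) ⟩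
    ℕtoℚ (4 ℕ.^ k) + - 1ℚ             ≡⟨ cong (_+ - 1ℚ) (ℕtoℚ-^ 4 k) ⟩
    p + - 1ℚ                          ∎
  pow-diff : ℕtoℚ num ≡ p * (p + - 1ℚ)
  pow-diff = trans (ℕtoℚ-* (4 ℕ.^ k) (4 ℕ.^ k ∸ 1)) (cong₂ _*_ (ℕtoℚ-^ 4 k) pow-pred)
  i-eq : i ≡ 2ℚ * ℕtoℚ k * d
  i-eq = *-cancelˡ-inverse (ℕtoℚ ((2 ℕ.* k) !)) i (!-inv! (2 ℕ.* k)) (begin
    ℕtoℚ ((2 ℕ.* k) !) * i
      ≡⟨ !-inv! (2 ℕ.* k) ⟩
    1ℚ
      ≡⟨ ℕtoℚ-inverse (2 ℕ.* k ℕ.* (2 ℕ.* k) !) ⟨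
    ℕtoℚ (2 ℕ.* k ℕ.* (2 ℕ.* k) !) * d
      ≡⟨ cong (_* d) (trans (ℕtoℚ-* (2 ℕ.* k) ((2 ℕ.* k) !)) (cong (_* ℕtoℚ ((2 ℕ.* k) !)) (ℕtoℚ-* 2 k))) ⟩
    2ℚ * ℕtoℚ k * ℕtoℚ ((2 ℕ.* k) !) * d
      ≡⟨ solve 3 (λ k f d → k :* f :* d := f :* (k :* d)) refl (2ℚ * ℕtoℚ k) (ℕtoℚ ((2 ℕ.* k) !)) d ⟩
    ℕtoℚ ((2 ℕ.* k) !) * (2ℚ * ℕtoℚ k * d) ∎)

-- The secant and tangent series

-- The recursion for the inverse of a series with constant term 1 passes through `antidiag` and is
-- not visibly structural, so the `ℕ` argument bounds its depth. The coefficient at a is settled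
-- once the bound exceeds a.
inverse-approx : Seq → ℕ → Seq
inverse-approx f zero    a       = 0ℚ
inverse-approx f (suc n) zero    = 1ℚ
inverse-approx f (suc n) (suc a) = - antidiag a (λ i j → f (suc i) * inverse-approx f n j)

inverse : Seq → Seq
inverse f a = inverse-approx f (suc a) a

inverse-approx-stable : ∀ f m n a → a < m → a < n → inverse-approx f m a ≡ inverse-approx f n a
inverse-approx-stable f (suc m) (suc n) zero    _       _       = refl
inverse-approx-stable f (suc m) (suc n) (suc a) (s≤s p) (s≤s q) =
  cong -_ (antidiag-cong a λ i j e → cong (f (suc i) *_)
    (inverse-approx-stable f m n j (j< e p) (j< e q)))
  where
  j< : ∀ {i j m} → i ℕ.+ j ≡ a → a < m → j < m
  j< {i} {j} refl a<m = ℕ.≤-<-trans (ℕ.m≤n+m j i) a<m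

⋆-inverse : ∀ f → f 0 ≡ 1ℚ → f ⋆ inverse f ≗ δ
⋆-inverse f f0 zero    = trans (ℚ.*-identityʳ (f 0)) f0
⋆-inverse f f0 (suc a) = begin
  f 0 * - S + antidiag a (λ i j → f (suc i) * inverse f j)
    ≡⟨ cong₂ _+_ (trans (cong (_* - S) f0) (ℚ.*-identityˡ (- S)))
         (antidiag-cong a λ i j e → cong (f (suc i) *_) (inverse-approx-stable f (suc j) (suc a) j
            (ℕ.n<1+n j) (s≤s (subst (j ≤_) e (ℕ.m≤n+m j i))))) ⟩
  - S + S
    ≡⟨ ℚ.+-inverseˡ S ⟩
  0ℚ ∎
  where
  open ≡-Reasoning
  S = antidiag a (λ i j → f (suc i) * inverse-approx f (suc a) j)

-- ū = cos √y, s = 1 / cos √y and t = √y tan √y as series in y.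
ū s t : Seq
ū = dilate -1ℚ u
s = inverse ū
t = ⊖ dilate -1ℚ g

ū⋆s : ū ⋆ s ≗ δ
ū⋆s = ⋆-inverse ū refl

-- The substitution y ↦ -y in `g⋆u`: it turns cosh √y into cos √y and √y tanh √y into -√y tan √y.
t⋆ū : t ⋆ ū ≗ const (- 2ℚ) ⋆ θ ū
t⋆ū a = begin
  ((⊖ dilate -1ℚ g) ⋆ ū) a
    ≡⟨ -‿distribˡ-* (dilate -1ℚ g) ū a ⟨
  - (dilate -1ℚ g ⋆ ū) a
    ≡⟨ cong -_ (dilate-⋆ -1ℚ g u a) ⟨
  - (-1ℚ ^ℚ a * (g ⋆ u) a)
    ≡⟨ cong (λ q → - (-1ℚ ^ℚ a * q)) (trans (g⋆u a) (const-⋆ 2ℚ (θ u) a)) ⟩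
  - (-1ℚ ^ℚ a * (2ℚ * (ℕtoℚ a * u a)))
    ≡⟨ solve 3 (λ e n x → :- (e :* (con 2ℚ :* (n :* x))) := con (- 2ℚ) :* (n :* (e :* x))) refl
         (-1ℚ ^ℚ a) (ℕtoℚ a) (u a) ⟩
  - 2ℚ * θ ū a
    ≡⟨ const-⋆ (- 2ℚ) (θ ū) a ⟨
  (const (- 2ℚ) ⋆ θ ū) a ∎
  where
  open ≡-Reasoning
  open ℚ-Solver
  open import Algebra.Properties.Ring PS.ring using (-‿distribˡ-*)

-- The logarithmic derivative of 1/cos √y is the negative of that of cos √y, by differentiating
-- `ū⋆s`; the equation is compared after multiplication by the unit cos √y.
θs : const 2ℚ ⋆ θ s ≗ t ⋆ s
θs = unit-cancelʳ {ū} {s} ū⋆s (begin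
  const 2ℚ ⋆ θ s ⋆ ū
    ≈⟨ solve 4 (λ u s du ds → con 2ℚ :* ds :* u := con 2ℚ :* (du :* s :+ u :* ds) :+ s :* (con (- 2ℚ) :* du))
         (λ _ → refl) ū s (θ ū) (θ s) ⟩
  const 2ℚ ⋆ (θ ū ⋆ s ⊕ ū ⋆ θ s) ⊕ s ⋆ (const (- 2ℚ) ⋆ θ ū)
    ≈⟨ PS.+-cong (PS.*-congˡ {const 2ℚ} θ-ū⋆s) (PS.*-congˡ {s} (PS.sym t⋆ū)) ⟩
  const 2ℚ ⋆ (λ _ → 0ℚ) ⊕ s ⋆ (t ⋆ ū)
    ≈⟨ PS.+-congʳ {s ⋆ (t ⋆ ū)} (PS.zeroʳ (const 2ℚ)) ⟩
  (λ _ → 0ℚ) ⊕ s ⋆ (t ⋆ ū)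
    ≈⟨ PS.+-identityˡ _ ⟩
  s ⋆ (t ⋆ ū)
    ≈⟨ solve 3 (λ s t u → s :* (t :* u) := t :* s :* u) (λ _ → refl) s t ū ⟩
  t ⋆ s ⋆ ū ∎)
  where
  open import Relation.Binary.Reasoning.Setoid PS.setoid
  open PS-Solver
  θ-δ : θ δ ≗ λ _ → 0ℚ
  θ-δ zero    = refl
  θ-δ (suc a) = ℚ.*-zeroʳ (ℕtoℚ (suc a))
  θ-ū⋆s : θ ū ⋆ s ⊕ ū ⋆ θ s ≗ λ _ → 0ℚ
  θ-ū⋆s a = trans (sym (θ-⋆ ū s a)) (trans (θ-cong ū⋆s a) (θ-δ a))

x·sin : Seq
x·sin = const (- 2ℚ) ⋆ θ ū

2[1+a] : ∀ a → 2ℚ * ℕtoℚ (suc a) ≡ ℕtoℚ (2 ℕ.+ 2 ℕ.* a)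
2[1+a] a = trans (sym (ℕtoℚ-* 2 (suc a))) (cong ℕtoℚ (ℕ.*-suc 2 a))

2[1+a]-1 : ∀ a → 2ℚ * ℕtoℚ (suc a) + -1ℚ ≡ ℕtoℚ (suc (2 ℕ.* a))
2[1+a]-1 a = trans (cong (_+ -1ℚ) (trans (2[1+a] a) (ℕtoℚ-+ 1 (suc (2 ℕ.* a)))))
  (solve 1 (λ x → con 1ℚ :+ x :+ con -1ℚ := x) refl (ℕtoℚ (suc (2 ℕ.* a))))
  where open ℚ-Solver

-- With y = x² this reads x (x sin x)′ − x sin x = x² cos x.
ū-second-derivative : const 2ℚ ⋆ θ x·sin ⊕ ⊖ x·sin ≗ X ⋆ ū
ū-second-derivative zero    = refl
ū-second-derivative (suc a) = begin
  (const 2ℚ ⋆ θ x·sin) (suc a) + - x·sin (suc a)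
    ≡⟨ cong₂ (λ x y → x + - y)
         (trans (const-⋆ 2ℚ (θ x·sin) (suc a)) (cong (λ y → 2ℚ * (n * y)) x·sin-suc)) x·sin-suc ⟩
  2ℚ * (n * (- 2ℚ * (n * (-1ℚ * e * i)))) + - (- 2ℚ * (n * (-1ℚ * e * i)))
    ≡⟨ solve 3 (λ n e i →
         con 2ℚ :* (n :* (con (- 2ℚ) :* (n :* (con -1ℚ :* e :* i)))) :+
           :- (con (- 2ℚ) :* (n :* (con -1ℚ :* e :* i)))
         := e :* ((con 2ℚ :* n :+ con -1ℚ) :* (con 2ℚ :* n :* i))) refl n e i ⟩
  e * ((2ℚ * n + -1ℚ) * (2ℚ * n * i))
    ≡⟨ cong (e *_) (begin
      (2ℚ * n + -1ℚ) * (2ℚ * n * i)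
        ≡⟨ cong₂ (λ x y → x * (y * i)) (2[1+a]-1 a) (2[1+a] a) ⟩
      ℕtoℚ (suc (2 ℕ.* a)) * (ℕtoℚ (2 ℕ.+ 2 ℕ.* a) * inv! (2 ℕ.* suc a))
        ≡⟨ cong (λ m → ℕtoℚ (suc (2 ℕ.* a)) * (ℕtoℚ (2 ℕ.+ 2 ℕ.* a) * inv! m)) (ℕ.*-suc 2 a) ⟩
      ℕtoℚ (suc (2 ℕ.* a)) * (ℕtoℚ (2 ℕ.+ 2 ℕ.* a) * inv! (2 ℕ.+ 2 ℕ.* a))
        ≡⟨ cong (_*_ (ℕtoℚ (suc (2 ℕ.* a)))) (inv!-suc (suc (2 ℕ.* a))) ⟩
      ℕtoℚ (suc (2 ℕ.* a)) * inv! (suc (2 ℕ.* a))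
        ≡⟨ inv!-suc (2 ℕ.* a) ⟩
      u a ∎) ⟩
  ū a
    ≡⟨ X-⋆-suc ū a ⟨
  (X ⋆ ū) (suc a) ∎
  where
  open ≡-Reasoning
  open ℚ-Solver
  n = ℕtoℚ (suc a)
  e = -1ℚ ^ℚ a
  i = u (suc a)
  x·sin-suc : x·sin (suc a) ≡ - 2ℚ * (n * (-1ℚ * e * i))
  x·sin-suc = const-⋆ (- 2ℚ) (θ ū) (suc a)

-- tan' = 1 + tan².
t-riccati : const 2ℚ ⋆ θ t ⊕ ⊖ t ≗ X ⊕ t ⋆ t
t-riccati = unit-cancelʳ {ū} {s} ū⋆s (begin
  (const 2ℚ ⋆ θ t ⊕ ⊖ t) ⋆ ū
    ≈⟨ solve 4 (λ t u dt du → (con 2ℚ :* dt :+ :- t) :* u :=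
         con 2ℚ :* (dt :* u :+ t :* du) :+ :- (t :* u) :+ t :* (con (- 2ℚ) :* du)) (λ _ → refl) t ū (θ t) (θ ū) ⟩
  const 2ℚ ⋆ (θ t ⋆ ū ⊕ t ⋆ θ ū) ⊕ ⊖ (t ⋆ ū) ⊕ t ⋆ (const (- 2ℚ) ⋆ θ ū)
    ≈⟨ PS.+-cong (PS.+-cong (PS.*-congˡ {const 2ℚ} (PS.trans (PS.sym (θ-⋆ t ū)) (θ-cong t⋆ū))) (PS.-‿cong t⋆ū))
                 (PS.*-congˡ {t} (PS.sym t⋆ū)) ⟩
  const 2ℚ ⋆ θ x·sin ⊕ ⊖ x·sin ⊕ t ⋆ (t ⋆ ū)
    ≈⟨ PS.+-congʳ {t ⋆ (t ⋆ ū)} ū-second-derivative ⟩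
  X ⋆ ū ⊕ t ⋆ (t ⋆ ū)
    ≈⟨ solve 3 (λ x t u → x :* u :+ t :* (t :* u) := (x :+ t :* t) :* u) (λ _ → refl) X t ū ⟩
  (X ⊕ t ⋆ t) ⋆ ū ∎)
  where
  open import Relation.Binary.Reasoning.Setoid PS.setoid
  open PS-Solver

antidiag-nonneg : ∀ a {h} → (∀ i j → i ℕ.+ j ≡ a → 0ℚ ℚ.≤ h i j) → 0ℚ ℚ.≤ antidiag a h
antidiag-nonneg zero    h≥0 = h≥0 0 0 refl
antidiag-nonneg (suc a) h≥0 =
  ℚ.+-mono-≤ (h≥0 0 (suc a) refl) (antidiag-nonneg a λ i j e → h≥0 (suc i) j (cong suc e))

*-nonneg : ∀ {p q} → 0ℚ ℚ.≤ p → 0ℚ ℚ.≤ q → 0ℚ ℚ.≤ p * q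
*-nonneg {p} {q} p≥0 q≥0 = ℚ.nonNegative⁻¹ (p * q)
  {{ℚ.nonNeg*nonNeg⇒nonNeg p {{ℚ.nonNegative p≥0}} q {{ℚ.nonNegative q≥0}}}}

X-nonneg : ∀ a → 0ℚ ℚ.≤ X a
X-nonneg zero          = ℚ.≤-refl
X-nonneg (suc zero)    = ℚ.nonNegative⁻¹ 1ℚ
X-nonneg (suc (suc _)) = ℚ.≤-refl

t-0 : t 0 ≡ 0ℚ
t-0 = refl

-- In degree a + 1 the Riccati equation reads (2a + 1) t_(a+1) = X_(a+1) + (t ⋆ t)_(a+1). Since t_0
-- = 0, the square involves only earlier coefficients, so nonnegativity propagates.
t-nonneg : ∀ a → 0ℚ ℚ.≤ t a
t-nonneg = <-rec (λ a → 0ℚ ℚ.≤ t a) step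
  where
  step : ∀ a → (∀ {b} → b < a → 0ℚ ℚ.≤ t b) → 0ℚ ℚ.≤ t a
  step zero    _  = ℚ.≤-reflexive (sym t-0)
  step (suc a) ih = subst (0ℚ ℚ.≤_) (sym t-solved)
    (*-nonneg (ℚ.nonNegative⁻¹ r {{ℚ.normalize-nonNeg 1 (suc (2 ℕ.* a))}})
      (ℚ.+-mono-≤ (X-nonneg (suc a)) (antidiag-nonneg (suc a) term)))
    where
    open ≡-Reasoning
    open ℚ-Solver
    m r : ℚ
    m = ℕtoℚ (suc (2 ℕ.* a))
    r = ℤ.+ 1 / suc (2 ℕ.* a)
    -- The two extreme products would involve t_(a+1) itself; they vanish through t_0 = 0.
    term : ∀ i j → i ℕ.+ j ≡ suc a → 0ℚ ℚ.≤ t i * t j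
    term zero    j       _    = ℚ.≤-reflexive (sym (ℚ.*-zeroˡ (t j)))
    term i@(suc _) zero  _    = ℚ.≤-reflexive (sym (ℚ.*-zeroʳ (t i)))
    term (suc i) (suc j) refl =
      *-nonneg (ih (s≤s (subst (suc i ≤_) (sym (ℕ.+-suc i j)) (s≤s (ℕ.m≤m+n i j)))))
               (ih (s≤s (ℕ.m≤n+m (suc j) i)))
    t-solved : t (suc a) ≡ r * (X (suc a) + (t ⋆ t) (suc a))
    t-solved = *-cancelˡ-inverse m r (ℕtoℚ-inverse (suc (2 ℕ.* a))) (begin
      m * t (suc a)
        ≡⟨ cong (_* t (suc a)) (sym (2[1+a]-1 a)) ⟩
      (2ℚ * ℕtoℚ (suc a) + -1ℚ) * t (suc a)
        ≡⟨ solve 2 (λ n t → (con 2ℚ :* n :+ con -1ℚ) :* t := con 2ℚ :* (n :* t) :+ :- t)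
             refl (ℕtoℚ (suc a)) (t (suc a)) ⟩
      2ℚ * θ t (suc a) + - t (suc a)
        ≡⟨ cong (_+ - t (suc a)) (const-⋆ 2ℚ (θ t) (suc a)) ⟨
      (const 2ℚ ⋆ θ t ⊕ ⊖ t) (suc a)
        ≡⟨ t-riccati (suc a) ⟩
      w
        ≡⟨ ℚ.*-identityˡ w ⟨
      1ℚ * w
        ≡⟨ cong (_* w) (ℕtoℚ-inverse (suc (2 ℕ.* a))) ⟨
      m * r * w
        ≡⟨ ℚ.*-assoc m r w ⟩
      m * (r * w) ∎)
      where w = X (suc a) + (t ⋆ t) (suc a)

∣-1^ℚ∣ : ∀ k → ∣ -1ℚ ^ℚ k ∣ ≡ 1ℚ
∣-1^ℚ∣ zero    = refl
∣-1^ℚ∣ (suc k) = trans (ℚ.∣p*q∣≡∣p∣*∣q∣ -1ℚ (-1ℚ ^ℚ k)) (trans (ℚ.*-identityˡ _) (∣-1^ℚ∣ k))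

ℕtoℚ-nonneg : ∀ n → 0ℚ ℚ.≤ ℕtoℚ n
ℕtoℚ-nonneg n = ℚ.nonNegative⁻¹ (ℕtoℚ n) {{ℚ.normalize-nonNeg n 1}}

-- A nonnegative coefficient equals its absolute value, in which the signs (-1)^k and -1 separating
-- `t` from `g` disappear. In this way |c_k| is reached without a formula for the sign of B_(2k).
t-coeffK : ∀ k → t k ≡ 2ℚ * (ℕtoℚ k * ∣ coeffK k ∣)
t-coeffK k = begin
  t k                                         ≡⟨ ℚ.0≤p⇒∣p∣≡p (t-nonneg k) ⟨
  ∣ - (-1ℚ ^ℚ k * g k) ∣                      ≡⟨ ℚ.∣-p∣≡∣p∣ (-1ℚ ^ℚ k * g k) ⟩
  ∣ -1ℚ ^ℚ k * g k ∣                          ≡⟨ ℚ.∣p*q∣≡∣p∣*∣q∣ (-1ℚ ^ℚ k) (g k) ⟩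
  ∣ -1ℚ ^ℚ k ∣ * ∣ g k ∣                      ≡⟨ cong₂ (λ x y → x * ∣ y ∣) (∣-1^ℚ∣ k) (g-coeffK k) ⟩
  1ℚ * ∣ 2ℚ * (ℕtoℚ k * coeffK k) ∣           ≡⟨ ℚ.*-identityˡ _ ⟩
  ∣ 2ℚ * (ℕtoℚ k * coeffK k) ∣                ≡⟨ ℚ.∣p*q∣≡∣p∣*∣q∣ 2ℚ (ℕtoℚ k * coeffK k) ⟩
  2ℚ * ∣ ℕtoℚ k * coeffK k ∣                  ≡⟨ cong (2ℚ *_) (ℚ.∣p*q∣≡∣p∣*∣q∣ (ℕtoℚ k) (coeffK k)) ⟩
  2ℚ * (∣ ℕtoℚ k ∣ * ∣ coeffK k ∣)            ≡⟨ cong (λ x → 2ℚ * (x * ∣ coeffK k ∣)) (ℚ.0≤p⇒∣p∣≡p (ℕtoℚ-nonneg k)) ⟩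
  2ℚ * (ℕtoℚ k * ∣ coeffK k ∣)                ∎
  where open ≡-Reasoning

-- The expansion of log (1/cos √y) with coefficients |c_k|, in differentiated form, so that no
-- logarithm of a series is needed.
s-ode : θ s ≗ θ (λ k → ∣ coeffK k ∣) ⋆ s
s-ode a = *-cancelˡ-inverse 2ℚ ℚ.½ refl (begin
  2ℚ * θ s a             ≡⟨ const-⋆ 2ℚ (θ s) a ⟨
  (const 2ℚ ⋆ θ s) a     ≡⟨ θs a ⟩
  (t ⋆ s) a              ≡⟨ antidiag-cong a (λ i j _ → trans (cong (_* s j) (t-coeffK i))
                              (ℚ.*-assoc 2ℚ (ℕtoℚ i * ∣ coeffK i ∣) (s j))) ⟩
  antidiag a (λ i j → 2ℚ * (θ (λ k → ∣ coeffK k ∣) i * s j)) ≡⟨ antidiag-*ˡ a 2ℚ _ ⟩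
  2ℚ * (θ (λ k → ∣ coeffK k ∣) ⋆ s) a ∎)
  where open ≡-Reasoning

antidiag-head : ∀ a h → (∀ i j → h (suc i) j ≡ 0ℚ) → antidiag a h ≡ h 0 a
antidiag-head zero    h h≡0 = refl
antidiag-head (suc a) h h≡0 = trans
  (cong (h 0 (suc a) +_) (trans (antidiag-cong a λ i j _ → h≡0 i j) (antidiag-zero a)))
  (ℚ.+-identityʳ _)

-- A 2 × 2 array of indices is summed by rows or by columns. In `cancel-mulM` the rows are the two
-- alphabets and the columns the two factors of a product.
antidiag-exchange : ∀ a (h : ℕ → ℕ → ℕ → ℕ → ℚ) →
  antidiag a (λ i j → antidiag i λ i₁ i₂ → antidiag j λ j₁ j₂ → h i₁ i₂ j₁ j₂) ≡
  antidiag a (λ k l → antidiag k λ i₁ j₁ → antidiag l λ i₂ j₂ → h i₁ i₂ j₁ j₂)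
antidiag-exchange a h = begin
  antidiag a (λ i j → antidiag i λ i₁ i₂ → antidiag j (h i₁ i₂))
    ≡⟨ antidiag-assoc a (λ i₁ i₂ j → antidiag j (h i₁ i₂)) ⟩
  antidiag a (λ i₁ m → antidiag m λ i₂ j → antidiag j (h i₁ i₂))
    ≡⟨ antidiag-cong a (λ i₁ m _ → middle i₁ m) ⟩
  antidiag a (λ i₁ m → antidiag m λ j₁ l → antidiag l λ i₂ j₂ → h i₁ i₂ j₁ j₂)
    ≡⟨ antidiag-assoc a (λ i₁ j₁ l → antidiag l λ i₂ j₂ → h i₁ i₂ j₁ j₂) ⟨
  antidiag a (λ k l → antidiag k λ i₁ j₁ → antidiag l λ i₂ j₂ → h i₁ i₂ j₁ j₂) ∎
  where
  open ≡-Reasoning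
  middle : ∀ i₁ m → antidiag m (λ i₂ j → antidiag j (h i₁ i₂)) ≡
                    antidiag m (λ j₁ l → antidiag l λ i₂ j₂ → h i₁ i₂ j₁ j₂)
  middle i₁ m = begin
    antidiag m (λ i₂ j → antidiag j (h i₁ i₂))
      ≡⟨ antidiag-assoc m (h i₁) ⟨
    antidiag m (λ n j₂ → antidiag n λ i₂ j₁ → h i₁ i₂ j₁ j₂)
      ≡⟨ antidiag-cong m (λ n j₂ _ → antidiag-comm n (λ i₂ j₁ → h i₁ i₂ j₁ j₂)) ⟩
    antidiag m (λ n j₂ → antidiag n λ j₁ i₂ → h i₁ i₂ j₁ j₂)
      ≡⟨ antidiag-assoc m (λ j₁ i₂ j₂ → h i₁ i₂ j₁ j₂) ⟩
    antidiag m (λ j₁ l → antidiag l λ i₂ j₂ → h i₁ i₂ j₁ j₂) ∎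

antidiag-product : ∀ a b h k →
  antidiag a h * antidiag b k ≡ antidiag a (λ i₁ i₂ → antidiag b λ j₁ j₂ → h i₁ i₂ * k j₁ j₂)
antidiag-product a b h k = trans (sym (antidiag-*ʳ a (antidiag b k) h))
  (antidiag-cong a λ i₁ i₂ _ → sym (antidiag-*ˡ b (h i₁ i₂) k))

-- The involution ω

-- Series in two alphabets.  The second one carries the specialisation
-- h_r ↦ e_r, so that h_r becomes Σ_{i+j=r} h_i(x) e_j(y).
Mixed : Set
Mixed = List ℕ → List ℕ → ℚ

mulM : Mixed → Mixed → Mixed
mulM F G γ α = splitSum γ λ γ₁ γ₂ → splitSum α λ α₁ α₂ → F γ₁ α₁ * G γ₂ α₂

hM : ℕ → Mixed
hM r γ α = if (degree γ ℕ.+ degree α ≡ᵇ r) ∧ allB (λ a → a ≤ᵇ 1) α then 1ℚ else 0ℚ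

oneM : Mixed
oneM γ α = oneS γ * oneS α

hsM : List ℕ → Mixed
hsM λs = foldr mulM oneM (map hM λs)

evalM : Poly → Mixed
evalM Q γ α = ∑ Q λ t → proj₁ t * hsM (proj₂ t) γ α

sumS-map : ∀ {Y : Set} (F : Y → Series) xs α → sumS (map F xs) α ≡ ∑ xs (λ x → F x α)
sumS-map F []       α = refl
sumS-map F (x ∷ xs) α = cong (F x α +_) (sumS-map F xs α)

-- Removing all y variables leaves the h's, and removing all x variables (`hsM-e`) leaves the e's.
-- Hence the two evaluations in `IsOmegaOf` are restrictions of the single series `evalM Q`.
hsM-h : ∀ λs γ → hsM λs γ [] ≡ prodS (map hS λs) γ
hsM-h []       γ = ℚ.*-identityʳ (oneS γ)
hsM-h (r ∷ λs) γ = trans (splitSum-cong γ λ γ₁ γ₂ _ → cong₂ _*_ (hM-h γ₁) (hsM-h λs γ₂))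
  (sym (mulS-splitSum (hS r) (prodS (map hS λs)) γ))
  where
  hM-h : ∀ γ → hM r γ [] ≡ hS r γ
  hM-h γ rewrite ℕ.+-identityʳ (degree γ) with degree γ ≡ᵇ r
  ... | true  = refl
  ... | false = refl

hsM-e : ∀ λs α → hsM λs [] α ≡ prodS (map eS λs) α
hsM-e []       α = ℚ.*-identityˡ (oneS α)
hsM-e (r ∷ λs) α = trans (splitSum-cong α λ α₁ α₂ _ → cong (eS r α₁ *_) (hsM-e λs α₂))
  (sym (mulS-splitSum (eS r) (prodS (map eS λs)) α))

evalM-h : ∀ Q γ → evalM Q γ [] ≡ evalPoly hS Q γ
evalM-h Q γ = trans (∑-cong Q λ t → cong (proj₁ t *_) (hsM-h (proj₂ t) γ)) (sym (sumS-map _ Q γ))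

evalM-e : ∀ Q α → evalM Q [] α ≡ evalPoly eS Q α
evalM-e Q α = trans (∑-cong Q λ t → cong (proj₁ t *_) (hsM-e (proj₂ t) α)) (sym (sumS-map _ Q α))

-- The coefficient of y^a after x₁ ↦ −y, y₁ ↦ y; this substitution cancels the two variables.
cancel : ℕ → Mixed → Mixed
cancel a F γ α = antidiag a λ b c → -1ℚ ^ℚ b * F (b ∷ γ) (c ∷ α)

Supersymmetric : Mixed → Set
Supersymmetric F = ∀ a γ α → cancel a F γ α ≡ δ a * F γ α

-- Solving the cancellation relation puts a fresh x variable in front; at exponent 0 this condition
-- removes it again.
Padded : Mixed → Set
Padded F = ∀ γ α → F (0 ∷ γ) α ≡ F γ α

mulM-∷ : ∀ F G b γ c α → mulM F G (b ∷ γ) (c ∷ α) ≡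
  antidiag b λ b₁ b₂ → antidiag c λ c₁ c₂ → mulM (λ γ α → F (b₁ ∷ γ) (c₁ ∷ α)) (λ γ α → G (b₂ ∷ γ) (c₂ ∷ α)) γ α
mulM-∷ F G b γ c α = antidiag-cong b λ b₁ b₂ _ → splitSum-antidiag γ c _

mulM-scale : ∀ p q F G γ α → mulM (λ γ α → p * F γ α) (λ γ α → q * G γ α) γ α ≡ p * q * mulM F G γ α
mulM-scale p q F G γ α = trans
  (splitSum-cong γ λ γ₁ γ₂ _ → trans
    (splitSum-cong α λ α₁ α₂ _ → solve 4 (λ p f q g → (p :* f) :* (q :* g) := p :* q :* (f :* g)) refl
      p (F γ₁ α₁) q (G γ₂ α₂))
    (splitSum-*ˡ α (p * q) _))
  (splitSum-*ˡ γ (p * q) _)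
  where open ℚ-Solver

mulM-cong : ∀ {F F′ G G′} → (∀ γ α → F γ α ≡ F′ γ α) → (∀ γ α → G γ α ≡ G′ γ α) →
            ∀ γ α → mulM F G γ α ≡ mulM F′ G′ γ α
mulM-cong p q γ α = splitSum-cong γ λ γ₁ γ₂ _ → splitSum-cong α λ α₁ α₂ _ →
  cong₂ _*_ (p γ₁ α₁) (q γ₂ α₂)

mulM-antidiag : ∀ i j (F G : ℕ → ℕ → Mixed) γ α →
  mulM (λ γ α → antidiag i λ b c → F b c γ α) (λ γ α → antidiag j λ b c → G b c γ α) γ α ≡
  antidiag i λ b₁ c₁ → antidiag j λ b₂ c₂ → mulM (F b₁ c₁) (G b₂ c₂) γ α
mulM-antidiag i j F G γ α = begin
  splitSum γ (λ γ₁ γ₂ → splitSum α λ α₁ α₂ →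
    antidiag i (λ b c → F b c γ₁ α₁) * antidiag j (λ b c → G b c γ₂ α₂))
    ≡⟨ splitSum-cong γ (λ γ₁ γ₂ _ → trans
         (splitSum-cong α λ α₁ α₂ _ → antidiag-product i j (λ b c → F b c γ₁ α₁) (λ b c → G b c γ₂ α₂))
         (trans (splitSum-antidiag α i _) (antidiag-cong i λ b₁ c₁ _ → splitSum-antidiag α j _))) ⟩
  splitSum γ (λ γ₁ γ₂ → antidiag i λ b₁ c₁ → antidiag j λ b₂ c₂ → splitSum α λ α₁ α₂ →
    F b₁ c₁ γ₁ α₁ * G b₂ c₂ γ₂ α₂)
    ≡⟨ trans (splitSum-antidiag γ i _) (antidiag-cong i λ b₁ c₁ _ → splitSum-antidiag γ j _) ⟩
  antidiag i (λ b₁ c₁ → antidiag j λ b₂ c₂ → mulM (F b₁ c₁) (G b₂ c₂) γ α) ∎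
  where open ≡-Reasoning

-- A substitution is multiplicative. The sign splits as (-1)^b = (-1)^(b₁) (-1)^(b₂), and
-- `antidiag-exchange` regroups the indices by factor.
cancel-mulM : ∀ a F G γ α →
  cancel a (mulM F G) γ α ≡ antidiag a (λ i j → mulM (cancel i F) (cancel j G) γ α)
cancel-mulM a F G γ α = begin
  antidiag a (λ b c → -1ℚ ^ℚ b * mulM F G (b ∷ γ) (c ∷ α))
    ≡⟨ antidiag-cong a (λ b c _ → trans (cong (-1ℚ ^ℚ b *_) (mulM-∷ F G b γ c α)) (trans
         (sym (antidiag-*ˡ b (-1ℚ ^ℚ b) _)) (antidiag-cong b λ b₁ b₂ e → trans
         (sym (antidiag-*ˡ c (-1ℚ ^ℚ b) _)) (antidiag-cong c λ c₁ c₂ _ → sign b b₁ b₂ c₁ c₂ e)))) ⟩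
  antidiag a (λ b c → antidiag b λ b₁ b₂ → antidiag c λ c₁ c₂ →
    mulM (F′ b₁ c₁) (G′ b₂ c₂) γ α)
    ≡⟨ antidiag-exchange a (λ b₁ b₂ c₁ c₂ → mulM (F′ b₁ c₁) (G′ b₂ c₂) γ α) ⟩
  antidiag a (λ i j → antidiag i λ b₁ c₁ → antidiag j λ b₂ c₂ →
    mulM (F′ b₁ c₁) (G′ b₂ c₂) γ α)
    ≡⟨ antidiag-cong a (λ i j _ → mulM-antidiag i j F′ G′ γ α) ⟨
  antidiag a (λ i j → mulM (cancel i F) (cancel j G) γ α) ∎
  where
  open ≡-Reasoning
  F′ G′ : ℕ → ℕ → Mixed
  F′ b c γ α = -1ℚ ^ℚ b * F (b ∷ γ) (c ∷ α)
  G′ b c γ α = -1ℚ ^ℚ b * G (b ∷ γ) (c ∷ α)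
  sign : ∀ b b₁ b₂ c₁ c₂ → b₁ ℕ.+ b₂ ≡ b →
    -1ℚ ^ℚ b * mulM (λ γ α → F (b₁ ∷ γ) (c₁ ∷ α)) (λ γ α → G (b₂ ∷ γ) (c₂ ∷ α)) γ α ≡
    mulM (F′ b₁ c₁) (G′ b₂ c₂) γ α
  sign b b₁ b₂ c₁ c₂ refl = trans
    (cong (_* mulM (λ γ α → F (b₁ ∷ γ) (c₁ ∷ α)) (λ γ α → G (b₂ ∷ γ) (c₂ ∷ α)) γ α) (^ℚ-+ -1ℚ b₁ b₂))
    (sym (mulM-scale (-1ℚ ^ℚ b₁) (-1ℚ ^ℚ b₂) (λ γ α → F (b₁ ∷ γ) (c₁ ∷ α)) (λ γ α → G (b₂ ∷ γ) (c₂ ∷ α)) γ α))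

-- Since the y part is squarefree, only y₁ exponents 0 and 1 survive; the two remaining terms have
-- equal total degree and opposite signs.
hM-supersymmetric : ∀ r → Supersymmetric (hM r)
hM-supersymmetric r zero    γ α = refl
hM-supersymmetric r (suc a) γ α = begin
  antidiag (suc a) (λ b c → h b c)
    ≡⟨ antidiag-comm (suc a) h ⟩
  h (suc a) 0 + antidiag a (λ c b → h b (suc c))
    ≡⟨ cong (_+_ (h (suc a) 0)) (antidiag-head a (λ c b → h b (suc c)) c≥2) ⟩
  -1ℚ * -1ℚ ^ℚ a * hM r (suc a ∷ γ) (0 ∷ α) + -1ℚ ^ℚ a * hM r (a ∷ γ) (1 ∷ α)
    ≡⟨ cong (λ q → -1ℚ * -1ℚ ^ℚ a * q + -1ℚ ^ℚ a * hM r (a ∷ γ) (1 ∷ α)) same ⟩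
  -1ℚ * -1ℚ ^ℚ a * hM r (a ∷ γ) (1 ∷ α) + -1ℚ ^ℚ a * hM r (a ∷ γ) (1 ∷ α)
    ≡⟨ solve 2 (λ e q → con -1ℚ :* e :* q :+ e :* q := con 0ℚ) refl (-1ℚ ^ℚ a) (hM r (a ∷ γ) (1 ∷ α)) ⟩
  0ℚ
    ≡⟨ ℚ.*-zeroˡ (hM r γ α) ⟨
  0ℚ * hM r γ α ∎
  where
  open ≡-Reasoning
  open ℚ-Solver
  h : ℕ → ℕ → ℚ
  h b c = -1ℚ ^ℚ b * hM r (b ∷ γ) (c ∷ α)
  c≥2 : ∀ c b → h b (suc (suc c)) ≡ 0ℚ
  c≥2 c b with degree (b ∷ γ) ℕ.+ degree (2 ℕ.+ c ∷ α) ≡ᵇ r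
  ... | true  = ℚ.*-zeroʳ (-1ℚ ^ℚ b)
  ... | false = ℚ.*-zeroʳ (-1ℚ ^ℚ b)
  same : hM r (suc a ∷ γ) (0 ∷ α) ≡ hM r (a ∷ γ) (1 ∷ α)
  same = cong (λ d → if (d ≡ᵇ r) ∧ allB (λ a → a ≤ᵇ 1) α then 1ℚ else 0ℚ)
    (sym (ℕ.+-suc (a ℕ.+ degree γ) (degree α)))

oneM-supersymmetric : Supersymmetric oneM
oneM-supersymmetric zero    γ α = refl
oneM-supersymmetric (suc a) γ α = trans
  (trans (antidiag-cong (suc a) vanish) (antidiag-zero (suc a))) (sym (ℚ.*-zeroˡ (oneM γ α)))
  where
  vanish : ∀ b c → b ℕ.+ c ≡ suc a → -1ℚ ^ℚ b * oneM (b ∷ γ) (c ∷ α) ≡ 0ℚ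
  vanish (suc b) c       _ = trans (cong (-1ℚ ^ℚ suc b *_) (ℚ.*-zeroˡ (oneS (c ∷ α)))) (ℚ.*-zeroʳ (-1ℚ ^ℚ suc b))
  vanish zero    (suc c) _ = cong (1ℚ *_) (ℚ.*-zeroʳ (oneS (0 ∷ γ)))

mulM-supersymmetric : ∀ F G → Supersymmetric F → Supersymmetric G → Supersymmetric (mulM F G)
mulM-supersymmetric F G F-ss G-ss a γ α = begin
  cancel a (mulM F G) γ α
    ≡⟨ cancel-mulM a F G γ α ⟩
  antidiag a (λ i j → mulM (cancel i F) (cancel j G) γ α)
    ≡⟨ antidiag-cong a (λ i j _ → trans (mulM-cong (F-ss i) (G-ss j) γ α) (mulM-scale (δ i) (δ j) F G γ α)) ⟩
  antidiag a (λ i j → δ i * δ j * mulM F G γ α)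
    ≡⟨ antidiag-*ʳ a (mulM F G γ α) (λ i j → δ i * δ j) ⟩
  (δ ⋆ δ) a * mulM F G γ α
    ≡⟨ cong (_* mulM F G γ α) (⋆-identityˡ δ a) ⟩
  δ a * mulM F G γ α ∎
  where open ≡-Reasoning

hsM-supersymmetric : ∀ λs → Supersymmetric (hsM λs)
hsM-supersymmetric []       = oneM-supersymmetric
hsM-supersymmetric (r ∷ λs) =
  mulM-supersymmetric (hM r) (hsM λs) (hM-supersymmetric r) (hsM-supersymmetric λs)

hsM-padded : ∀ λs → Padded (hsM λs)
hsM-padded []       γ α = refl
hsM-padded (r ∷ λs) γ α = splitSum-cong γ λ γ₁ γ₂ _ → splitSum-cong α λ α₁ α₂ _ →
  cong (hM r γ₁ α₁ *_) (hsM-padded λs γ₂ α₂)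

evalM-supersymmetric : ∀ Q → Supersymmetric (evalM Q)
evalM-supersymmetric Q a γ α = begin
  antidiag a (λ b c → -1ℚ ^ℚ b * evalM Q (b ∷ γ) (c ∷ α))
    ≡⟨ antidiag-cong a (λ b c _ → trans (sym (∑-*ˡ Q (-1ℚ ^ℚ b) _))
         (∑-cong Q λ t → swap (-1ℚ ^ℚ b) (proj₁ t) (hsM (proj₂ t) (b ∷ γ) (c ∷ α)))) ⟩
  antidiag a (λ b c → ∑ Q λ t → proj₁ t * (-1ℚ ^ℚ b * hsM (proj₂ t) (b ∷ γ) (c ∷ α)))
    ≡⟨ ∑-antidiag Q a (λ t b c → proj₁ t * (-1ℚ ^ℚ b * hsM (proj₂ t) (b ∷ γ) (c ∷ α))) ⟨
  ∑ Q (λ t → antidiag a λ b c → proj₁ t * (-1ℚ ^ℚ b * hsM (proj₂ t) (b ∷ γ) (c ∷ α)))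
    ≡⟨ ∑-cong Q (λ t → trans (antidiag-*ˡ a (proj₁ t) _) (trans
         (cong (proj₁ t *_) (hsM-supersymmetric (proj₂ t) a γ α)) (swap (proj₁ t) (δ a) (hsM (proj₂ t) γ α)))) ⟩
  ∑ Q (λ t → δ a * (proj₁ t * hsM (proj₂ t) γ α))
    ≡⟨ ∑-*ˡ Q (δ a) _ ⟩
  δ a * evalM Q γ α ∎
  where
  open ≡-Reasoning
  swap : ∀ x y z → x * (y * z) ≡ y * (x * z)
  swap = solve 3 (λ x y z → x :* (y :* z) := y :* (x :* z)) refl
    where open ℚ-Solver

evalM-padded : ∀ Q → Padded (evalM Q)
evalM-padded Q γ α = ∑-cong Q λ t → cong (proj₁ t *_) (hsM-padded (proj₂ t) γ α)

-- In the relation of degree a + 1, the term with x₁ exponent 0 is the coefficient sought, and all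
-- others have a smaller y₁ exponent. Repeating this moves the y variables one after another into
-- the x alphabet, where the two series agree.
supersymmetric-unique : ∀ {F G} → Supersymmetric F → Supersymmetric G → Padded F → Padded G →
  (∀ γ → F γ [] ≡ G γ []) → ∀ α γ → F γ α ≡ G γ α
supersymmetric-unique {F} {G} F-ss G-ss F-pad G-pad base []      γ = base γ
supersymmetric-unique {F} {G} F-ss G-ss F-pad G-pad base (a ∷ α) =
  -- `γ` stays quantified because each reduction lengthens it by one variable.
  <-rec (λ a → ∀ γ → F γ (a ∷ α) ≡ G γ (a ∷ α)) step a
  where
  open ≡-Reasoning
  solved : ∀ H → Supersymmetric H → Padded H → ∀ a γ → H γ (suc a ∷ α) ≡
           - antidiag a (λ b c → -1ℚ ^ℚ suc b * H (suc b ∷ γ) (c ∷ α))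
  solved H H-ss H-pad a γ = begin
    H γ (suc a ∷ α)            ≡⟨ H-pad γ (suc a ∷ α) ⟨
    x                          ≡⟨ solve 2 (λ x r → x := (con 1ℚ :* x :+ r) :+ :- r) refl x r ⟩
    (1ℚ * x + r) + - r         ≡⟨ cong (_+ - r) (trans (H-ss (suc a) γ α) (ℚ.*-zeroˡ (H γ α))) ⟩
    0ℚ + - r                   ≡⟨ ℚ.+-identityˡ (- r) ⟩
    - r                        ∎
    where
    open ℚ-Solver
    x = H (0 ∷ γ) (suc a ∷ α)
    r = antidiag a (λ b c → -1ℚ ^ℚ suc b * H (suc b ∷ γ) (c ∷ α))
  solved₀ : ∀ H → Supersymmetric H → Padded H → ∀ γ → H γ (0 ∷ α) ≡ H γ α
  solved₀ H H-ss H-pad γ = begin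
    H γ (0 ∷ α)              ≡⟨ H-pad γ (0 ∷ α) ⟨
    H (0 ∷ γ) (0 ∷ α)        ≡⟨ ℚ.*-identityˡ _ ⟨
    1ℚ * H (0 ∷ γ) (0 ∷ α)   ≡⟨ H-ss 0 γ α ⟩
    1ℚ * H γ α               ≡⟨ ℚ.*-identityˡ _ ⟩
    H γ α                    ∎
  step : ∀ a → (∀ {c} → c < a → ∀ γ → F γ (c ∷ α) ≡ G γ (c ∷ α)) → ∀ γ → F γ (a ∷ α) ≡ G γ (a ∷ α)
  step zero    _  γ = trans (solved₀ F F-ss F-pad γ) (trans
    (supersymmetric-unique {F} {G} F-ss G-ss F-pad G-pad base α γ) (sym (solved₀ G G-ss G-pad γ)))
  step (suc a) ih γ = trans (solved F F-ss F-pad a γ) (trans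
    (cong -_ (antidiag-cong a λ b c e → cong (-1ℚ ^ℚ suc b *_)
      (ih (s≤s (subst (c ≤_) e (ℕ.m≤n+m c b))) (suc b ∷ γ))))
    (sym (solved G G-ss G-pad a γ)))

-- The coefficients of the product of f(x_i) over all variables.
∏ : Seq → Series
∏ f = foldr (λ a q → f a * q) 1ℚ

indicator : ℕ → ℕ → ℚ
indicator n d = if d ≡ᵇ n then 1ℚ else 0ℚ

-- K times the part of total degree n of ∏ cosh √x_i · ∏ 1/cos √y_j: the candidate for the image of
-- the matching sum in two alphabets.
productM : ℚ → ℕ → Mixed
productM K n γ α = K * (indicator n (degree γ ℕ.+ degree α) * (∏ u γ * ∏ s α))

productM-padded : ∀ K n → Padded (productM K n)
productM-padded K n γ α = cong (λ p → K * (indicator n (degree γ ℕ.+ degree α) * (p * ∏ s α))) (ℚ.*-identityˡ (∏ u γ))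

-- The substitution x₁ ↦ -y turns cosh √x₁ into cos √y, which cancels against 1/cos √y by `ū⋆s`.
productM-supersymmetric : ∀ K n → Supersymmetric (productM K n)
productM-supersymmetric K n a γ α = begin
  antidiag a (λ b c → -1ℚ ^ℚ b * productM K n (b ∷ γ) (c ∷ α))
    ≡⟨ antidiag-cong a term ⟩
  antidiag a (λ b c → ū b * s c * Z a)
    ≡⟨ antidiag-*ʳ a (Z a) (λ b c → ū b * s c) ⟩
  (ū ⋆ s) a * Z a
    ≡⟨ cong (_* Z a) (ū⋆s a) ⟩
  δ a * Z a
    ≡⟨ at-zero a ⟩
  δ a * productM K n γ α ∎
  where
  open ≡-Reasoning
  open ℚ-Solver
  Z : ℕ → ℚ
  Z a = K * (indicator n (a ℕ.+ (degree γ ℕ.+ degree α)) * (∏ u γ * ∏ s α))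
  at-zero : ∀ a → δ a * Z a ≡ δ a * productM K n γ α
  at-zero zero    = refl
  at-zero (suc a) = trans (ℚ.*-zeroˡ (Z (suc a))) (sym (ℚ.*-zeroˡ (productM K n γ α)))
  term : ∀ b c → b ℕ.+ c ≡ a → -1ℚ ^ℚ b * productM K n (b ∷ γ) (c ∷ α) ≡ ū b * s c * Z a
  term b c refl = trans
    (solve 7 (λ e k i x p y q → e :* (k :* (i :* ((x :* p) :* (y :* q)))) := e :* x :* y :* (k :* (i :* (p :* q)))) refl
      (-1ℚ ^ℚ b) K (indicator n (degree (b ∷ γ) ℕ.+ degree (c ∷ α))) (u b) (∏ u γ) (s c) (∏ s α))
    (cong (λ d → ū b * s c * (K * (indicator n d * (∏ u γ * ∏ s α)))) (ℕ-interchange b (degree γ) c (degree α)))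

-- `evalM Q` and `productM K n` are both supersymmetric and agree without y variables, hence
-- everywhere; the claim is their equality without x variables.
ω-product : ∀ K n Q → (∀ α → evalPoly hS Q α ≡ K * (indicator n (degree α) * ∏ u α)) →
            ∀ α → evalPoly eS Q α ≡ K * (indicator n (degree α) * ∏ s α)
ω-product K n Q hyp α = begin
  evalPoly eS Q α           ≡⟨ evalM-e Q α ⟨
  evalM Q [] α              ≡⟨ supersymmetric-unique {evalM Q} {productM K n} (evalM-supersymmetric Q)
                                 (productM-supersymmetric K n) (evalM-padded Q) (productM-padded K n) base α [] ⟩
  productM K n [] α         ≡⟨ cong (λ q → K * (indicator n (degree α) * q)) (ℚ.*-identityˡ (∏ s α)) ⟩
  K * (indicator n (degree α) * ∏ s α) ∎
  where
  open ≡-Reasoning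
  base : ∀ γ → evalM Q γ [] ≡ productM K n γ []
  base γ = trans (evalM-h Q γ) (trans (hyp γ) (cong₂ (λ d q → K * (indicator n d * q))
    (sym (ℕ.+-identityʳ (degree γ))) (sym (ℚ.*-identityʳ (∏ u γ)))))

-- The power sum side

infixl 7 _·_

_·_ : Series → Series → Series
(f · g) α = splitSum α λ β γ → f β * g γ

-- The degree bounds allow identities that hold only up to degree n to be used inside a product.
·-cong : ∀ {f f′ g g′} α → (∀ β → degree β ≤ degree α → f β ≡ f′ β) →
         (∀ γ → degree γ ≤ degree α → g γ ≡ g′ γ) → (f · g) α ≡ (f′ · g′) α
·-cong α p q = splitSum-cong α λ β γ e → cong₂ _*_
  (p β (subst (degree β ≤_) e (ℕ.m≤m+n (degree β) (degree γ))))
  (q γ (subst (degree γ ≤_) e (ℕ.m≤n+m (degree γ) (degree β))))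

·-comm : ∀ f g α → (f · g) α ≡ (g · f) α
·-comm f g α = trans (splitSum-comm α _) (splitSum-cong α λ β γ _ → ℚ.*-comm (f γ) (g β))

·-assoc : ∀ f g h α → (f · g · h) α ≡ (f · (g · h)) α
·-assoc f g h α = begin
  splitSum α (λ β γ → splitSum β (λ β₁ β₂ → f β₁ * g β₂) * h γ)
    ≡⟨ splitSum-cong α (λ β γ _ → splitSum-*ʳ β (h γ) (λ β₁ β₂ → f β₁ * g β₂)) ⟨
  splitSum α (λ β γ → splitSum β (λ β₁ β₂ → f β₁ * g β₂ * h γ))
    ≡⟨ splitSum-assoc α (λ β₁ β₂ γ → f β₁ * g β₂ * h γ) ⟩
  splitSum α (λ β δ → splitSum δ (λ δ₁ δ₂ → f β * g δ₁ * h δ₂))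
    ≡⟨ splitSum-cong α (λ β δ _ → trans
         (splitSum-cong δ λ δ₁ δ₂ _ → ℚ.*-assoc (f β) (g δ₁) (h δ₂)) (splitSum-*ˡ δ (f β) _)) ⟩
  (f · (g · h)) α ∎
  where open ≡-Reasoning

·-distribʳ : ∀ f g h α → (addS f g · h) α ≡ (f · h) α + (g · h) α
·-distribʳ f g h α = trans
  (splitSum-cong α λ β γ _ → ℚ.*-distribʳ-+ (h γ) (f β) (g β)) (splitSum-+ α _ _)

·-scaleˡ : ∀ c f g α → (scaleS c f · g) α ≡ c * (f · g) α
·-scaleˡ c f g α = trans (splitSum-cong α λ β γ _ → ℚ.*-assoc c (f β) (g γ)) (splitSum-*ˡ α c _)

·-scaleʳ : ∀ c f g α → (f · scaleS c g) α ≡ c * (f · g) α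
·-scaleʳ c f g α = trans (·-comm f (scaleS c g) α)
  (trans (·-scaleˡ c g f α) (cong (c *_) (·-comm g f α)))

·-∑ : ∀ {Y : Set} f (xs : List Y) (c : Y → ℚ) (g : Y → Series) α →
  (f · λ γ → ∑ xs (λ x → c x * g x γ)) α ≡ ∑ xs (λ x → c x * (f · g x) α)
·-∑ f []       c g α = trans (splitSum-cong α λ β γ _ → ℚ.*-zeroʳ (f β)) (splitSum-zero α)
·-∑ f (x ∷ xs) c g α = trans
  (trans (splitSum-cong α λ β γ _ → ℚ.*-distribˡ-+ (f β) (c x * g x γ) _) (splitSum-+ α _ _))
  (cong₂ _+_ (·-scaleʳ (c x) f (g x) α) (·-∑ f xs c g α))

·-identityˡ : ∀ f α → (oneS · f) α ≡ f α
·-identityˡ f []      = ℚ.*-identityˡ (f [])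
·-identityˡ f (a ∷ α) = begin
  antidiag a (λ b c → splitSum α λ β γ → oneS (b ∷ β) * f (c ∷ γ))
    ≡⟨ antidiag-head a _ (λ i j → trans
         (splitSum-cong α λ β γ _ → ℚ.*-zeroˡ (f (j ∷ γ))) (splitSum-zero α)) ⟩
  ((oneS · (λ γ → f (a ∷ γ))) α)
    ≡⟨ ·-identityˡ (λ γ → f (a ∷ γ)) α ⟩
  f (a ∷ α) ∎
  where open ≡-Reasoning

θS : Series → Series
θS f α = ℕtoℚ (degree α) * f α

θS-· : ∀ f g α → θS (f · g) α ≡ (θS f · g) α + (f · θS g) α
θS-· f g α = trans (sym (splitSum-*ˡ α (ℕtoℚ (degree α)) _)) (trans
  (splitSum-cong α λ β γ e → trans
    (cong (_* (f β * g γ)) (trans (cong ℕtoℚ (sym e)) (ℕtoℚ-+ (degree β) (degree γ))))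
    (solve 4 (λ i j f g → (i :+ j) :* (f :* g) := i :* f :* g :+ f :* (j :* g)) refl
      (ℕtoℚ (degree β)) (ℕtoℚ (degree γ)) (f β) (g γ)))
  (splitSum-+ α _ _))
  where open ℚ-Solver

splitSum-degree-0 : ∀ α h → degree α ≡ 0 → splitSum α h ≡ h α α
splitSum-degree-0 []         h _ = refl
splitSum-degree-0 (zero ∷ α) h e = splitSum-degree-0 α (λ β γ → h (0 ∷ β) (0 ∷ γ)) e

oneS-degree-0 : ∀ α → degree α ≡ 0 → oneS α ≡ 1ℚ
oneS-degree-0 []         _ = refl
oneS-degree-0 (zero ∷ α) e = oneS-degree-0 α e

Homogeneous : ℕ → Series → Set
Homogeneous d f = ∀ α → degree α ≢ d → f α ≡ 0ℚ

oneS-homogeneous : Homogeneous 0 oneS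
oneS-homogeneous []          d≢0 = contradiction refl d≢0
oneS-homogeneous (zero ∷ α)  d≢0 = oneS-homogeneous α d≢0
oneS-homogeneous (suc a ∷ α) d≢0 = refl

·-homogeneous : ∀ {d e f g} → Homogeneous d f → Homogeneous e g → Homogeneous (d ℕ.+ e) (f · g)
·-homogeneous {d} {e} {f} {g} hf hg α deg≢ = trans (splitSum-cong α term) (splitSum-zero α)
  where
  term : ∀ β γ → degree β ℕ.+ degree γ ≡ degree α → f β * g γ ≡ 0ℚ
  term β γ eq with degree β ℕ.≟ d | degree γ ℕ.≟ e
  ... | no β≢d | _       = trans (cong (_* g γ) (hf β β≢d)) (ℚ.*-zeroˡ (g γ))
  ... | yes _  | no γ≢e  = trans (cong (f β *_) (hg γ γ≢e)) (ℚ.*-zeroʳ (f β))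
  ... | yes β≡d | yes γ≡e = contradiction (trans (sym eq) (cong₂ ℕ._+_ β≡d γ≡e)) deg≢

≡ᵇ-false : ∀ m n → m ≢ n → (m ≡ᵇ n) ≡ false
≡ᵇ-false m n m≢n with m ≡ᵇ n in eq
... | false = refl
... | true  = contradiction (ℕ.≡ᵇ⇒≡ m n (subst Bool.T (sym eq) _)) m≢n

≡ᵇ-true : ∀ m → (m ≡ᵇ m) ≡ true
≡ᵇ-true zero    = refl
≡ᵇ-true (suc m) = ≡ᵇ-true m

pS-homogeneous : ∀ k → Homogeneous k (pS k)
pS-homogeneous k α d≢k rewrite ≡ᵇ-false (degree α) k d≢k = refl

_^·_ : Series → ℕ → Series
f ^· zero  = oneS
f ^· suc m = f · (f ^· m)

powS-^· : ∀ f m α → powS f m α ≡ (f ^· m) α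
powS-^· f zero    α = refl
powS-^· f (suc m) α = trans (mulS-splitSum f (powS f m) α)
  (splitSum-cong α λ β γ _ → cong (f β *_) (powS-^· f m γ))

^·-homogeneous : ∀ k m → Homogeneous (m ℕ.* k) (pS k ^· m)
^·-homogeneous k zero    = oneS-homogeneous
^·-homogeneous k (suc m) = ·-homogeneous {k} {m ℕ.* k} {pS k} {pS k ^· m} (pS-homogeneous k) (^·-homogeneous k m)

-- The sum of r_k p_k over all k ≥ 1, an infinite combination of power sums; for r without constant
-- term it is the sum of r(x_i) over the variables.
primS : Seq → Series
primS r []          = 0ℚ
primS r (zero ∷ α)  = primS r α
primS r (suc a ∷ α) = r (suc a) * oneS α

-- Logarithmic derivatives add: if f has logarithmic derivative r, then ∏ f(x_i) has Σ r(x_i).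
∏-ode : ∀ r f → r 0 ≡ 0ℚ → θ f ≗ r ⋆ f → ∀ α → θS (∏ f) α ≡ (primS r · ∏ f) α
∏-ode r f r0 ode []      = refl
∏-ode r f r0 ode (a ∷ α) = sym (begin
  antidiag a (λ b c → splitSum α λ β γ → primS r (b ∷ β) * (f c * ∏ f γ))
    ≡⟨ antidiag-cong a (λ b c _ → trans (splitSum-cong α λ β γ _ → term b c β γ) (trans (splitSum-+ α _ _)
         (cong₂ _+_ (trans (splitSum-*ˡ α (r b * f c) _) (cong (r b * f c *_) (·-identityˡ (∏ f) α)))
                    (splitSum-*ˡ α (δ b * f c) _)))) ⟩
  antidiag a (λ b c → r b * f c * ∏ f α + δ b * f c * P)
    ≡⟨ trans (antidiag-+ a _ _) (cong₂ _+_ (antidiag-*ʳ a (∏ f α) (λ b c → r b * f c))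
         (antidiag-*ʳ a P (λ b c → δ b * f c))) ⟩
  (r ⋆ f) a * ∏ f α + (δ ⋆ f) a * P
    ≡⟨ cong₂ (λ x y → x * ∏ f α + y) (sym (ode a))
         (cong₂ _*_ (⋆-identityˡ f a) (sym (∏-ode r f r0 ode α))) ⟩
  ℕtoℚ a * f a * ∏ f α + f a * (ℕtoℚ (degree α) * ∏ f α)
    ≡⟨ solve 4 (λ i j x y → i :* x :* y :+ x :* (j :* y) := (i :+ j) :* (x :* y)) refl
         (ℕtoℚ a) (ℕtoℚ (degree α)) (f a) (∏ f α) ⟩
  (ℕtoℚ a + ℕtoℚ (degree α)) * (f a * ∏ f α)
    ≡⟨ cong (_* (f a * ∏ f α)) (ℕtoℚ-+ a (degree α)) ⟨
  θS (∏ f) (a ∷ α) ∎)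
  where
  open ≡-Reasoning
  open ℚ-Solver
  P = (primS r · ∏ f) α
  -- The one variable picked by `primS r` is the head, with β zero, or lies in the tail, with b = 0.
  -- For b = 0 the first summand vanishes by `r0`.
  term : ∀ b c β γ → primS r (b ∷ β) * (f c * ∏ f γ) ≡
         r b * f c * (oneS β * ∏ f γ) + δ b * f c * (primS r β * ∏ f γ)
  term zero c β γ = trans
    (solve 4 (λ o p x y → p :* (x :* y) := con 0ℚ :* x :* (o :* y) :+ con 1ℚ :* x :* (p :* y)) refl
      (oneS β) (primS r β) (f c) (∏ f γ))
    (cong (λ q → q * f c * (oneS β * ∏ f γ) + 1ℚ * f c * (primS r β * ∏ f γ)) (sym r0))
  term (suc b) c β γ =
    solve 5 (λ o p x y q → q :* o :* (x :* y) := q :* x :* (o :* y) :+ con 0ℚ :* x :* (p :* y)) refl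
      (oneS β) (primS r β) (f c) (∏ f γ) (r (suc b))

primS-degree-0 : ∀ r α → degree α ≡ 0 → primS r α ≡ 0ℚ
primS-degree-0 r []         _ = refl
primS-degree-0 r (zero ∷ α) e = primS-degree-0 r α e

primS-cong : ∀ {r r′} α → (∀ a → a < degree α → r (suc a) ≡ r′ (suc a)) → primS r α ≡ primS r′ α
primS-cong []          eq = refl
primS-cong (zero ∷ α)  eq = primS-cong α eq
primS-cong (suc a ∷ α) eq = cong (_* oneS α) (eq a (s≤s (ℕ.m≤m+n a (degree α))))

primS-+ : ∀ r r′ α → primS (r ⊕ r′) α ≡ primS r α + primS r′ α
primS-+ r r′ []          = refl
primS-+ r r′ (zero ∷ α)  = primS-+ r r′ α
primS-+ r r′ (suc a ∷ α) = ℚ.*-distribʳ-+ (oneS α) (r (suc a)) (r′ (suc a))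

primS-* : ∀ c r α → primS (λ a → c * r a) α ≡ c * primS r α
primS-* c r []          = sym (ℚ.*-zeroʳ c)
primS-* c r (zero ∷ α)  = primS-* c r α
primS-* c r (suc a ∷ α) = ℚ.*-assoc c (r (suc a)) (oneS α)

primS-0 : ∀ α → primS (λ _ → 0ℚ) α ≡ 0ℚ
primS-0 []          = refl
primS-0 (zero ∷ α)  = primS-0 α
primS-0 (suc a ∷ α) = ℚ.*-zeroˡ (oneS α)

pS-is-primS : ∀ k α → pS (suc k) α ≡ primS (indicator (suc k)) α
pS-is-primS k []          = refl
pS-is-primS k (zero ∷ α)  = pS-is-primS k α
pS-is-primS k (suc a ∷ α) = begin
  (if (a ℕ.+ degree α ≡ᵇ k) ∧ (countB (0 <ᵇ_) α ≡ᵇ 0) then 1ℚ else 0ℚ)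
    ≡⟨ cong (λ b → if (a ℕ.+ degree α ≡ᵇ k) ∧ b then 1ℚ else 0ℚ) (no-positive α) ⟩
  (if (a ℕ.+ degree α ≡ᵇ k) ∧ allB (_≡ᵇ 0) α then 1ℚ else 0ℚ)
    ≡⟨ at-zero ⟩
  indicator k a * oneS α ∎
  where
  open ≡-Reasoning
  no-positive : ∀ α → (countB (0 <ᵇ_) α ≡ᵇ 0) ≡ allB (_≡ᵇ 0) α
  no-positive []          = refl
  no-positive (zero ∷ α)  = no-positive α
  no-positive (suc a ∷ α) = refl
  degree-0 : ∀ α → allB (_≡ᵇ 0) α ≡ true → degree α ≡ 0
  degree-0 []         _ = refl
  degree-0 (zero ∷ α) e = degree-0 α e
  at-zero : (if (a ℕ.+ degree α ≡ᵇ k) ∧ allB (_≡ᵇ 0) α then 1ℚ else 0ℚ) ≡ indicator k a * oneS α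
  at-zero with allB (_≡ᵇ 0) α in eq
  ... | false = trans (cong (λ b → if b then 1ℚ else 0ℚ) (Bool.∧-zeroʳ (a ℕ.+ degree α ≡ᵇ k)))
                      (sym (ℚ.*-zeroʳ (indicator k a)))
  ... | true  = trans (cong (λ b → if b then 1ℚ else 0ℚ) (trans (Bool.∧-identityʳ _)
                        (cong (_≡ᵇ k) (trans (cong (a ℕ.+_) (degree-0 α eq)) (ℕ.+-identityʳ a)))))
                      (sym (ℚ.*-identityʳ (indicator k a)))

-- As R has no constant term, the part of R · F in degree d > 0 uses F only in smaller degrees,
-- while the left side multiplies by the invertible number d.
ode-unique : ∀ {R F F′} n → (∀ α → degree α ≡ 0 → R α ≡ 0ℚ) →
  (∀ α → degree α ≡ 0 → F α ≡ F′ α) →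
  (∀ α → degree α ≤ n → θS F α ≡ (R · F) α) → (∀ α → degree α ≤ n → θS F′ α ≡ (R · F′) α) →
  ∀ α → degree α ≤ n → F α ≡ F′ α
ode-unique {R} {F} {F′} n R0 F0 ode ode′ α = <-rec
  (λ d → ∀ α → degree α ≡ d → d ≤ n → F α ≡ F′ α) step (degree α) α refl
  where
  step : ∀ d → (∀ {e} → e < d → ∀ α → degree α ≡ e → e ≤ n → F α ≡ F′ α) →
         ∀ α → degree α ≡ d → d ≤ n → F α ≡ F′ α
  step zero    ih α eq d≤n = F0 α eq
  step (suc d) ih α eq d≤n = ℕtoℚ-cancelˡ (suc d) (begin
    ℕtoℚ (suc d) * F α    ≡⟨ cong (λ e → ℕtoℚ e * F α) eq ⟨
    θS F α                ≡⟨ ode α α≤n ⟩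
    (R · F) α             ≡⟨ splitSum-cong α term ⟩
    (R · F′) α            ≡⟨ ode′ α α≤n ⟨
    θS F′ α               ≡⟨ cong (λ e → ℕtoℚ e * F′ α) eq ⟩
    ℕtoℚ (suc d) * F′ α   ∎)
    where
    open ≡-Reasoning
    α≤n : degree α ≤ n
    α≤n = subst (_≤ n) (sym eq) d≤n
    term : ∀ β γ → degree β ℕ.+ degree γ ≡ degree α → R β * F γ ≡ R β * F′ γ
    term β γ e with degree β in eβ
    ... | zero  = trans (vanish F) (sym (vanish F′))
      where
      vanish : ∀ H → R β * H γ ≡ 0ℚ
      vanish H = trans (cong (_* H γ) (R0 β eβ)) (ℚ.*-zeroˡ (H γ))
    ... | suc b = cong (R β *_) (ih γ<d γ refl (ℕ.≤-trans (ℕ.<⇒≤ γ<d) d≤n))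
      where
      γ<d : degree γ < suc d
      γ<d = s≤s (subst (degree γ ≤_) (ℕ.suc-injective (trans e eq)) (ℕ.m≤n+m (degree γ) b))

module _ (c : Seq) (n : ℕ) where

  divided : ℕ → ℕ → ℚ
  divided k m = inv! m * c k ^ℚ m

  -- exp (c_k p_k), truncated beyond degree n.
  expP : ℕ → Series
  expP k α = ∑ (upTo (suc n)) λ m → divided k m * (pS k ^· m) α

  expP-degree-0 : ∀ k α → degree α ≡ 0 → expP (suc k) α ≡ 1ℚ
  expP-degree-0 k α e = begin
    1ℚ * (pS (suc k) ^· 0) α + sumℚ (map term (applyUpTo suc n))
      ≡⟨ cong₂ _+_ (trans (ℚ.*-identityˡ _) (oneS-degree-0 α e))
           (cong sumℚ (List.map-applyUpTo suc term n)) ⟩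
    1ℚ + sumℚ (applyUpTo (term ∘ suc) n)
      ≡⟨ cong (λ l → 1ℚ + sumℚ l) (List.map-applyUpTo id (term ∘ suc) n) ⟨
    1ℚ + ∑ (upTo n) (term ∘ suc)
      ≡⟨ cong (1ℚ +_) (trans (∑-cong (upTo n) vanish) (∑-zero (upTo n))) ⟩
    1ℚ + 0ℚ
      ≡⟨⟩
    1ℚ ∎
    where
    open ≡-Reasoning
    term : ℕ → ℚ
    term m = divided (suc k) m * (pS (suc k) ^· m) α
    vanish : ∀ m → term (suc m) ≡ 0ℚ
    vanish m = trans (cong (divided (suc k) (suc m) *_)
      (^·-homogeneous (suc k) (suc m) α λ d → case-0 (trans (sym e) d))) (ℚ.*-zeroʳ (divided (suc k) (suc m)))
      where
      case-0 : ¬ (0 ≡ suc (k ℕ.+ m ℕ.* suc k))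
      case-0 ()

  -- Differentiating the term of exponent m + 1 gives k c_k p_k times the term of exponent m. The
  -- right side has one summand more, m = n, which lies in degree (n + 1) k > n and so vanishes at
  -- α.
  expP-ode : ∀ k α → degree α ≤ n →
             θS (expP (suc k)) α ≡ (scaleS (θ c (suc k)) (pS (suc k)) · expP (suc k)) α
  expP-ode k α α≤n = begin
    ℕtoℚ (degree α) * ∑ (upTo (suc n)) term
      ≡⟨ ∑-*ˡ (upTo (suc n)) (ℕtoℚ (degree α)) term ⟨
    ℕtoℚ (degree α) * term 0 + sumℚ (map θterm (applyUpTo suc n))
      ≡⟨ cong₂ _+_ constant (cong sumℚ (trans (List.map-applyUpTo suc θterm n)
           (sym (List.map-applyUpTo id (θterm ∘ suc) n)))) ⟩
    0ℚ + ∑ (upTo n) (θterm ∘ suc)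
      ≡⟨ ℚ.+-identityˡ _ ⟩
    ∑ (upTo n) (θterm ∘ suc)
      ≡⟨ ∑-cong (upTo n) derivative ⟩
    ∑ (upTo n) shifted
      ≡⟨ ℚ.+-identityʳ _ ⟨
    ∑ (upTo n) shifted + 0ℚ
      ≡⟨ cong (∑ (upTo n) shifted +_) (trans (ℚ.+-identityʳ (shifted n)) top) ⟨
    ∑ (upTo n) shifted + ∑ [ n ] shifted
      ≡⟨ ∑-++ (upTo n) [ n ] shifted ⟨
    ∑ (upTo n ++ [ n ]) shifted
      ≡⟨ cong (λ xs → ∑ xs shifted) (List.applyUpTo-∷ʳ id n) ⟩
    ∑ (upTo (suc n)) shifted
      ≡⟨ ∑-*ˡ (upTo (suc n)) (θ c K) (λ m → divided K m * (p · (p ^· m)) α) ⟩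
    θ c K * ∑ (upTo (suc n)) (λ m → divided K m * (p · (p ^· m)) α)
      ≡⟨ cong (θ c K *_) (·-∑ p (upTo (suc n)) (divided K) (p ^·_) α) ⟨
    θ c K * (p · expP K) α
      ≡⟨ ·-scaleˡ (θ c K) p (expP K) α ⟨
    (scaleS (θ c K) p · expP K) α ∎
    where
    open ≡-Reasoning
    open ℚ-Solver
    K = suc k
    p = pS K
    term θterm shifted : ℕ → ℚ
    term m = divided K m * (p ^· m) α
    θterm m = ℕtoℚ (degree α) * term m
    shifted m = θ c K * (divided K m * (p · (p ^· m)) α)
    -- By homogeneity p_k^m has a coefficient at α only when degree α = m k, so the two factors may
    -- be exchanged.
    weighted : ∀ m → ℕtoℚ (degree α) * (p ^· m) α ≡ ℕtoℚ (m ℕ.* K) * (p ^· m) α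
    weighted m with degree α ℕ.≟ m ℕ.* K
    ... | yes e = cong (λ d → ℕtoℚ d * (p ^· m) α) e
    ... | no ≢  = trans (cong (ℕtoℚ (degree α) *_) z) (trans (ℚ.*-zeroʳ (ℕtoℚ (degree α)))
                    (sym (trans (cong (ℕtoℚ (m ℕ.* K) *_) z) (ℚ.*-zeroʳ (ℕtoℚ (m ℕ.* K))))))
      where z = ^·-homogeneous K m α ≢
    constant : θterm 0 ≡ 0ℚ
    constant = trans (solve 3 (λ d i q → d :* (i :* q) := i :* (d :* q)) refl (ℕtoℚ (degree α)) (divided K 0) (oneS α))
      (trans (cong (divided K 0 *_) (trans (weighted 0) (ℚ.*-zeroˡ (oneS α)))) (ℚ.*-zeroʳ (divided K 0)))
    derivative : ∀ m → θterm (suc m) ≡ shifted m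
    derivative m = begin
      ℕtoℚ (degree α) * (inv! (suc m) * (c K * c K ^ℚ m) * P)
        ≡⟨ solve 5 (λ d i x y q → d :* (i :* (x :* y) :* q) := i :* x :* y :* (d :* q)) refl
             (ℕtoℚ (degree α)) (inv! (suc m)) (c K) (c K ^ℚ m) P ⟩
      inv! (suc m) * c K * c K ^ℚ m * (ℕtoℚ (degree α) * P)
        ≡⟨ cong (inv! (suc m) * c K * c K ^ℚ m *_) (trans (weighted (suc m)) (cong (_* P) (ℕtoℚ-* (suc m) K))) ⟩
      inv! (suc m) * c K * c K ^ℚ m * (ℕtoℚ (suc m) * ℕtoℚ K * P)
        ≡⟨ solve 6 (λ i x y m k q → i :* x :* y :* (m :* k :* q) := (k :* x) :* ((m :* i) :* y :* q)) refl
             (inv! (suc m)) (c K) (c K ^ℚ m) (ℕtoℚ (suc m)) (ℕtoℚ K) P ⟩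
      θ c K * (ℕtoℚ (suc m) * inv! (suc m) * c K ^ℚ m * P)
        ≡⟨ cong (λ i → θ c K * (i * c K ^ℚ m * P)) (inv!-suc m) ⟩
      shifted m ∎
      where P = (p · (p ^· m)) α
    top : shifted n ≡ 0ℚ
    top = trans (cong (λ q → θ c K * (divided K n * q)) (^·-homogeneous K (suc n) α
        λ e → ℕ.<⇒≢ (ℕ.≤-<-trans α≤n (ℕ.<-≤-trans (ℕ.n<1+n n) (ℕ.m≤m*n (suc n) K))) e))
      (trans (cong (θ c K *_) (ℚ.*-zeroʳ (divided K n))) (ℚ.*-zeroʳ (θ c K)))

  -- `f` numbers the power sums: it starts as `suc` and becomes `f ∘ suc` past each factor, in step
  -- with the numbering of parts along a multiplicity list.
  expProduct : (ℕ → ℕ) → ℕ → Series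
  expProduct f zero    = oneS
  expProduct f (suc N) = expP (f 0) · expProduct (f ∘ suc) N

  logDerivative : (ℕ → ℕ) → ℕ → Seq
  logDerivative f zero    a = 0ℚ
  logDerivative f (suc N) a = θ c (f 0) * indicator (f 0) a + logDerivative (f ∘ suc) N a

  expProduct-degree-0 : ∀ {f} N → (∀ i → f i ≢ 0) → ∀ α → degree α ≡ 0 → expProduct f N α ≡ 1ℚ
  expProduct-degree-0     zero    f≢0 α e = oneS-degree-0 α e
  expProduct-degree-0 {f} (suc N) f≢0 α e = begin
    (expP (f 0) · expProduct (f ∘ suc) N) α     ≡⟨ splitSum-degree-0 α _ e ⟩
    expP (f 0) α * expProduct (f ∘ suc) N α     ≡⟨ cong₂ _*_ (head (f 0) (f≢0 0))
                                                     (expProduct-degree-0 N (f≢0 ∘ suc) α e) ⟩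
    1ℚ * 1ℚ                                     ≡⟨⟩
    1ℚ                                          ∎
    where
    open ≡-Reasoning
    head : ∀ k → k ≢ 0 → expP k α ≡ 1ℚ
    head zero    k≢0 = contradiction refl k≢0
    head (suc k) _   = expP-degree-0 k α e

  -- Leibniz rule: the first factor contributes θ c (f 0) p_(f 0), and the remaining factors their
  -- own logarithmic derivative by induction.
  expProduct-ode : ∀ {f} N → (∀ i → f i ≢ 0) → ∀ α → degree α ≤ n →
    θS (expProduct f N) α ≡ (primS (logDerivative f N) · expProduct f N) α
  expProduct-ode zero f≢0 α α≤n = trans (θS-oneS α) (sym (trans
    (splitSum-cong α λ β γ _ → trans (cong (_* oneS γ) (primS-0 β)) (ℚ.*-zeroˡ (oneS γ))) (splitSum-zero α)))
    where
    θS-oneS : ∀ α → θS oneS α ≡ 0ℚ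
    θS-oneS α with degree α ℕ.≟ 0
    ... | yes e = trans (cong (λ d → ℕtoℚ d * oneS α) e) (ℚ.*-zeroˡ (oneS α))
    ... | no ≢0 = trans (cong (ℕtoℚ (degree α) *_) (oneS-homogeneous α ≢0)) (ℚ.*-zeroʳ (ℕtoℚ (degree α)))
  expProduct-ode {f} (suc N) f≢0 α α≤n = begin
    θS (E · F) α
      ≡⟨ θS-· E F α ⟩
    (θS E · F) α + (E · θS F) α
      ≡⟨ cong₂ _+_
           (·-cong α (λ β β≤ → head (f 0) (f≢0 0) β (ℕ.≤-trans β≤ α≤n)) (λ γ _ → refl))
           (·-cong {E} {E} α (λ β _ → refl) (λ γ γ≤ → expProduct-ode {f ∘ suc} N (f≢0 ∘ suc) γ (ℕ.≤-trans γ≤ α≤n))) ⟩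
    (P · E · F) α + (E · (R · F)) α
      ≡⟨ cong₂ _+_ (·-assoc P E F α) swap ⟩
    (P · (E · F)) α + (R · (E · F)) α
      ≡⟨ ·-distribʳ P R (E · F) α ⟨
    (addS P R · (E · F)) α
      ≡⟨ ·-cong {addS P R} {_} {E · F} α (λ β _ → sym (trans
           (primS-+ (λ a → θ c (f 0) * indicator (f 0) a) (logDerivative (f ∘ suc) N) β)
           (cong (_+ R β) (trans (primS-* (θ c (f 0)) (indicator (f 0)) β)
             (cong (θ c (f 0) *_) (sym (pS-primS (f 0) (f≢0 0) β))))))) (λ γ _ → refl) ⟩
    (primS (logDerivative f (suc N)) · (E · F)) α ∎
    where
    open ≡-Reasoning
    E = expP (f 0)
    F = expProduct (f ∘ suc) N
    P = scaleS (θ c (f 0)) (pS (f 0))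
    R = primS (logDerivative (f ∘ suc) N)
    head : ∀ k → k ≢ 0 → ∀ β → degree β ≤ n → θS (expP k) β ≡ (scaleS (θ c k) (pS k) · expP k) β
    head zero    k≢0 = contradiction refl k≢0
    head (suc k) _   = expP-ode k
    pS-primS : ∀ k → k ≢ 0 → ∀ β → pS k β ≡ primS (indicator k) β
    pS-primS zero    k≢0 = contradiction refl k≢0
    pS-primS (suc k) _   = pS-is-primS k
    swap : (E · (R · F)) α ≡ (R · (E · F)) α
    swap = begin
      (E · (R · F)) α   ≡⟨ ·-assoc E R F α ⟨
      (E · R · F) α     ≡⟨ ·-cong {_} {_} {F} α (λ β _ → ·-comm E R β) (λ γ _ → refl) ⟩
      (R · E · F) α     ≡⟨ ·-assoc R E F α ⟩
      (R · (E · F)) α   ∎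

  logDerivative-< : ∀ {f} N o → (∀ i → f i ≡ o ℕ.+ i) → ∀ a → a < o → logDerivative f N a ≡ 0ℚ
  logDerivative-< zero    o f≡ a a<o = refl
  logDerivative-< {f} (suc N) o f≡ a a<o = trans
    (cong₂ _+_ (trans (cong (λ b → θ c (f 0) * (if b then 1ℚ else 0ℚ)) (≡ᵇ-false a (f 0)
                 (λ e → ℕ.<⇒≢ a<o (trans e (trans (f≡ 0) (ℕ.+-identityʳ o)))))) (ℚ.*-zeroʳ (θ c (f 0))))
      (logDerivative-< N (suc o) (λ i → trans (f≡ (suc i)) (ℕ.+-suc o i)) a (ℕ.m≤n⇒m≤1+n a<o)))
    (ℚ.+-identityˡ 0ℚ)

  logDerivative-range : ∀ {f} N o → (∀ i → f i ≡ o ℕ.+ i) → ∀ a → o ≤ a → a < o ℕ.+ N →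
                        logDerivative f N a ≡ θ c a
  logDerivative-range zero o f≡ a o≤a a<o =
    contradiction o≤a (ℕ.<⇒≱ (subst (a <_) (ℕ.+-identityʳ o) a<o))
  logDerivative-range {f} (suc N) o f≡ a o≤a a<o+N with a ℕ.≟ o
  ... | yes refl = begin
    θ c (f 0) * indicator (f 0) a + logDerivative (f ∘ suc) N a
      ≡⟨ cong₂ (λ k q → θ c k * indicator k a + q) (trans (f≡ 0) (ℕ.+-identityʳ a))
           (logDerivative-< N (suc a) (λ i → trans (f≡ (suc i)) (ℕ.+-suc a i)) a (ℕ.n<1+n a)) ⟩
    θ c a * indicator a a + 0ℚ
      ≡⟨ cong (λ b → θ c a * (if b then 1ℚ else 0ℚ) + 0ℚ) (≡ᵇ-true a) ⟩
    θ c a * 1ℚ + 0ℚ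
      ≡⟨ trans (ℚ.+-identityʳ _) (ℚ.*-identityʳ _) ⟩
    θ c a ∎
    where open ≡-Reasoning
  ... | no a≢o = trans
    (cong₂ _+_ (trans (cong (λ b → θ c (f 0) * (if b then 1ℚ else 0ℚ)) (≡ᵇ-false a (f 0)
                 (λ e → a≢o (trans e (trans (f≡ 0) (ℕ.+-identityʳ o)))))) (ℚ.*-zeroʳ (θ c (f 0))))
      (logDerivative-range N (suc o) (λ i → trans (f≡ (suc i)) (ℕ.+-suc o i)) a
        (ℕ.≤∧≢⇒< o≤a (a≢o ∘ sym)) (subst (a <_) (ℕ.+-suc o N) a<o+N)))
    (ℚ.+-identityˡ _)

c̄ : Seq
c̄ k = ∣ coeffK k ∣

-- In degrees at most n, the parts 1, ..., n supply all of θ c̄, so the truncated product and ∏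
-- 1/cos √x_i satisfy the same equation there.
expProduct-s : ∀ n α → degree α ≤ n → expProduct c̄ n suc n α ≡ ∏ s α
expProduct-s n = ode-unique {primS (θ c̄)} n (primS-degree-0 (θ c̄))
  (λ α e → trans (expProduct-degree-0 c̄ n n (λ _ ()) α e) (sym (∏-degree-0 α e)))
  (λ α α≤n → trans (expProduct-ode c̄ n n (λ _ ()) α α≤n) (·-cong {_} {_} {expProduct c̄ n suc n} α
    (λ β β≤ → primS-cong β λ a a< → logDerivative-range c̄ n n 1 (λ _ → refl) (suc a) (s≤s z≤n)
      (s≤s (ℕ.≤-trans a< (ℕ.≤-trans β≤ α≤n))))
    (λ γ _ → refl)))
  (λ α _ → ∏-ode (θ c̄) s refl s-ode α)
  where
  ∏-degree-0 : ∀ α → degree α ≡ 0 → ∏ s α ≡ 1ℚ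
  ∏-degree-0 []         _ = refl
  ∏-degree-0 (zero ∷ α) e = trans (ℚ.*-identityˡ (∏ s α)) (∏-degree-0 α e)

-- At `f = suc` this computes to the numbering used in `weight`, `phi` and `powerSumλ`; a general
-- `f` makes the tail of a multiplicity list accessible to induction.
numbered : (ℕ → ℕ) → List ℕ → List (ℕ × ℕ)
numbered f ms = zip (applyUpTo f (length ms)) ms

weightOf : (ℕ → ℕ) → List ℕ → ℕ
weightOf f ms = foldr ℕ._+_ 0 (map (λ p → proj₁ p ℕ.* proj₂ p) (numbered f ms))

termOf : Seq → (ℕ → ℕ) → List ℕ → ℚ
termOf c f ms = foldr _*_ 1ℚ (map (λ p → inv! (proj₂ p) * c (proj₁ p) ^ℚ proj₂ p) (numbered f ms))

powerOf : (ℕ → ℕ) → List ℕ → Series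
powerOf f ms = prodS (map (λ p → powS (pS (proj₁ p)) (proj₂ p)) (numbered f ms))

powerOf-∷ : ∀ f m ms α → powerOf f (m ∷ ms) α ≡ ((pS (f 0) ^· m) · powerOf (f ∘ suc) ms) α
powerOf-∷ f m ms α = trans (mulS-splitSum (powS (pS (f 0)) m) (powerOf (f ∘ suc) ms) α)
  (splitSum-cong α λ β γ _ → cong (_* powerOf (f ∘ suc) ms γ) (powS-^· (pS (f 0)) m β))

powerOf-homogeneous : ∀ f ms → Homogeneous (weightOf f ms) (powerOf f ms)
powerOf-homogeneous f []       = oneS-homogeneous
powerOf-homogeneous f (m ∷ ms) α ≢w = trans (powerOf-∷ f m ms α)
  (·-homogeneous {m ℕ.* f 0} {weightOf (f ∘ suc) ms} {pS (f 0) ^· m} {powerOf (f ∘ suc) ms}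
    (^·-homogeneous (f 0) m) (powerOf-homogeneous (f ∘ suc) ms) α
    λ e → ≢w (trans e (cong (ℕ._+ weightOf (f ∘ suc) ms) (ℕ.*-comm m (f 0)))))

-- Choosing one term from each exponential amounts to choosing a multiplicity list; the cut-off at
-- exponent n matches the entries 0, ..., n of `allLists (suc n)`.
expProduct-expand : ∀ c n f N α →
  ∑ (allLists (suc n) N) (λ ms → termOf c f ms * powerOf f ms α) ≡ expProduct c n f N α
expProduct-expand c n f zero    α = trans (ℚ.+-identityʳ _) (ℚ.*-identityˡ (oneS α))
expProduct-expand c n f (suc N) α = begin
  ∑ (concatMap (λ m → map (m ∷_) ls) (upTo (suc n))) term
    ≡⟨ ∑-concatMap (upTo (suc n)) (λ m → map (m ∷_) ls) term ⟩
  ∑ (upTo (suc n)) (λ m → ∑ (map (m ∷_) ls) term)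
    ≡⟨ ∑-cong (upTo (suc n)) (λ m → trans (∑-map ls (m ∷_) term) (inner m)) ⟩
  ∑ (upTo (suc n)) (λ m → d m * ((p ^· m) · F) α)
    ≡⟨ ∑-cong (upTo (suc n)) (λ m → cong (d m *_) (·-comm (p ^· m) F α)) ⟩
  ∑ (upTo (suc n)) (λ m → d m * (F · (p ^· m)) α)
    ≡⟨ ·-∑ F (upTo (suc n)) d (p ^·_) α ⟨
  (F · expP c n (f 0)) α
    ≡⟨ ·-comm F (expP c n (f 0)) α ⟩
  expProduct c n f (suc N) α ∎
  where
  open ≡-Reasoning
  ls = allLists (suc n) N
  p = pS (f 0)
  d = divided c n (f 0)
  F = expProduct c n (f ∘ suc) N
  term : List ℕ → ℚ
  term ms = termOf c f ms * powerOf f ms α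
  inner : ∀ m → ∑ ls (λ ms → term (m ∷ ms)) ≡ d m * ((p ^· m) · F) α
  inner m = begin
    ∑ ls (λ ms → d m * termOf c (f ∘ suc) ms * powerOf f (m ∷ ms) α)
      ≡⟨ ∑-cong ls (λ ms → trans (cong (d m * termOf c (f ∘ suc) ms *_) (powerOf-∷ f m ms α))
           (ℚ.*-assoc (d m) (termOf c (f ∘ suc) ms) _)) ⟩
    ∑ ls (λ ms → d m * (termOf c (f ∘ suc) ms * ((p ^· m) · powerOf (f ∘ suc) ms) α))
      ≡⟨ ∑-*ˡ ls (d m) _ ⟩
    d m * ∑ ls (λ ms → termOf c (f ∘ suc) ms * ((p ^· m) · powerOf (f ∘ suc) ms) α)
      ≡⟨ cong (d m *_) (·-∑ (p ^· m) ls (termOf c (f ∘ suc)) (powerOf (f ∘ suc)) α) ⟨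
    d m * ((p ^· m) · λ γ → ∑ ls (λ ms → termOf c (f ∘ suc) ms * powerOf (f ∘ suc) ms γ)) α
      ≡⟨ cong (d m *_) (·-cong {p ^· m} α (λ β _ → refl) (λ γ _ → expProduct-expand c n (f ∘ suc) N γ)) ⟩
    d m * ((p ^· m) · F) α ∎

∣^ℚ∣ : ∀ q m → ∣ q ^ℚ m ∣ ≡ ∣ q ∣ ^ℚ m
∣^ℚ∣ q zero    = refl
∣^ℚ∣ q (suc m) = trans (ℚ.∣p*q∣≡∣p∣*∣q∣ q (q ^ℚ m)) (cong (∣ q ∣ *_) (∣^ℚ∣ q m))

∣inv!∣ : ∀ m → ∣ inv! m ∣ ≡ inv! m
∣inv!∣ m = ℚ.0≤p⇒∣p∣≡p (ℚ.nonNegative⁻¹ (inv! m) {{ℚ.normalize-nonNeg 1 (m !) {{m ℕ.!≢0}}}})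

∣termOf∣ : ∀ c f ms → ∣ termOf c f ms ∣ ≡ termOf (λ k → ∣ c k ∣) f ms
∣termOf∣ c f []       = refl
∣termOf∣ c f (m ∷ ms) = trans (ℚ.∣p*q∣≡∣p∣*∣q∣ (inv! m * c (f 0) ^ℚ m) (termOf c (f ∘ suc) ms)) (cong₂ _*_
  (trans (ℚ.∣p*q∣≡∣p∣*∣q∣ (inv! m) (c (f 0) ^ℚ m)) (cong₂ _*_ (∣inv!∣ m) (∣^ℚ∣ (c (f 0)) m)))
  (∣termOf∣ c (f ∘ suc) ms))

∑-filterᵇ : ∀ {Y : Set} (p : Y → Bool) xs f → ∑ (filterᵇ p xs) f ≡ ∑ xs (λ x → if p x then f x else 0ℚ)
∑-filterᵇ p []       f = refl
∑-filterᵇ p (x ∷ xs) f with p x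
... | true  = cong (f x +_) (∑-filterᵇ p xs f)
... | false = trans (∑-filterᵇ p xs f) (sym (ℚ.+-identityˡ _))

-- The power sum product of `ms` lives in degree `weight ms`, so the test weight = n can be traded
-- for degree α = n, which is independent of `ms` and leaves an unrestricted sum. The factor (2n)!
-- on the right is the one inside `phi`; the outer one cancels against `inv!`.
A-product : ∀ n α → scaleS (ℕtoℚ ((2 ℕ.* n) !)) (A n) α ≡
                    ℕtoℚ ((2 ℕ.* n) !) * (indicator n (degree α) * ∏ s α)
A-product n α = begin
  K * (inv! (2 ℕ.* n) * S)
    ≡⟨ ℚ.*-assoc K (inv! (2 ℕ.* n)) S ⟨
  K * inv! (2 ℕ.* n) * S
    ≡⟨ trans (cong (_* S) (!-inv! (2 ℕ.* n))) (ℚ.*-identityˡ S) ⟩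
  S
    ≡⟨ sumS-map (λ ms → scaleS ∣ phi n ms ∣ (powerSumλ ms)) (partitionsMult n) α ⟩
  ∑ (partitionsMult n) (λ ms → ∣ phi n ms ∣ * powerSumλ ms α)
    ≡⟨ ∑-filterᵇ (λ ms → weight ms ≡ᵇ n) ls (λ ms → ∣ phi n ms ∣ * powerSumλ ms α) ⟩
  ∑ ls (λ ms → if weight ms ≡ᵇ n then ∣ phi n ms ∣ * powerSumλ ms α else 0ℚ)
    ≡⟨ ∑-cong ls by-degree ⟩
  ∑ ls (λ ms → K * I * (termOf c̄ suc ms * powerOf suc ms α))
    ≡⟨ ∑-*ˡ ls (K * I) _ ⟩
  K * I * ∑ ls (λ ms → termOf c̄ suc ms * powerOf suc ms α)
    ≡⟨ cong (K * I *_) (expProduct-expand c̄ n suc n α) ⟩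
  K * I * expProduct c̄ n suc n α
    ≡⟨ ℚ.*-assoc K I _ ⟩
  K * (I * expProduct c̄ n suc n α)
    ≡⟨ cong (K *_) at-degree ⟩
  K * (I * ∏ s α) ∎
  where
  open ≡-Reasoning
  open ℚ-Solver
  K = ℕtoℚ ((2 ℕ.* n) !)
  I = indicator n (degree α)
  ls = allLists (suc n) n
  S = sumS (map (λ ms → scaleS ∣ phi n ms ∣ (powerSumλ ms)) (partitionsMult n)) α
  at-degree : I * expProduct c̄ n suc n α ≡ I * ∏ s α
  at-degree with degree α ℕ.≟ n
  ... | yes e = cong (I *_) (expProduct-s n α (ℕ.≤-reflexive e))
  ... | no ≢n rewrite ≡ᵇ-false (degree α) n ≢n =
    trans (ℚ.*-zeroˡ (expProduct c̄ n suc n α)) (sym (ℚ.*-zeroˡ (∏ s α)))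
  phi-abs : ∀ ms → ∣ phi n ms ∣ ≡ K * termOf c̄ suc ms
  phi-abs ms = trans (ℚ.∣p*q∣≡∣p∣*∣q∣ K (termOf coeffK suc ms))
    (cong₂ _*_ (ℚ.0≤p⇒∣p∣≡p (ℕtoℚ-nonneg ((2 ℕ.* n) !))) (∣termOf∣ coeffK suc ms))
  by-degree : ∀ ms → (if weight ms ≡ᵇ n then ∣ phi n ms ∣ * powerSumλ ms α else 0ℚ) ≡
                     K * I * (termOf c̄ suc ms * powerOf suc ms α)
  by-degree ms with degree α ℕ.≟ weightOf suc ms
  ... | yes e = trans (cong (λ q → if weight ms ≡ᵇ n then q * P else 0ℚ) (phi-abs ms))
      (trans (on-if (weight ms ≡ᵇ n))
        (cong (λ d → K * indicator n d * (τ * P)) (sym e)))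
    where
    P = powerOf suc ms α
    τ = termOf c̄ suc ms
    on-if : ∀ b → (if b then K * τ * P else 0ℚ) ≡ K * (if b then 1ℚ else 0ℚ) * (τ * P)
    on-if true  = solve 3 (λ k t p → k :* t :* p := k :* con 1ℚ :* (t :* p)) refl K τ P
    on-if false = solve 3 (λ k t p → con 0ℚ := k :* con 0ℚ :* (t :* p)) refl K τ P
  ... | no ≢w = trans (on-if (weight ms ≡ᵇ n)) (sym (trans (cong (λ q → K * I * (termOf c̄ suc ms * q)) P≡0)
      (trans (cong (K * I *_) (ℚ.*-zeroʳ (termOf c̄ suc ms))) (ℚ.*-zeroʳ (K * I)))))
    where
    P≡0 : powerOf suc ms α ≡ 0ℚ
    P≡0 = powerOf-homogeneous suc ms α ≢w
    on-if : ∀ b → (if b then ∣ phi n ms ∣ * powerSumλ ms α else 0ℚ) ≡ 0ℚ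
    on-if true  = trans (cong (∣ phi n ms ∣ *_) P≡0) (ℚ.*-zeroʳ ∣ phi n ms ∣)
    on-if false = refl

-- Matchings and words

-- Each element of `xs` uses up one partner in `ys`, and injectivity keeps the partners of the
-- others among what remains. With a relation in place of a function, partners may be built from
-- membership proofs.
length-≤ : ∀ {X Y : Set} (R : X → Y → Set) {xs : List X} {ys : List Y} → Unique xs →
           (∀ {x} → x ∈ xs → ∃ λ y → y ∈ ys × R x y) →
           (∀ {x x′ y} → R x y → R x′ y → x ≡ x′) → length xs ≤ length ys
length-≤ R []          total inj = z≤n
length-≤ R {x ∷ xs} {ys} (x∉xs ∷ xs!) total inj
  with y , y∈ys , Rxy ← total (here refl)
  with as , bs , refl ← ∈-∃++ y∈ys = subst (suc (length xs) ≤_) (sym length-ys)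
    (s≤s (length-≤ R xs! rest inj))
  where
  length-ys : length (as ++ [ y ] ++ bs) ≡ suc (length (as ++ bs))
  length-ys = trans (List.length-++ as) (trans (ℕ.+-suc (length as) (length bs)) (cong suc (sym (List.length-++ as))))
  rest : ∀ {x′} → x′ ∈ xs → ∃ λ y′ → y′ ∈ as ++ bs × R x′ y′
  rest x′∈xs with total (there x′∈xs)
  ... | y′ , y′∈ys , Rx′y′ with ∈-++⁻ as y′∈ys
  ... | inj₁ y′∈as         = y′ , ∈-++⁺ˡ y′∈as , Rx′y′
  ... | inj₂ (here refl)   = contradiction (inj Rxy Rx′y′) (All.lookup x∉xs x′∈xs)
  ... | inj₂ (there y′∈bs) = y′ , ∈-++⁺ʳ as y′∈bs , Rx′y′

countB-++ : ∀ {Y : Set} (p : Y → Bool) xs ys → countB p (xs ++ ys) ≡ countB p xs ℕ.+ countB p ys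
countB-++ p xs ys = trans (cong length (List.filter-++ (T? ∘ p) xs ys)) (List.length-++ (filterᵇ p xs))

countB-map : ∀ {Y Z : Set} (p : Z → Bool) (f : Y → Z) xs → countB p (map f xs) ≡ countB (p ∘ f) xs
countB-map p f []       = refl
countB-map p f (x ∷ xs) with p (f x)
... | true  = cong suc (countB-map p f xs)
... | false = countB-map p f xs

countB-partition : ∀ {Y : Set} (p q : Y → Bool) xs →
  countB p xs ≡ countB p (filterᵇ q xs) ℕ.+ countB p (filterᵇ (not ∘ q) xs)
countB-partition p q []       = refl
countB-partition p q (x ∷ xs) with q x
... | true  with p x
...   | true  = cong suc (countB-partition p q xs)
...   | false = countB-partition p q xs
countB-partition p q (x ∷ xs) | false with p x
...   | true  = trans (cong suc (countB-partition p q xs)) (sym (ℕ.+-suc _ _))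
...   | false = countB-partition p q xs

module _ {N : ℕ} where

  IsMatching : (Fin N → Fin N) → Set
  IsMatching σ = ∀ i → σ (σ i) ≡ i × σ i ≢ i

  openers : (Fin N → Fin N) → List (Fin N)
  openers σ = filterᵇ (λ i → toℕ i <ᵇ toℕ (σ i)) (allFin N)

  -- The word f colours the edges of σ, and every colour class is a chain of P_σ.
  record Compatible (σ : Fin N → Fin N) (f : Fin N → ℕ) : Set where
    field
      colour : ∀ i → f (σ i) ≡ f i
      chain  : ∀ {i j} → i Fin.< σ i → j Fin.< σ j → i Fin.< j → f i ≡ f j → σ i Fin.< j

  ∈-openers⁺ : ∀ σ {i} → i Fin.< σ i → i ∈ openers σ
  ∈-openers⁺ σ i<σi = ∈-filter⁺ (λ i → T? (toℕ i <ᵇ toℕ (σ i))) (∈-allFin _) (ℕ.<⇒<ᵇ i<σi)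

  ∈-openers⁻ : ∀ σ {i} → i ∈ openers σ → i Fin.< σ i
  ∈-openers⁻ σ {i} i∈ = ℕ.<ᵇ⇒< (toℕ i) (toℕ (σ i))
    (proj₂ (∈-filter⁻ (λ i → T? (toℕ i <ᵇ toℕ (σ i))) {xs = allFin N} i∈))

  opener-or-closer : ∀ {σ} → IsMatching σ → ∀ i → i Fin.< σ i ⊎ σ i Fin.< i
  opener-or-closer {σ} m i with Fin.<-cmp i (σ i)
  ... | tri< lt _ _ = inj₁ lt
  ... | tri≈ _ eq _ = contradiction (sym eq) (proj₂ (m i))
  ... | tri> _ _ gt = inj₂ gt

  -- σ exchanges the two ends of every edge and preserves q, so openers and closers satisfying q are
  -- equally many.
  countB-openers : ∀ {σ} → IsMatching σ → ∀ q → (∀ i → q (σ i) ≡ q i) →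
                   countB q (allFin N) ≡ 2 ℕ.* countB q (openers σ)
  countB-openers {σ} m q q-σ = trans (countB-partition q opens (allFin N)) (cong (countB q (openers σ) ℕ.+_)
    (trans (ℕ.≤-antisym
        (length-≤ R (unique (not ∘ opens)) to-opener inj) (length-≤ R (unique opens) to-closer inj))
      (sym (ℕ.+-identityʳ _))))
    where
    opens : Fin N → Bool
    opens i = toℕ i <ᵇ toℕ (σ i)
    R : Fin N → Fin N → Set
    R i j = σ i ≡ j
    inj : ∀ {i j k} → R i k → R j k → i ≡ j
    inj {i} {j} refl e = trans (sym (proj₁ (m i))) (trans (cong σ (sym e)) (proj₁ (m j)))
    unique : ∀ o → Unique (filterᵇ q (filterᵇ o (allFin N)))
    unique o = Unique.filter⁺ (T? ∘ q) (Unique.filter⁺ (T? ∘ o) (Unique.allFin⁺ N))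
    ∈⁺ : ∀ {i} o → T (q i) → T (o i) → i ∈ filterᵇ q (filterᵇ o (allFin N))
    ∈⁺ o qi oi = ∈-filter⁺ (T? ∘ q) (∈-filter⁺ (T? ∘ o) (∈-allFin _) oi) qi
    ∈⁻ : ∀ {i} o → i ∈ filterᵇ q (filterᵇ o (allFin N)) → T (q i) × T (o i)
    ∈⁻ o i∈ with i∈′ , qi ← ∈-filter⁻ (T? ∘ q) {xs = filterᵇ o (allFin N)} i∈ =
      qi , proj₂ (∈-filter⁻ (T? ∘ o) {xs = allFin N} i∈′)
    T-not : ∀ {b} → ¬ T b → T (not b)
    T-not {true}  ¬b = ¬b tt
    T-not {false} ¬b = tt
    not-T : ∀ {b} → T (not b) → ¬ T b
    not-T {false} _ ()
    to-closer : ∀ {i} → i ∈ filterᵇ q (filterᵇ opens (allFin N)) →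
                ∃ λ j → j ∈ filterᵇ q (filterᵇ (not ∘ opens) (allFin N)) × R i j
    to-closer {i} i∈ with qi , oi ← ∈⁻ opens i∈ = σ i , ∈⁺ (not ∘ opens) (subst T (sym (q-σ i)) qi)
      (T-not λ o → ℕ.<-asym (ℕ.<ᵇ⇒< (toℕ i) (toℕ (σ i)) oi)
        (subst (λ j → toℕ (σ i) < toℕ j) (proj₁ (m i)) (ℕ.<ᵇ⇒< (toℕ (σ i)) (toℕ (σ (σ i))) o))) , refl
    to-opener : ∀ {i} → i ∈ filterᵇ q (filterᵇ (not ∘ opens) (allFin N)) →
                ∃ λ j → j ∈ filterᵇ q (filterᵇ opens (allFin N)) × R i j
    to-opener {i} i∈ with qi , ci ← ∈⁻ (not ∘ opens) i∈ | opener-or-closer m i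
    ... | inj₁ i<σi = contradiction (ℕ.<⇒<ᵇ i<σi) (not-T ci)
    ... | inj₂ σi<i = σ i , ∈⁺ opens (subst T (sym (q-σ i)) qi)
      (ℕ.<⇒<ᵇ (subst (λ j → toℕ (σ i) < toℕ j) (sym (proj₁ (m i))) σi<i)) , refl

  Compatible-unique : ∀ {σ τ f} → IsMatching σ → IsMatching τ → Compatible σ f → Compatible τ f → ∀ i → σ i ≡ τ i
  Compatible-unique {σ} {τ} {f} mσ mτ cσ cτ i = <-rec
    (λ k → ∀ i → toℕ i ≡ k → σ i ≡ τ i) (λ k ih i e → step i λ j j<i → ih (subst (toℕ j <_) e j<i) j refl) (toℕ i) i refl
    where
    not-shorter : ∀ {σ τ} → IsMatching σ → IsMatching τ → Compatible σ f → Compatible τ f →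
      ∀ i → (∀ j → j Fin.< i → σ j ≡ τ j) → i Fin.< σ i → i Fin.< τ i → ¬ (σ i Fin.< τ i)
    not-shorter {σ} {τ} mσ mτ cσ cτ i ih i<σi i<τi σi<τi with opener-or-closer mτ (σ i)
    ... | inj₁ x-opens = ℕ.<-asym σi<τi
      (Compatible.chain cτ i<τi x-opens i<σi (sym (Compatible.colour cσ i)))
    ... | inj₂ z<x with Fin.<-cmp (τ (σ i)) i
    ...   | tri< z<i _ _ = ℕ.<⇒≢ z<i (cong toℕ (trans (sym (proj₁ (mσ (τ (σ i)))))
              (trans (cong σ (trans (ih _ z<i) (proj₁ (mτ (σ i))))) (proj₁ (mσ i)))))
    ...   | tri≈ _ z≡i _ = ℕ.<⇒≢ σi<τi (cong toℕ (trans (sym (proj₁ (mτ (σ i)))) (cong τ z≡i)))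
    ...   | tri> _ _ i<z = ℕ.<-asym σi<τi (ℕ.<-trans (Compatible.chain cτ i<τi
              (subst (τ (σ i) Fin.<_) (sym (proj₁ (mτ (σ i)))) z<x) i<z
              (sym (trans (Compatible.colour cτ (σ i)) (Compatible.colour cσ i)))) z<x)
    step : ∀ i → (∀ j → j Fin.< i → σ j ≡ τ j) → σ i ≡ τ i
    step i ih with opener-or-closer mσ i | opener-or-closer mτ i
    ... | inj₂ σi<i | _         = trans (sym (proj₁ (mτ (σ i)))) (cong τ (trans (sym (ih (σ i) σi<i)) (proj₁ (mσ i))))
    ... | inj₁ _    | inj₂ τi<i = sym (trans (sym (proj₁ (mσ (τ i)))) (cong σ (trans (ih (τ i) τi<i) (proj₁ (mτ i)))))
    ... | inj₁ i<σi | inj₁ i<τi with Fin.<-cmp (σ i) (τ i)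
    ...   | tri< lt _ _ = contradiction lt (not-shorter mσ mτ cσ cτ i ih i<σi i<τi)
    ...   | tri≈ _ eq _ = eq
    ...   | tri> _ _ gt = contradiction gt (not-shorter mτ mσ cτ cσ i (λ j j<i → sym (ih j j<i)) i<τi i<σi)

-- Building the matching by reading the word from left to right

module Scan (f : ℕ → ℕ) where

  occurrences : ℕ → ℕ → ℕ
  occurrences m c = countB (λ x → x ≡ᵇ c) (applyUpTo f m)

  occurrences-suc : ∀ m c → occurrences (suc m) c ≡ occurrences m c ℕ.+ countB (λ x → x ≡ᵇ c) [ f m ]
  occurrences-suc m c = trans (cong (countB (λ x → x ≡ᵇ c)) (sym (List.applyUpTo-∷ʳ f m)))
    (countB-++ (λ x → x ≡ᵇ c) (applyUpTo f m) [ f m ])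

  occurrences-≡ : ∀ m → occurrences (suc m) (f m) ≡ suc (occurrences m (f m))
  occurrences-≡ m rewrite occurrences-suc m (f m) | Equivalence.to Bool.T-≡ (ℕ.≡⇒≡ᵇ (f m) (f m) refl) =
    ℕ.+-comm _ 1

  occurrences-≢ : ∀ m c → f m ≢ c → occurrences (suc m) c ≡ occurrences m c
  occurrences-≢ m c ≢c rewrite occurrences-suc m c with f m ≡ᵇ c in eq
  ... | false = ℕ.+-identityʳ _
  ... | true  = contradiction (ℕ.≡ᵇ⇒≡ (f m) c (subst T (sym eq) tt)) ≢c

  -- A matching of the first m positions with at most one unmatched position per
  -- colour; the unmatched positions are the fixed points of σ.
  record Prefix (m : ℕ) : Set where
    field
      σ      : ℕ → ℕ
      bound  : ∀ {i} → i < m → σ i < m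
      invol  : ∀ {i} → i < m → σ (σ i) ≡ i
      colour : ∀ {i} → i < m → f (σ i) ≡ f i
      -- A fixed point counts as an opener here, and the strict `i < σ i` forbids any later opener
      -- of its colour; hence at most one position per colour is open.
      chain  : ∀ {i j} → j < m → i ≤ σ i → j ≤ σ j → i < j → f i ≡ f j → i < σ i × σ i < j
      parity : ∀ c → (∃ λ k → occurrences m c ≡ 2 ℕ.* k × (∀ {i} → i < m → f i ≡ c → σ i ≢ i))
                   ⊎ (∃ λ k → occurrences m c ≡ suc (2 ℕ.* k) × ∃ λ v → v < m × f v ≡ c × σ v ≡ v)

  -- Position m is paired with v. The choice v = m leaves it open and requires that no open position
  -- has its colour (`fresh`); the choice v < m closes the open position v (`fixed`).
  module Extend {m} (P : Prefix m) (v : ℕ) (v≤m : v ≤ m) (fv≡fm : f v ≡ f m)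
    (fixed : v < m → Prefix.σ P v ≡ v)
    (fresh : v ≡ m → ∀ {i} → i < m → f i ≡ f m → Prefix.σ P i ≢ i) where
    open Prefix P

    σ′ : ℕ → ℕ
    σ′ i with i ℕ.≟ m
    ... | yes _ = v
    ... | no  _ with i ℕ.≟ v
    ...   | yes _ = m
    ...   | no  _ = σ i

    σ′-m : σ′ m ≡ v
    σ′-m with m ℕ.≟ m
    ... | yes _  = refl
    ... | no m≢m = contradiction refl m≢m

    σ′-v : σ′ v ≡ m
    σ′-v with v ℕ.≟ m
    ... | yes v≡m = v≡m
    ... | no  _ with v ℕ.≟ v
    ...   | yes _  = refl
    ...   | no v≢v = contradiction refl v≢v

    σ′-other : ∀ {i} → i ≢ m → i ≢ v → σ′ i ≡ σ i
    σ′-other {i} i≢m i≢v with i ℕ.≟ m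
    ... | yes i≡m = contradiction i≡m i≢m
    ... | no  _ with i ℕ.≟ v
    ...   | yes i≡v = contradiction i≡v i≢v
    ...   | no  _   = refl

    data Position (i : ℕ) : Set where
      new     : i ≡ m → σ′ i ≡ v → Position i
      partner : i ≡ v → v < m → σ′ i ≡ m → Position i
      old     : i < m → i ≢ v → σ′ i ≡ σ i → Position i

    position : ∀ {i} → i < suc m → Position i
    position {i} (s≤s i≤m) with i ℕ.≟ m | i ℕ.≟ v
    ... | yes refl | _        = new refl σ′-m
    ... | no i≢m   | yes refl = partner refl (ℕ.≤∧≢⇒< i≤m i≢m) σ′-v
    ... | no i≢m   | no i≢v   = old (ℕ.≤∧≢⇒< i≤m i≢m) i≢v (σ′-other i≢m i≢v)

    bound′ : ∀ {i} → i < suc m → σ′ i < suc m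
    bound′ i<1+m with position i<1+m
    ... | new _ e       = subst (_< suc m) (sym e) (s≤s v≤m)
    ... | partner _ _ e = subst (_< suc m) (sym e) ℕ.≤-refl
    ... | old i<m _ e   = subst (_< suc m) (sym e) (ℕ.m≤n⇒m≤1+n (bound i<m))

    invol′ : ∀ {i} → i < suc m → σ′ (σ′ i) ≡ i
    invol′ i<1+m with position i<1+m
    ... | new refl e       = trans (cong σ′ e) σ′-v
    ... | partner refl _ e = trans (cong σ′ e) σ′-m
    ... | old i<m i≢v e    = trans (cong σ′ e) (trans (σ′-other (ℕ.<⇒≢ (bound i<m)) λ σi≡v →
        i≢v (trans (sym (invol i<m)) (trans (cong σ σi≡v) (fixed (subst (_< m) σi≡v (bound i<m))))))
      (invol i<m))

    colour′ : ∀ {i} → i < suc m → f (σ′ i) ≡ f i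
    colour′ i<1+m with position i<1+m
    ... | new refl e       = trans (cong f e) fv≡fm
    ... | partner refl _ e = trans (cong f e) (sym fv≡fm)
    ... | old i<m _ e      = trans (cong f e) (colour i<m)

    chain′ : ∀ {i j} → j < suc m → i ≤ σ′ i → j ≤ σ′ j → i < j → f i ≡ f j → i < σ′ i × σ′ i < j
    chain′ {i} {j} j<1+m i≤ j≤ i<j fi≡fj with position j<1+m | position (ℕ.<-trans i<j j<1+m)
    ... | new refl e | new refl _ = contradiction i<j (ℕ.<-irrefl refl)
    ... | new refl e | partner refl v<m _ = contradiction (subst (m ≤_) e j≤) (ℕ.<⇒≱ v<m)
    -- Position m is an opener only if v = m, and then `fresh` says that the edge at i is already
    -- closed.
    ... | new refl e | old i<m i≢v e′ rewrite e′ =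
      ℕ.≤∧≢⇒< i≤ (fresh (ℕ.≤-antisym v≤m (subst (m ≤_) e j≤)) i<m fi≡fj ∘ sym) , bound i<m
    ... | partner refl v<m _ | new refl _       = contradiction v<m (ℕ.<-asym i<j)
    ... | partner refl v<m _ | partner refl _ _ = contradiction i<j (ℕ.<-irrefl refl)
    ... | partner refl v<m _ | old i<m i≢v e′ rewrite e′ =
      chain v<m i≤ (ℕ.≤-reflexive (sym (fixed v<m))) i<j fi≡fj
    ... | old j<m j≢v e | new refl _ = contradiction j<m (ℕ.<-asym i<j)
    -- No opener of this colour follows the open position v, so closing v at m encloses none.
    ... | old j<m j≢v e | partner refl v<m _ = contradiction
      (proj₁ (chain j<m (ℕ.≤-reflexive (sym (fixed v<m))) (subst (j ≤_) e j≤) i<j fi≡fj))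
      (ℕ.<-irrefl (sym (fixed v<m)))
    ... | old j<m j≢v e | old i<m i≢v e′ rewrite e′ = chain j<m i≤ (subst (j ≤_) e j≤) i<j fi≡fj

    parity-other : ∀ c → f m ≢ c →
      (∃ λ k → occurrences (suc m) c ≡ 2 ℕ.* k × (∀ {i} → i < suc m → f i ≡ c → σ′ i ≢ i)) ⊎
      (∃ λ k → occurrences (suc m) c ≡ suc (2 ℕ.* k) × ∃ λ v → v < suc m × f v ≡ c × σ′ v ≡ v)
    parity-other c fm≢c with parity c
    ... | inj₁ (k , e , no-fixed) = inj₁ (k , trans (occurrences-≢ m c fm≢c) e , no-fixed′)
      where
      no-fixed′ : ∀ {i} → i < suc m → f i ≡ c → σ′ i ≢ i
      no-fixed′ i<1+m fi≡c with position i<1+m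
      ... | new refl _       = contradiction fi≡c fm≢c
      ... | partner refl _ _ = contradiction (trans (sym fv≡fm) fi≡c) fm≢c
      ... | old i<m _ e′ rewrite e′ = no-fixed i<m fi≡c
    ... | inj₂ (k , e , w , w<m , fw≡c , σw≡w) = inj₂ (k , trans (occurrences-≢ m c fm≢c) e ,
      w , ℕ.m≤n⇒m≤1+n w<m , fw≡c ,
      trans (σ′-other (ℕ.<⇒≢ w<m) (λ { refl → fm≢c (trans (sym fv≡fm) fw≡c) })) σw≡w)

    extend : ((∃ λ k → occurrences (suc m) (f m) ≡ 2 ℕ.* k × (∀ {i} → i < suc m → f i ≡ f m → σ′ i ≢ i)) ⊎
              (∃ λ k → occurrences (suc m) (f m) ≡ suc (2 ℕ.* k) × ∃ λ v → v < suc m × f v ≡ f m × σ′ v ≡ v)) →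
             Prefix (suc m)
    extend parity-m = record
      { σ = σ′ ; bound = bound′ ; invol = invol′ ; colour = colour′ ; chain = chain′ ; parity = parity′ }
      where
      parity′ : ∀ c →
        (∃ λ k → occurrences (suc m) c ≡ 2 ℕ.* k × (∀ {i} → i < suc m → f i ≡ c → σ′ i ≢ i)) ⊎
        (∃ λ k → occurrences (suc m) c ≡ suc (2 ℕ.* k) × ∃ λ v → v < suc m × f v ≡ c × σ′ v ≡ v)
      parity′ c with f m ℕ.≟ c
      ... | yes refl = parity-m
      ... | no fm≢c  = parity-other c fm≢c

  -- The parity of the earlier occurrences of the letter at m decides: if even, m is left open; if
  -- odd, m closes the unique open position of its colour.
  prefix : ∀ m → Prefix m
  prefix zero = record
    { σ = id ; bound = λ () ; invol = λ () ; colour = λ () ; chain = λ () ; parity = λ c → inj₁ (0 , refl , λ ()) }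
  prefix (suc m) with Prefix.parity (prefix m) (f m)
  ... | inj₁ (k , e , no-fixed) = extend (inj₂ (k , trans (occurrences-≡ m) (cong suc e) , m , ℕ.≤-refl , refl , σ′-m))
    where open Extend (prefix m) m ℕ.≤-refl refl (λ m<m → contradiction m<m (ℕ.<-irrefl refl)) (λ _ → no-fixed)
  ... | inj₂ (k , e , v , v<m , fv≡fm , σv≡v) = extend (inj₁
      (suc k , trans (occurrences-≡ m) (trans (cong suc e) (sym (ℕ.*-suc 2 k))) , no-fixed))
    where
    open Prefix (prefix m)
    open Extend (prefix m) v (ℕ.<⇒≤ v<m) fv≡fm (λ _ → σv≡v) (λ v≡m → contradiction v≡m (ℕ.<⇒≢ v<m))
    no-fixed : ∀ {i} → i < suc m → f i ≡ f m → σ′ i ≢ i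
    no-fixed {i} i<1+m fi≡fm σ′i≡i with position i<1+m
    ... | new refl e′         = ℕ.<⇒≢ v<m (trans (sym e′) σ′i≡i)
    ... | partner refl v<m e′ = ℕ.<⇒≢ v<m (trans (sym σ′i≡i) e′)
    -- A second open position of this colour besides v would violate `chain`.
    ... | old i<m i≢v e′ with ℕ.<-cmp i v
    ...   | tri≈ _ i≡v _ = i≢v i≡v
    ...   | tri< i<v _ _ = ℕ.<-irrefl (trans (sym σ′i≡i) e′)
              (proj₁ (chain v<m (ℕ.≤-reflexive (trans (sym σ′i≡i) e′)) (ℕ.≤-reflexive (sym σv≡v)) i<v
                (trans fi≡fm (sym fv≡fm))))
    ...   | tri> _ _ v<i = ℕ.<-irrefl (sym σv≡v)
              (proj₁ (chain i<m (ℕ.≤-reflexive (sym σv≡v)) (ℕ.≤-reflexive (trans (sym σ′i≡i) e′)) v<i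
                (trans fv≡fm (sym fi≡fm))))

odd≢even : ∀ j k → suc (2 ℕ.* j) ≢ 2 ℕ.* k
odd≢even j       zero    ()
odd≢even zero    (suc k) e = ℕ.0≢1+n (ℕ.suc-injective (trans e (ℕ.*-suc 2 k)))
odd≢even (suc j) (suc k) e = odd≢even j k (ℕ.suc-injective (ℕ.suc-injective
  (trans (cong suc (sym (ℕ.*-suc 2 j))) (trans e (ℕ.*-suc 2 k)))))

-- After the whole word has been read, an open position would mean an odd number of occurrences of
-- its colour.
Compatible-exists : ∀ {N} (f : ℕ → ℕ) →
  (∀ {i} → i < N → ∃ λ k → countB (λ x → x ≡ᵇ f i) (applyUpTo f N) ≡ 2 ℕ.* k) →
  ∃ λ (σ : Fin N → Fin N) → IsMatching σ × Compatible σ (f ∘ toℕ)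
Compatible-exists {N} f even = σF , matching , record { colour = colourF ; chain = chainF }
  where
  open Scan f
  open Prefix (prefix N)
  σF : Fin N → Fin N
  σF i = fromℕ< (bound (Fin.toℕ<n i))
  toℕ-σF : ∀ i → toℕ (σF i) ≡ σ (toℕ i)
  toℕ-σF i = Fin.toℕ-fromℕ< (bound (Fin.toℕ<n i))
  no-fixed : ∀ i → i < N → σ i ≢ i
  no-fixed i i<N σi≡i with parity (f i)
  ... | inj₁ (_ , _ , nf) = nf i<N refl σi≡i
  ... | inj₂ (j , e , _) with k , e′ ← even i<N = odd≢even j k (trans (sym e) e′)
  matching : IsMatching σF
  matching i = Fin.toℕ-injective (trans (toℕ-σF (σF i)) (trans (cong σ (toℕ-σF i)) (invol (Fin.toℕ<n i)))) ,
    λ e → no-fixed (toℕ i) (Fin.toℕ<n i) (trans (sym (toℕ-σF i)) (cong toℕ e))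
  colourF : ∀ i → f (toℕ (σF i)) ≡ f (toℕ i)
  colourF i = trans (cong f (toℕ-σF i)) (colour (Fin.toℕ<n i))
  chainF : ∀ {i j} → i Fin.< σF i → j Fin.< σF j → i Fin.< j → f (toℕ i) ≡ f (toℕ j) → σF i Fin.< j
  chainF {i} {j} i< j< i<j e = subst (_< toℕ j) (sym (toℕ-σF i)) (proj₂ (chain (Fin.toℕ<n j)
    (ℕ.<⇒≤ (subst (toℕ i <_) (toℕ-σF i) i<)) (ℕ.<⇒≤ (subst (toℕ j <_) (toℕ-σF j) j<)) i<j e))

T-ext : ∀ {a b} → (T a → T b) → (T b → T a) → a ≡ b
T-ext {true}  {true}  _ _ = refl
T-ext {true}  {false} f _ = contradiction (f tt) λ ()
T-ext {false} {true}  _ g = contradiction (g tt) λ ()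
T-ext {false} {false} _ _ = refl

T⇒≡ : ∀ {b} → T b → b ≡ true
T⇒≡ = Equivalence.to Bool.T-≡

∑-countB : ∀ {Y : Set} (p : Y → Bool) xs → ∑ xs (λ x → if p x then 1ℚ else 0ℚ) ≡ ℕtoℚ (countB p xs)
∑-countB p []       = refl
∑-countB p (x ∷ xs) with p x
... | true  = trans (cong (1ℚ +_) (∑-countB p xs)) (sym (ℕtoℚ-+ 1 (countB p xs)))
... | false = trans (ℚ.+-identityˡ _) (∑-countB p xs)

∑-upTo-cong : ∀ n {f g : ℕ → ℚ} → (∀ {i} → i < n → f i ≡ g i) → ∑ (upTo n) f ≡ ∑ (upTo n) g
∑-upTo-cong n {f} {g} eq = cong sumℚ (List.map-cong-local (All.applyUpTo⁺₁ id n eq))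

at : List ℕ → ℕ → ℕ
at []       _       = 0
at (b ∷ _)  zero    = b
at (_ ∷ β)  (suc i) = at β i

decrement : ℕ → List ℕ → List ℕ
decrement _       []      = []
decrement zero    (b ∷ β) = ℕ.pred b ∷ β
decrement (suc c) (b ∷ β) = b ∷ decrement c β

length-decrement : ∀ c β → length (decrement c β) ≡ length β
length-decrement zero    []      = refl
length-decrement (suc _) []      = refl
length-decrement zero    (b ∷ β) = refl
length-decrement (suc c) (b ∷ β) = cong suc (length-decrement c β)

at-decrement-≡ : ∀ c β → at (decrement c β) c ≡ ℕ.pred (at β c)
at-decrement-≡ zero    []      = refl
at-decrement-≡ (suc _) []      = refl
at-decrement-≡ zero    (b ∷ β) = refl
at-decrement-≡ (suc c) (b ∷ β) = at-decrement-≡ c β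

at-decrement-≢ : ∀ c i β → c ≢ i → at (decrement c β) i ≡ at β i
at-decrement-≢ zero    i       []      _   = refl
at-decrement-≢ (suc _) i       []      _   = refl
at-decrement-≢ zero    zero    (b ∷ β) c≢i = contradiction refl c≢i
at-decrement-≢ zero    (suc i) (b ∷ β) _   = refl
at-decrement-≢ (suc c) zero    (b ∷ β) _   = refl
at-decrement-≢ (suc c) (suc i) (b ∷ β) c≢i = at-decrement-≢ c i β (c≢i ∘ cong suc)

degree-decrement : ∀ c β {b} → at β c ≡ suc b → suc (degree (decrement c β)) ≡ degree β
degree-decrement zero    (suc b ∷ β) _ = refl
degree-decrement (suc c) (a ∷ β)     e = trans (sym (ℕ.+-suc a _)) (cong (a ℕ.+_) (degree-decrement c β e))

∏-decrement : ∀ c β {b} → at β c ≡ suc b → ∏ inv! (decrement c β) ≡ ℕtoℚ (at β c) * ∏ inv! β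
∏-decrement zero    (suc b ∷ β) _ =
  trans (cong (_* ∏ inv! β) (sym (inv!-suc b))) (ℚ.*-assoc (ℕtoℚ (suc b)) (inv! (suc b)) (∏ inv! β))
∏-decrement (suc c) (a ∷ β)     e = trans (cong (inv! a *_) (∏-decrement c β e))
  (solve 3 (λ i n p → i :* (n :* p) := n :* (i :* p)) refl (inv! a) (ℕtoℚ (at β c)) (∏ inv! β))
  where open ℚ-Solver

∑-at : ∀ β → ∑ (upTo (length β)) (λ c → ℕtoℚ (at β c)) ≡ ℕtoℚ (degree β)
∑-at []      = refl
∑-at (b ∷ β) = begin
  ℕtoℚ b + sumℚ (map (λ c → ℕtoℚ (at (b ∷ β) c)) (applyUpTo suc (length β)))
    ≡⟨ cong (λ l → ℕtoℚ b + sumℚ l) (List.map-applyUpTo suc (λ c → ℕtoℚ (at (b ∷ β) c)) (length β)) ⟩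
  ℕtoℚ b + sumℚ (applyUpTo (λ c → ℕtoℚ (at β c)) (length β))
    ≡⟨ cong (λ l → ℕtoℚ b + sumℚ l) (List.map-applyUpTo id (λ c → ℕtoℚ (at β c)) (length β)) ⟨
  ℕtoℚ b + ∑ (upTo (length β)) (λ c → ℕtoℚ (at β c))
    ≡⟨ cong (ℕtoℚ b +_) (∑-at β) ⟩
  ℕtoℚ b + ℕtoℚ (degree β)
    ≡⟨ ℕtoℚ-+ b (degree β) ⟨
  ℕtoℚ (b ℕ.+ degree β) ∎
  where open ≡-Reasoning

-- Counting words by content

multiplicity : ℕ → List ℕ → ℕ
multiplicity i = countB (λ c → c ≡ᵇ i)

HasContent : List ℕ → List ℕ → Set
HasContent β cs = ∀ {i} → i < length β → multiplicity i cs ≡ at β i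

module _ (cs : List ℕ) where

  private
    check : ℕ × ℕ → Bool
    check p = multiplicity (proj₁ p) cs ≡ᵇ proj₂ p

  andB-zip⁻ : ∀ f β → T (andB (map check (zip (applyUpTo f (length β)) β))) →
              ∀ {i} → i < length β → multiplicity (f i) cs ≡ at β i
  andB-zip⁻ f (b ∷ β) t {zero}  _       = ℕ.≡ᵇ⇒≡ _ b (proj₁ (Equivalence.to Bool.T-∧ t))
  andB-zip⁻ f (b ∷ β) t {suc i} (s≤s p) =
    andB-zip⁻ (f ∘ suc) β (proj₂ (Equivalence.to (Bool.T-∧ {check (f 0 , b)}) t)) p

  andB-zip⁺ : ∀ f β → (∀ {i} → i < length β → multiplicity (f i) cs ≡ at β i) →
              T (andB (map check (zip (applyUpTo f (length β)) β)))
  andB-zip⁺ f []      h = tt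
  andB-zip⁺ f (b ∷ β) h = Equivalence.from Bool.T-∧
    (ℕ.≡⇒≡ᵇ _ b (h (s≤s z≤n)) , andB-zip⁺ (f ∘ suc) β (λ p → h (s≤s p)))

countsB⁻ : ∀ β cs → T (countsB β cs) → HasContent β cs
countsB⁻ β cs = andB-zip⁻ cs id β

countsB⁺ : ∀ β cs → HasContent β cs → T (countsB β cs)
countsB⁺ β cs h = andB-zip⁺ cs id β h

multiplicity-∷-≡ : ∀ c cs → multiplicity c (c ∷ cs) ≡ suc (multiplicity c cs)
multiplicity-∷-≡ c cs rewrite ≡ᵇ-true c = refl

multiplicity-∷-≢ : ∀ c i cs → c ≢ i → multiplicity i (c ∷ cs) ≡ multiplicity i cs
multiplicity-∷-≢ c i cs c≢i rewrite ≡ᵇ-false c i c≢i = refl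

countsB-∷ : ∀ β c cs {b} → c < length β → at β c ≡ suc b → countsB β (c ∷ cs) ≡ countsB (decrement c β) cs
countsB-∷ β c cs c<L e = T-ext
  (λ t → countsB⁺ (decrement c β) cs λ i< →
    to (countsB⁻ β (c ∷ cs) t) (subst (_ <_) (length-decrement c β) i<))
  (λ t → countsB⁺ β (c ∷ cs) λ i< →
    from (countsB⁻ (decrement c β) cs t (subst (_ <_) (sym (length-decrement c β)) i<)))
  where
  to : HasContent β (c ∷ cs) → ∀ {i} → i < length β → multiplicity i cs ≡ at (decrement c β) i
  to h {i} i< with c ℕ.≟ i
  ... | yes refl = trans (cong ℕ.pred (trans (sym (multiplicity-∷-≡ c cs)) (h i<))) (sym (at-decrement-≡ c β))
  ... | no c≢i   = trans (sym (multiplicity-∷-≢ c i cs c≢i)) (trans (h i<) (sym (at-decrement-≢ c i β c≢i)))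
  from : ∀ {i} → multiplicity i cs ≡ at (decrement c β) i → multiplicity i (c ∷ cs) ≡ at β i
  from {i} h with c ℕ.≟ i
  ... | yes refl = trans (multiplicity-∷-≡ c cs)
    (trans (cong suc (trans h (trans (at-decrement-≡ c β) (cong ℕ.pred e)))) (sym e))
  ... | no c≢i   = trans (multiplicity-∷-≢ c i cs c≢i) (trans h (at-decrement-≢ c i β c≢i))

countsB-∷-zero : ∀ β c cs → c < length β → at β c ≡ 0 → countsB β (c ∷ cs) ≡ false
countsB-∷-zero β c cs c<L e with countsB β (c ∷ cs) in eq
... | false = refl
... | true  = contradiction
  (trans (sym (multiplicity-∷-≡ c cs)) (trans (countsB⁻ β (c ∷ cs) (subst T (sym eq) tt) c<L) e)) λ ()

degree≡0⇒at≡0 : ∀ β → degree β ≡ 0 → ∀ i → at β i ≡ 0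
degree≡0⇒at≡0 []         _ i       = refl
degree≡0⇒at≡0 (zero ∷ β) e zero    = refl
degree≡0⇒at≡0 (zero ∷ β) e (suc i) = degree≡0⇒at≡0 β e i

at≡0⇒degree≡0 : ∀ β → (∀ {i} → i < length β → at β i ≡ 0) → degree β ≡ 0
at≡0⇒degree≡0 []      h = refl
at≡0⇒degree≡0 (b ∷ β) h = cong₂ ℕ._+_ (h (s≤s z≤n)) (at≡0⇒degree≡0 β (λ p → h (s≤s p)))

-- The multinomial coefficient, by induction through the first letter c. The rest of the word has
-- content β lowered at c, and passing from 1/β_c! to 1/(β_c - 1)! yields a factor β_c. These
-- factors sum to the degree N + 1, which completes N! to (N + 1)!.
words-with-content : ∀ N β → ∑ (allLists (length β) N) (λ cs → if countsB β cs then 1ℚ else 0ℚ) ≡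
                             ℕtoℚ (N !) * (indicator N (degree β) * ∏ inv! β)
words-with-content zero β with degree β ℕ.≟ 0
... | yes e rewrite e | T⇒≡ (countsB⁺ β [] λ {i} _ → sym (degree≡0⇒at≡0 β e i)) =
  sym (trans (ℚ.*-identityˡ _) (trans (ℚ.*-identityˡ (∏ inv! β)) (∏-one β e)))
  where
  ∏-one : ∀ β → degree β ≡ 0 → ∏ inv! β ≡ 1ℚ
  ∏-one []         _ = refl
  ∏-one (zero ∷ β) e = trans (ℚ.*-identityˡ (∏ inv! β)) (∏-one β e)
... | no ≢0 rewrite ≡ᵇ-false (degree β) 0 ≢0 with countsB β [] in eq
...   | false = sym (trans (ℚ.*-identityˡ _) (ℚ.*-zeroˡ (∏ inv! β)))
...   | true  = contradiction (at≡0⇒degree≡0 β λ i< → sym (countsB⁻ β [] (subst T (sym eq) tt) i<)) ≢0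
words-with-content (suc N) β = begin
  ∑ (concatMap (λ c → map (c ∷_) ls) (upTo L)) test
    ≡⟨ ∑-concatMap (upTo L) (λ c → map (c ∷_) ls) test ⟩
  ∑ (upTo L) (λ c → ∑ (map (c ∷_) ls) test)
    ≡⟨ ∑-upTo-cong L (λ {c} c<L → trans (∑-map ls (c ∷_) test) (first-letter c c<L (at β c) refl)) ⟩
  ∑ (upTo L) (λ c → Z * ℕtoℚ (at β c))
    ≡⟨ ∑-*ˡ (upTo L) Z (λ c → ℕtoℚ (at β c)) ⟩
  Z * ∑ (upTo L) (λ c → ℕtoℚ (at β c))
    ≡⟨ cong (Z *_) (∑-at β) ⟩
  Z * ℕtoℚ (degree β)
    ≡⟨ total ⟩
  ℕtoℚ (suc N !) * (indicator (suc N) (degree β) * ∏ inv! β) ∎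
  where
  open ≡-Reasoning
  open ℚ-Solver
  L = length β
  ls = allLists L N
  Z = ℕtoℚ (N !) * (indicator (suc N) (degree β) * ∏ inv! β)
  test : List ℕ → ℚ
  test cs = if countsB β cs then 1ℚ else 0ℚ
  first-letter : ∀ c → c < L → ∀ b → at β c ≡ b → ∑ ls (λ cs → test (c ∷ cs)) ≡ Z * ℕtoℚ (at β c)
  first-letter c c<L zero e = begin
    ∑ ls (λ cs → test (c ∷ cs))
      ≡⟨ ∑-cong ls (λ cs → cong (λ b → if b then 1ℚ else 0ℚ) (countsB-∷-zero β c cs c<L e)) ⟩
    ∑ ls (λ _ → 0ℚ)
      ≡⟨ ∑-zero ls ⟩
    0ℚ
      ≡⟨ ℚ.*-zeroʳ Z ⟨
    Z * ℕtoℚ 0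
      ≡⟨ cong (λ b → Z * ℕtoℚ b) e ⟨
    Z * ℕtoℚ (at β c) ∎
  first-letter c c<L (suc b) e = begin
    ∑ ls (λ cs → test (c ∷ cs))
      ≡⟨ ∑-cong ls (λ cs → cong (λ b → if b then 1ℚ else 0ℚ) (countsB-∷ β c cs c<L e)) ⟩
    ∑ ls (λ cs → if countsB (decrement c β) cs then 1ℚ else 0ℚ)
      ≡⟨ cong (λ l → ∑ (allLists l N) (λ cs → if countsB (decrement c β) cs then 1ℚ else 0ℚ)) (length-decrement c β) ⟨
    ∑ (allLists (length (decrement c β)) N) (λ cs → if countsB (decrement c β) cs then 1ℚ else 0ℚ)
      ≡⟨ words-with-content N (decrement c β) ⟩
    ℕtoℚ (N !) * (indicator (suc N) (suc (degree (decrement c β))) * ∏ inv! (decrement c β))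
      ≡⟨ cong₂ (λ d p → ℕtoℚ (N !) * (indicator (suc N) d * p)) (degree-decrement c β e) (∏-decrement c β e) ⟩
    ℕtoℚ (N !) * (indicator (suc N) (degree β) * (ℕtoℚ (at β c) * ∏ inv! β))
      ≡⟨ solve 4 (λ n i a p → n :* (i :* (a :* p)) := n :* (i :* p) :* a) refl
           (ℕtoℚ (N !)) (indicator (suc N) (degree β)) (ℕtoℚ (at β c)) (∏ inv! β) ⟩
    Z * ℕtoℚ (at β c) ∎
  total : Z * ℕtoℚ (degree β) ≡ ℕtoℚ (suc N !) * (indicator (suc N) (degree β) * ∏ inv! β)
  total with degree β ℕ.≟ suc N
  ... | yes e = trans (ℚ.*-comm Z (ℕtoℚ (degree β))) (trans (cong (λ d → ℕtoℚ d * Z) e)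
    (trans (sym (ℚ.*-assoc (ℕtoℚ (suc N)) (ℕtoℚ (N !)) _))
          (cong (_* (indicator (suc N) (degree β) * ∏ inv! β)) (sym (ℕtoℚ-* (suc N) (N !))))))
  ... | no ≢ rewrite ≡ᵇ-false (degree β) (suc N) ≢ =
    solve 4 (λ n m p d → n :* (con 0ℚ :* p) :* d := m :* (con 0ℚ :* p)) refl
      (ℕtoℚ (N !)) (ℕtoℚ (suc N !)) (∏ inv! β) (ℕtoℚ (degree β))

-- Enumerations without repetition

module _ {X Y Z : Set} (k : X → Y → Z) (g : X → List Y) where

  -- The common shape of `allLists`, `allVecs` and the list of coloured matchings, so that
  -- membership and uniqueness are proved once.
  sections : List X → List Z
  sections = concatMap λ x → map (k x) (g x)

  ∈-sections⁺ : ∀ {xs x y} → x ∈ xs → y ∈ g x → k x y ∈ sections xs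
  ∈-sections⁺ x∈ y∈ = ∈-concatMap⁺ (λ x → map (k x) (g x)) (lose x∈ (∈-map⁺ (k _) y∈))

  ∈-sections⁻ : ∀ xs {z} → z ∈ sections xs → ∃₂ λ x y → x ∈ xs × y ∈ g x × z ≡ k x y
  ∈-sections⁻ xs z∈ with x , x∈ , z∈′ ← find (∈-concatMap⁻ (λ x → map (k x) (g x)) {xs = xs} z∈)
    with y , y∈ , e ← ∈-map⁻ (k x) z∈′ = x , y , x∈ , y∈ , e

  sections-unique : (∀ {x x′ y y′} → k x y ≡ k x′ y′ → x ≡ x′ × y ≡ y′) →
                    (∀ x → Unique (g x)) → ∀ {xs} → Unique xs → Unique (sections xs)
  sections-unique inj g! []           = []
  sections-unique inj g! {x ∷ xs} (x∉ ∷ xs!) = Unique.++⁺ (Unique.map⁺ (proj₂ ∘ inj) (g! x))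
    (sections-unique inj g! xs!) disjoint
    where
    disjoint : ∀ {z} → ¬ (z ∈ map (k x) (g x) × z ∈ sections xs)
    disjoint (z∈₁ , z∈₂) with _ , _ , refl ← ∈-map⁻ (k x) z∈₁
      with x′ , _ , x′∈ , _ , e ← ∈-sections⁻ xs z∈₂ = All.lookup x∉ x′∈ (proj₁ (inj e))

allLists-unique : ∀ L m → Unique (allLists L m)
allLists-unique L zero    = [] ∷ []
allLists-unique L (suc m) = sections-unique _∷_ (λ _ → allLists L m)
  (λ e → List.∷-injective e) (λ _ → allLists-unique L m) (Unique.upTo⁺ L)

∈-allLists⁺ : ∀ {L cs} → All (_< L) cs → cs ∈ allLists L (length cs)
∈-allLists⁺ []        = here refl
∈-allLists⁺ {L} {_ ∷ cs} (c< ∷ cs<) = ∈-sections⁺ _∷_ (λ _ → allLists L (length cs)) (∈-upTo⁺ c<) (∈-allLists⁺ cs<)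

∈-allLists⁻ : ∀ L m {cs} → cs ∈ allLists L m → length cs ≡ m × All (_< L) cs
∈-allLists⁻ L zero    (here refl) = refl , []
∈-allLists⁻ L (suc m) cs∈ with c , cs , c∈ , cs∈′ , refl ← ∈-sections⁻ _∷_ (λ _ → allLists L m) (upTo L) cs∈
  with e , cs< ← ∈-allLists⁻ L m cs∈′ = cong suc e , ∈-upTo⁻ c∈ ∷ cs<

allVecs-unique : ∀ m k → Unique (allVecs m k)
allVecs-unique m zero    = [] ∷ []
allVecs-unique m (suc k) = sections-unique Vec._∷_ (λ _ → allVecs m k)
  (λ e → Vec.∷-injective e) (λ _ → allVecs-unique m k) (Unique.allFin⁺ m)

∈-allVecs : ∀ {m k} (v : Vec (Fin m) k) → v ∈ allVecs m k
∈-allVecs Vec.[]                 = here refl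
∈-allVecs {m} {suc k} (i Vec.∷ v) = ∈-sections⁺ Vec._∷_ (λ _ → allVecs m k) (∈-allFin i) (∈-allVecs v)

T-not⁻ : ∀ {b} → T (not b) → ¬ T b
T-not⁻ {false} _ ()

T-not⁺ : ∀ {b} → ¬ T b → T (not b)
T-not⁺ {true}  ¬b = ¬b tt
T-not⁺ {false} ¬b = tt

module _ {m : ℕ} (σ : Vec (Fin m) m) where

  private
    involutive? fixed? : Fin m → Bool
    involutive? i = ⌊ lookup σ (lookup σ i) Fin.≟ i ⌋
    fixed? i      = ⌊ lookup σ i Fin.≟ i ⌋

  isMatchingB⁻ : T (isMatchingB σ) → IsMatching (lookup σ)
  isMatchingB⁻ t i
    with a , b ← Equivalence.to (Bool.T-∧ {involutive? i})
                   (All.lookup (All.all⁺ (λ i → involutive? i ∧ not (fixed? i)) (allFin m) t) (∈-allFin i)) =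
    toWitness {a? = lookup σ (lookup σ i) Fin.≟ i} a ,
    λ e → T-not⁻ {fixed? i} b (fromWitness {a? = lookup σ i Fin.≟ i} e)

  isMatchingB⁺ : IsMatching (lookup σ) → T (isMatchingB σ)
  isMatchingB⁺ μ = All.all⁻ (λ i → involutive? i ∧ not (fixed? i))
    (All.tabulate {xs = allFin m} λ {i} _ → Equivalence.from (Bool.T-∧ {involutive? i})
      (fromWitness {a? = lookup σ (lookup σ i) Fin.≟ i} (proj₁ (μ i)) ,
       T-not⁺ {fixed? i} λ t → proj₂ (μ i) (toWitness {a? = lookup σ i Fin.≟ i} t)))

module Edges {N : ℕ} (σ : Fin N → Fin N) (g : Fin N → ℕ) where

  edge : Fin N → ℕ × ℕ
  edge i = toℕ i , toℕ (σ i)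

  coloured : Fin N → (ℕ × ℕ) × ℕ
  coloured i = edge i , g i

  zip-coloured : ∀ xs → zip (map edge xs) (map g xs) ≡ map coloured xs
  zip-coloured []       = refl
  zip-coloured (x ∷ xs) = cong (coloured x ∷_) (zip-coloured xs)

  Chain : Fin N → Fin N → Set
  Chain i j = g i ≡ g j → σ i Fin.< j

  compatibleB : Fin N → Fin N → Bool
  compatibleB i j = not (incAdj (edge i) (edge j)) ∨ not (g i ≡ᵇ g j)

  -- Of the two ways in which the edges can be comparable, σ j < i is impossible because i < j < σ
  -- j.
  compatibleB⁻ : ∀ {i j} → i Fin.< j → j Fin.< σ j → T (compatibleB i j) → Chain i j
  compatibleB⁻ {i} {j} i<j j<σj t gi≡gj with toℕ (σ i) <ᵇ toℕ j in eq
  ... | true  = ℕ.<ᵇ⇒< _ _ (subst T (sym eq) tt)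
  ... | false with toℕ (σ j) <ᵇ toℕ i in eq′
  ...   | true  = contradiction (ℕ.<ᵇ⇒< _ _ (subst T (sym eq′) tt)) (ℕ.<-asym (ℕ.<-trans i<j j<σj))
  ...   | false = contradiction (ℕ.≡⇒≡ᵇ (g i) (g j) gi≡gj) (T-not⁻ t)

  compatibleB⁺ : ∀ {i j} → Chain i j → T (compatibleB i j)
  compatibleB⁺ {i} {j} chain with g i ≡ᵇ g j in eq
  ... | false = Equivalence.from Bool.T-∨ (inj₂ tt)
  ... | true rewrite T⇒≡ (ℕ.<⇒<ᵇ (chain (ℕ.≡ᵇ⇒≡ (g i) (g j) (subst T (sym eq) tt)))) = tt

  -- `properB` tests each edge only against those after it in the list; in increasing order these
  -- are the edges that open later.
  properB⁻ : ∀ {xs} → AllPairs Fin._<_ xs → All (λ i → i Fin.< σ i) xs → T (properB incAdj (map coloured xs)) →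
             ∀ {i j} → i ∈ xs → j ∈ xs → i Fin.< j → Chain i j
  properB⁻ {x ∷ xs} (x< ∷ sorted) (_ ∷ open-xs) t i∈ j∈ i<j
    with t₁ , t₂ ← Equivalence.to (Bool.T-∧ {allB _ (map coloured xs)}) t with i∈ | j∈
  ... | here refl  | here refl = contradiction i<j (ℕ.<-irrefl refl)
  ... | here refl  | there j∈′ = compatibleB⁻ i<j (All.lookup open-xs j∈′)
    (All.lookup (All.map⁻ (All.all⁺ _ (map coloured xs) t₁)) j∈′)
  ... | there i∈′ | here refl  = contradiction i<j (ℕ.<-asym (All.lookup x< i∈′))
  ... | there i∈′ | there j∈′  = properB⁻ sorted open-xs t₂ i∈′ j∈′ i<j

  properB⁺ : ∀ {xs} → AllPairs Fin._<_ xs → (∀ {i j} → i ∈ xs → j ∈ xs → i Fin.< j → Chain i j) →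
             T (properB incAdj (map coloured xs))
  properB⁺ []                      chain = tt
  properB⁺ {x ∷ xs} (x< ∷ sorted) chain = Equivalence.from Bool.T-∧
    (All.all⁻ _ (All.map⁺ (All.tabulate λ j∈ → compatibleB⁺ (chain (here refl) (there j∈) (All.lookup x< j∈)))) ,
     properB⁺ sorted (λ i∈ j∈ → chain (there i∈) (there j∈)))

-- Turns the list of edge colours of a colouring into a function on vertices; distinctness of the
-- positions makes the assignment consistent.
interpolate : ∀ {N} {is : List (Fin N)} cs → Unique is → length cs ≡ length is → ∃ λ (φ : Fin N → ℕ) → map φ is ≡ cs
interpolate []       []          _ = (λ _ → 0) , refl
interpolate {is = i ∷ is} (c ∷ cs) (i∉ ∷ is!) e with φ , eq ← interpolate cs is! (ℕ.suc-injective e) = φ′ ,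
  cong₂ _∷_ φ′-i (trans (List.map-cong-local (All.map φ′-other i∉)) eq)
  where
  φ′ : Fin _ → ℕ
  φ′ j with i Fin.≟ j
  ... | yes _ = c
  ... | no  _ = φ j
  φ′-i : φ′ i ≡ c
  φ′-i with i Fin.≟ i
  ... | yes _  = refl
  ... | no i≢i = contradiction refl i≢i
  φ′-other : ∀ {j} → i ≢ j → φ′ j ≡ φ j
  φ′-other {j} i≢j with i Fin.≟ j
  ... | yes i≡j = contradiction i≡j i≢j
  ... | no  _   = refl

letters : ∀ {N} → List ℕ → Fin N → ℕ
letters w i = at w (toℕ i)

map-letters : ∀ {N} w → length w ≡ N → map (letters w) (allFin N) ≡ w
map-letters w refl = trans (List.map-tabulate id (letters w)) (go w)
  where
  go : ∀ w → List.tabulate {n = length w} (letters w) ≡ w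
  go []      = refl
  go (x ∷ w) = cong (x ∷_) (go w)

applyUpTo-at : ∀ w → applyUpTo (at w) (length w) ≡ w
applyUpTo-at []      = refl
applyUpTo-at (x ∷ w) = cong (x ∷_) (applyUpTo-at w)

letters-tabulate : ∀ {N} (f : Fin N → ℕ) i → letters (List.tabulate f) i ≡ f i
letters-tabulate f Fin.zero    = refl
letters-tabulate f (Fin.suc i) = letters-tabulate (f ∘ Fin.suc) i

at-< : ∀ {L w i} → All (_< L) w → i < length w → at w i < L
at-< {i = zero}  (p ∷ _)  _       = p
at-< {i = suc i} (_ ∷ ps) (s≤s q) = at-< ps q

at-double : ∀ α i → at (map (2 ℕ.*_) α) i ≡ 2 ℕ.* at α i
at-double []      i       = refl
at-double (a ∷ α) zero    = refl
at-double (a ∷ α) (suc i) = at-double α i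

2*-injective : ∀ {a b} → 2 ℕ.* a ≡ 2 ℕ.* b → a ≡ b
2*-injective {a} {b} = ℕ.*-cancelˡ-≡ a b 2

-- The correspondence between coloured matchings and words

module ColouredMatchings (n : ℕ) (α : List ℕ) where

  N L : ℕ
  N = 2 ℕ.* n
  L = length α

  Matching : Set
  Matching = Vec (Fin N) N

  isColouring : Matching → List ℕ → Bool
  isColouring σ cs = properB incAdj (zip (edgesOf σ) cs) ∧ countsB α cs

  colourings : Matching → List (List ℕ)
  colourings σ = filterᵇ (isColouring σ) (allLists L (length (edgesOf σ)))

  colouredMatchings : List (Matching × List ℕ)
  colouredMatchings = sections _,_ colourings (matchings n)

  -- The content is 2α because a colour is recorded at both ends of each of its edges.
  words : List (List ℕ)
  words = filterᵇ (countsB (map (2 ℕ.*_) α)) (allLists L N)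

  -- The word records at each vertex the colour of its edge.
  record Encodes (w : List ℕ) (p : Matching × List ℕ) : Set where
    field
      len        : length w ≡ N
      matching   : IsMatching (lookup (proj₁ p))
      compatible : Compatible (lookup (proj₁ p)) (letters w)
      edges      : proj₂ p ≡ map (letters w) (openers (lookup (proj₁ p)))

  multiplicity-edges : ∀ w σ → length w ≡ N → IsMatching σ → Compatible {N} σ (letters w) →
    ∀ i → multiplicity i w ≡ 2 ℕ.* multiplicity i (map (letters w) (openers σ))
  multiplicity-edges w σ len μ compat i = begin
    multiplicity i w
      ≡⟨ cong (multiplicity i) (map-letters w len) ⟨
    multiplicity i (map (letters w) (allFin N))
      ≡⟨ countB-map (λ c → c ≡ᵇ i) (letters w) (allFin N) ⟩
    countB (λ v → letters w v ≡ᵇ i) (allFin N)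
      ≡⟨ countB-openers μ (λ v → letters w v ≡ᵇ i) (λ v → cong (_≡ᵇ i) (Compatible.colour compat v)) ⟩
    2 ℕ.* countB (λ v → letters w v ≡ᵇ i) (openers σ)
      ≡⟨ cong (2 ℕ.*_) (countB-map (λ c → c ≡ᵇ i) (letters w) (openers σ)) ⟨
    2 ℕ.* multiplicity i (map (letters w) (openers σ)) ∎
    where open ≡-Reasoning

  openers-sorted : ∀ σ → AllPairs Fin._<_ (openers {N} σ)
  openers-sorted σ = AllPairs.filter⁺ (λ i → T? (toℕ i <ᵇ toℕ (σ i))) (AllPairs.tabulate⁺-< id)

  openers-open : ∀ σ → All (λ i → i Fin.< σ i) (openers {N} σ)
  openers-open σ = All.tabulate (∈-openers⁻ σ)

  length-edgesOf : ∀ (σ : Matching) → length (edgesOf σ) ≡ length (openers (lookup σ))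
  length-edgesOf σ = List.length-map (λ i → toℕ i , toℕ (lookup σ i)) (openers (lookup σ))

  ∈-colourings⁺ : ∀ (σ : Matching) {w} → length w ≡ N → All (_< L) w → IsMatching (lookup σ) →
    Compatible (lookup σ) (letters w) → HasContent (map (2 ℕ.*_) α) w →
    map (letters w) (openers (lookup σ)) ∈ colourings σ
  ∈-colourings⁺ σ {w} len w< μ compat content = ∈-filter⁺ (T? ∘ isColouring σ)
    (subst (λ k → cs ∈ allLists L k) (trans (List.length-map (letters w) os) (sym (length-edgesOf σ)))
      (∈-allLists⁺ (All.map⁺ (All.tabulate λ {i} _ → at-< w< (subst (toℕ i <_) (sym len) (Fin.toℕ<n i))))))
    (Equivalence.from Bool.T-∧
      (subst (T ∘ properB incAdj) (sym (zip-coloured os)) (properB⁺ (openers-sorted (lookup σ)) λ i∈ j∈ i<j →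
         Compatible.chain compat (∈-openers⁻ (lookup σ) i∈) (∈-openers⁻ (lookup σ) j∈) i<j) ,
       countsB⁺ α cs λ {i} i<L → 2*-injective (begin
         2 ℕ.* multiplicity i cs     ≡⟨ multiplicity-edges w (lookup σ) len μ compat i ⟨
         multiplicity i w            ≡⟨ content (subst (i <_) (sym (List.length-map (2 ℕ.*_) α)) i<L) ⟩
         at (map (2 ℕ.*_) α) i       ≡⟨ at-double α i ⟩
         2 ℕ.* at α i                ∎)))
    where
    open ≡-Reasoning
    open Edges (lookup σ) (letters w)
    os = openers (lookup σ)
    cs = map (letters w) os

  encode : ∀ {w} → w ∈ words → ∃ λ p → p ∈ colouredMatchings × Encodes w p
  encode {w} w∈ with w∈′ , t ← ∈-filter⁻ (T? ∘ countsB (map (2 ℕ.*_) α)) {xs = allLists L N} w∈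
    with len , w< ← ∈-allLists⁻ L N w∈′ = (σ , cs) , ∈-sections⁺ _,_ colourings
      (∈-filter⁺ (T? ∘ isMatchingB) (∈-allVecs σ) (isMatchingB⁺ σ μ)) (∈-colourings⁺ σ len w< μ compat content) ,
      record { len = len ; matching = μ ; compatible = compat ; edges = refl }
    where
    content : HasContent (map (2 ℕ.*_) α) w
    content = countsB⁻ (map (2 ℕ.*_) α) w t
    even : ∀ {i} → i < N → ∃ λ k → multiplicity (at w i) (applyUpTo (at w) N) ≡ 2 ℕ.* k
    even {i} i<N = at α (at w i) , (begin
      multiplicity (at w i) (applyUpTo (at w) N)
        ≡⟨ cong (λ k → multiplicity (at w i) (applyUpTo (at w) k)) len ⟨
      multiplicity (at w i) (applyUpTo (at w) (length w))
        ≡⟨ cong (multiplicity (at w i)) (applyUpTo-at w) ⟩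
      multiplicity (at w i) w
        ≡⟨ content (subst (at w i <_) (sym (List.length-map (2 ℕ.*_) α)) (at-< w< (subst (i <_) (sym len) i<N))) ⟩
      at (map (2 ℕ.*_) α) (at w i)
        ≡⟨ at-double α (at w i) ⟩
      2 ℕ.* at α (at w i) ∎)
      where open ≡-Reasoning
    exists : ∃ λ (σ : Fin N → Fin N) → IsMatching σ × Compatible σ (letters w)
    exists = Compatible-exists (at w) even
    τ : Fin N → Fin N
    τ = proj₁ exists
    σ : Matching
    σ = Vec.tabulate τ
    σ≗τ : ∀ i → lookup σ i ≡ τ i
    σ≗τ = Vec.lookup∘tabulate τ
    μ : IsMatching (lookup σ)
    μ i = trans (trans (σ≗τ (lookup σ i)) (cong τ (σ≗τ i))) (proj₁ (proj₁ (proj₂ exists) i)) ,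
      λ e → proj₂ (proj₁ (proj₂ exists) i) (trans (sym (σ≗τ i)) e)
    compat : Compatible (lookup σ) (letters w)
    compat = record
      { colour = λ i → trans (cong (letters w) (σ≗τ i)) (Compatible.colour (proj₂ (proj₂ exists)) i)
      ; chain  = λ {i} {j} i< j< i<j e → subst (Fin._< j) (sym (σ≗τ i))
          (Compatible.chain (proj₂ (proj₂ exists)) (subst (i Fin.<_) (σ≗τ i) i<) (subst (j Fin.<_) (σ≗τ j) j<) i<j e)
      }
    cs : List ℕ
    cs = map (letters w) (openers (lookup σ))

  decode : ∀ {p} → p ∈ colouredMatchings → ∃ λ w → w ∈ words × Encodes w p
  decode p∈ with σ , cs , σ∈ , cs∈ , refl ← ∈-sections⁻ _,_ colourings (matchings n) p∈
    with cs∈′ , t ← ∈-filter⁻ (T? ∘ isColouring σ) {xs = allLists L (length (edgesOf σ))} cs∈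
    with len-cs , cs< ← ∈-allLists⁻ L (length (edgesOf σ)) cs∈′
    with φ , φ-cs ← interpolate cs (Unique.filter⁺ (λ i → T? (toℕ i <ᵇ toℕ (lookup σ i))) (Unique.allFin⁺ N))
                      (trans len-cs (length-edgesOf σ)) =
    w , w∈ , record { len = len ; matching = μ ; compatible = compat ; edges = cs-w }
    where
    τ : Fin N → Fin N
    τ = lookup σ
    os : List (Fin N)
    os = openers τ
    μ : IsMatching τ
    μ = isMatchingB⁻ σ (proj₂ (∈-filter⁻ (T? ∘ isMatchingB) {xs = allVecs N N} σ∈))
    -- `φ` carries the edge colours on the openers; a closer receives the colour of its opener.
    f : Fin N → ℕ
    f i with opener-or-closer μ i
    ... | inj₁ _ = φ i
    ... | inj₂ _ = φ (τ i)
    f-opener : ∀ {i} → i Fin.< τ i → f i ≡ φ i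
    f-opener {i} i<τi with opener-or-closer μ i
    ... | inj₁ _    = refl
    ... | inj₂ τi<i = contradiction i<τi (ℕ.<-asym τi<i)
    f-closer : ∀ {i} → τ i Fin.< i → f i ≡ φ (τ i)
    f-closer {i} τi<i with opener-or-closer μ i
    ... | inj₁ i<τi = contradiction i<τi (ℕ.<-asym τi<i)
    ... | inj₂ _    = refl
    w : List ℕ
    w = List.tabulate f
    w≗f : ∀ i → letters w i ≡ f i
    w≗f = letters-tabulate f
    len : length w ≡ N
    len = List.length-tabulate f
    cs-w : cs ≡ map (letters w) os
    cs-w = trans (sym φ-cs) (List.map-cong-local
      (All.map (λ {i} i<τi → trans (sym (f-opener i<τi)) (sym (w≗f i))) (openers-open τ)))
    f-τ : ∀ i → f (τ i) ≡ f i
    f-τ i with opener-or-closer μ i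
    ... | inj₁ i<τi = trans (f-closer (subst (Fin._< τ i) (sym (proj₁ (μ i))) i<τi)) (cong φ (proj₁ (μ i)))
    ... | inj₂ τi<i = f-opener (subst (τ i Fin.<_) (sym (proj₁ (μ i))) τi<i)
    t₁ : T (properB incAdj (zip (edgesOf σ) cs))
    t₁ = proj₁ (Equivalence.to (Bool.T-∧ {properB incAdj (zip (edgesOf σ) cs)}) t)
    t₂ : T (countsB α cs)
    t₂ = proj₂ (Equivalence.to (Bool.T-∧ {properB incAdj (zip (edgesOf σ) cs)}) t)
    open Edges τ (letters w)
    compat : Compatible τ (letters w)
    compat = record
      { colour = λ i → trans (w≗f (τ i)) (trans (f-τ i) (sym (w≗f i)))
      ; chain  = λ i< j< → properB⁻ (openers-sorted τ) (openers-open τ)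
          (subst (T ∘ properB incAdj) (trans (cong (zip (edgesOf σ)) cs-w) (zip-coloured os)) t₁)
          (∈-openers⁺ τ i<) (∈-openers⁺ τ j<)
      }
    opener-< : ∀ {i} → i Fin.< τ i → f i < L
    opener-< {i} i<τi = subst (_< L) (w≗f i)
      (All.lookup cs< (subst (letters w i ∈_) (sym cs-w) (∈-map⁺ (letters w) (∈-openers⁺ τ i<τi))))
    f-< : ∀ i → f i < L
    f-< i with opener-or-closer μ i
    ... | inj₁ i<τi = subst (_< L) (f-opener i<τi) (opener-< i<τi)
    ... | inj₂ τi<i = subst (_< L) (f-opener i′) (opener-< i′)
      where i′ = subst (τ i Fin.<_) (sym (proj₁ (μ i))) τi<i
    content : HasContent (map (2 ℕ.*_) α) w
    content {i} i< = begin
      multiplicity i w                               ≡⟨ multiplicity-edges w τ len μ compat i ⟩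
      2 ℕ.* multiplicity i (map (letters w) os)      ≡⟨ cong (λ cs → 2 ℕ.* multiplicity i cs) cs-w ⟨
      2 ℕ.* multiplicity i cs                        ≡⟨ cong (2 ℕ.*_) (countsB⁻ α cs t₂
                                                          (subst (i <_) (List.length-map (2 ℕ.*_) α) i<)) ⟩
      2 ℕ.* at α i                                   ≡⟨ at-double α i ⟨
      at (map (2 ℕ.*_) α) i                          ∎
      where open ≡-Reasoning
    w∈ : w ∈ words
    w∈ = ∈-filter⁺ (T? ∘ countsB (map (2 ℕ.*_) α))
      (subst (λ k → w ∈ allLists L k) len (∈-allLists⁺ (All.tabulate⁺ f-<)))
      (countsB⁺ (map (2 ℕ.*_) α) w content)

  -- The list of edge colours fixes the letters at the openers, and the matching copies them to the
  -- closers.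
  encodes-injective : ∀ {w w′ p} → Encodes w p → Encodes w′ p → w ≡ w′
  encodes-injective {w} {w′} {σ , cs} e e′ =
    trans (sym (map-letters w E.len)) (trans (List.map-cong same (allFin N)) (map-letters w′ E′.len))
    where
    module E = Encodes e
    module E′ = Encodes e′
    map-injective-local : ∀ {f g : Fin N → ℕ} {xs} → map f xs ≡ map g xs → ∀ {i} → i ∈ xs → f i ≡ g i
    map-injective-local eq (here refl) = proj₁ (List.∷-injective eq)
    map-injective-local eq (there i∈)  = map-injective-local (proj₂ (List.∷-injective eq)) i∈
    on-openers : ∀ {i} → i Fin.< lookup σ i → letters w i ≡ letters w′ i
    on-openers i< = map-injective-local (trans (sym E.edges) E′.edges) (∈-openers⁺ (lookup σ) i<)
    same : ∀ i → letters w i ≡ letters w′ i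
    same i with opener-or-closer E.matching i
    ... | inj₁ i< = on-openers i<
    ... | inj₂ i> = trans (sym (Compatible.colour E.compatible i)) (trans
      (on-openers (subst (lookup σ i Fin.<_) (sym (proj₁ (E.matching i))) i>)) (Compatible.colour E′.compatible i))

  -- The word fixes the matching by `Compatible-unique`, and the matching fixes the positions at
  -- which the edge colours are read.
  encodes-functional : ∀ {w p p′} → Encodes w p → Encodes w p′ → p ≡ p′
  encodes-functional {w} {σ , cs} {σ′ , cs′} e e′ = cong₂ _,_ σ≡σ′
    (trans E.edges (trans (cong (map (letters w) ∘ openers ∘ lookup) σ≡σ′) (sym E′.edges)))
    where
    module E = Encodes e
    module E′ = Encodes e′
    σ≡σ′ : σ ≡ σ′
    σ≡σ′ = trans (sym (Vec.tabulate∘lookup σ)) (trans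
      (Vec.tabulate-cong (Compatible-unique E.matching E′.matching E.compatible E′.compatible)) (Vec.tabulate∘lookup σ′))

  length-words : length colouredMatchings ≡ length words
  length-words = ℕ.≤-antisym
    (length-≤ (flip Encodes) coloured-unique decode encodes-functional)
    (length-≤ Encodes (Unique.filter⁺ (T? ∘ countsB (map (2 ℕ.*_) α)) (allLists-unique L N)) encode encodes-injective)
    where
    coloured-unique : Unique colouredMatchings
    coloured-unique = sections-unique _,_ colourings (λ { refl → refl , refl })
      (λ σ → Unique.filter⁺ (T? ∘ isColouring σ) (allLists-unique L (length (edgesOf σ))))
      (Unique.filter⁺ (T? ∘ isMatchingB) (allVecs-unique N N))

  length-sections : ∀ σs → ∑ σs (λ σ → ℕtoℚ (length (colourings σ))) ≡ ℕtoℚ (length (sections _,_ colourings σs))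
  length-sections []       = refl
  length-sections (σ ∷ σs) = begin
    ℕtoℚ (length (colourings σ)) + ∑ σs (λ σ → ℕtoℚ (length (colourings σ)))
      ≡⟨ cong (ℕtoℚ (length (colourings σ)) +_) (length-sections σs) ⟩
    ℕtoℚ (length (colourings σ)) + ℕtoℚ (length (sections _,_ colourings σs))
      ≡⟨ ℕtoℚ-+ (length (colourings σ)) _ ⟨
    ℕtoℚ (length (colourings σ) ℕ.+ length (sections _,_ colourings σs))
      ≡⟨ cong (λ k → ℕtoℚ (k ℕ.+ length (sections _,_ colourings σs))) (List.length-map (σ ,_) (colourings σ)) ⟨
    ℕtoℚ (length (map (σ ,_) (colourings σ)) ℕ.+ length (sections _,_ colourings σs))
      ≡⟨ cong ℕtoℚ (List.length-++ (map (σ ,_) (colourings σ))) ⟨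
    ℕtoℚ (length (sections _,_ colourings (σ ∷ σs))) ∎
    where open ≡-Reasoning

-- By definition `chromatic` counts the lists in `colourings σ`, so the sum over matchings is the
-- number of coloured matchings, hence of words of content 2α. In the multinomial coefficient
-- 1/(2α_i)! is u(α_i).
sumMatchings-product : ∀ n α → sumMatchings n α ≡ ℕtoℚ ((2 ℕ.* n) !) * (indicator n (degree α) * ∏ u α)
sumMatchings-product n α = begin
  sumMatchings n α
    ≡⟨ sumS-map XIncP (matchings n) α ⟩
  ∑ (matchings n) (λ σ → ℕtoℚ (length (colourings σ)))
    ≡⟨ length-sections (matchings n) ⟩
  ℕtoℚ (length colouredMatchings)
    ≡⟨ cong ℕtoℚ length-words ⟩
  ℕtoℚ (length words)
    ≡⟨ ∑-countB (countsB α₂) (allLists L N) ⟨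
  ∑ (allLists L N) (λ cs → if countsB α₂ cs then 1ℚ else 0ℚ)
    ≡⟨ cong (λ l → ∑ (allLists l N) (λ cs → if countsB α₂ cs then 1ℚ else 0ℚ)) (List.length-map (2 ℕ.*_) α) ⟨
  ∑ (allLists (length α₂) N) (λ cs → if countsB α₂ cs then 1ℚ else 0ℚ)
    ≡⟨ words-with-content N α₂ ⟩
  ℕtoℚ (N !) * (indicator N (degree α₂) * ∏ inv! α₂)
    ≡⟨ cong₂ (λ i p → ℕtoℚ (N !) * (i * p)) (trans (cong (indicator N) (degree-double α)) (indicator-double (degree α)))
         (∏-double α) ⟩
  ℕtoℚ (N !) * (indicator n (degree α) * ∏ u α) ∎
  where
  open ≡-Reasoning
  open ColouredMatchings n α
  α₂ = map (2 ℕ.*_) α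
  degree-double : ∀ α → degree (map (2 ℕ.*_) α) ≡ 2 ℕ.* degree α
  degree-double []      = refl
  degree-double (a ∷ α) = trans (cong (2 ℕ.* a ℕ.+_) (degree-double α)) (sym (ℕ.*-distribˡ-+ 2 a (degree α)))
  indicator-double : ∀ d → indicator (2 ℕ.* n) (2 ℕ.* d) ≡ indicator n d
  indicator-double d = cong (λ b → if b then 1ℚ else 0ℚ) (T-ext
    (λ t → ℕ.≡⇒≡ᵇ d n (2*-injective (ℕ.≡ᵇ⇒≡ (2 ℕ.* d) (2 ℕ.* n) t)))
    (λ t → ℕ.≡⇒≡ᵇ (2 ℕ.* d) (2 ℕ.* n) (cong (2 ℕ.*_) (ℕ.≡ᵇ⇒≡ d n t))))
  ∏-double : ∀ α → ∏ inv! (map (2 ℕ.*_) α) ≡ ∏ u α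
  ∏-double []      = refl
  ∏-double (a ∷ α) = cong (u a *_) (∏-double α)

theorem7p1 : (n : ℕ) → 1 ≤ n →
    IsOmegaOf (sumMatchings n) (scaleS (ℕtoℚ ((2 ℕ.* n) !)) (A n))
theorem7p1 n _ Q hyp α = trans
  (ω-product (ℕtoℚ ((2 ℕ.* n) !)) n Q (λ β → trans (hyp β) (sumMatchings-product n β)) α)
  (sym (A-product n α))
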